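{- For every $k\ge 1$ there is a constant $L$ (depending only on $k$) such that the following holds. If a Viterbi sequence for $k$-state Markov chains, arranged into prefix, periodic interior and suffix, has an interior of period $p$ with at least $L$ transitions, then the combined length (total number of transitions) of the prefix and the suffix does not exceed $kp+k-2p$.
   Context: A $k$-state Markov chain has states $0,1,\dots,k-1$, an initial distribution $(\pi_i)$ and a stochastic transition matrix $(p_{ij})$. The space $\mathcal M_k$ of all such chains is a product of $k+1$ simplices of dimension $k-1$, and carries Lebesgue measure. A sequence of length $n$ is a sequence of states $s_0s_1\cdots s_n$ (with $n$ transitions); its probability is $\Pr[s_0\cdots s_n]=\pi_{s_0}\prod_{t=1}^n p_{s_{t-1}s_t}$. A Viterbi path of length $n$ of a Markov chain is a sequence of length $n$ of maximal probability. Two Markov chains are in the same region (for given $n$) iff they have the same set of Viterbi paths of length $n$; a Viterbi region is a region of positive measure in $\mathcal M_k$. A Viterbi sequence of length $n$ is a sequence that is a Viterbi path for (the chains of) some Viterbi region. Two sequences of the same length are equivalent if they have the same initial state and the same multiset of transitions $(s_{t-1},s_t)$; any sequence equivalent to a Viterbi sequence is a rearrangement of it. Arrangement into prefix, interior, suffix: given a cycle $c_0\to c_1\to\cdots\to c_{p-1}\to c_0$ on $p$ distinct states ($1\le p\le k$), the sequence is written as $s_0\cdots s_a\cdots s_b\cdots s_n$, where the transitions from $s_a$ to $s_b$ all follow the cycle consecutively (the number $b-a$ need not be a multiple of $p$). The prefix is $s_0\cdots s_a$ ($a$ transitions), the interior is $s_a\cdots s_b$ ($b-a$ transitions, period $p$),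 and the suffix is $s_b\cdots s_n$ ($n-b$ transitions). The length of the interior is required to be maximal among all such decompositions, for this cycle, of all sequences equivalent to the given one; in particular neither the prefix nor the suffix contains a contiguous block of $p$ transitions that is a full traversal of the cycle. -}

module Defs where

open import Data.Fin.Base using (Fin; zero; suc; toℕ)
open import Data.List.Base as List using (List; []; _∷_)
open import Data.List.Relation.Binary.Permutation.Propositional using (_↭_)
open import Data.Maybe.Base using (Maybe; maybe′)
open import Data.Maybe.Relation.Unary.Any using (Any)
open import Data.Nat.Base as ℕ using (ℕ; zero; suc; pred; NonZero)
import Data.Nat.Properties as ℕ
open import Data.Nat.DivMod using (_mod_)
open import Data.Product.Base using (Σ; ∃; _×_; _,_; proj₁; proj₂)
open import Data.Rational.Base as ℚ using (ℚ; 0ℚ; 1ℚ; ½; ∣_∣)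
import Data.Rational.Properties as ℚ
open import Data.Rational.Solver using (module +-*-Solver)
open import Data.Vec.Base as Vec using (Vec; []; _∷_; head; lookup)
open import Data.Vec.Functional using (Vector; foldr)
open import Function.Bundles using (_⇔_)
open import Function.Definitions using (Injective)
open import Relation.Binary.PropositionalEquality using (_≡_; refl; sym; trans; cong; cong₂; subst)
open import Relation.Nullary.Decidable.Core using (yes; no; toWitness)
open import Relation.Nullary.Negation.Core using (¬_)

-- Reals are a setoid under _≈ℝ_, not under _≡_.

IsCauchy : (ℕ → ℚ) → Set
IsCauchy x = ∀ ε → 0ℚ ℚ.< ε →
  ∃ λ N → ∀ m n → N ℕ.≤ m → N ℕ.≤ n → ∣ x m ℚ.- x n ∣ ℚ.≤ ε

record ℝ : Set where
  constructor mkℝ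
  field
    seq    : ℕ → ℚ
    cauchy : IsCauchy seq

open ℝ public

infix 4 _≤ℝ_ _≈ℝ_

_≤ℝ_ : ℝ → ℝ → Set
x ≤ℝ y = ∀ ε → 0ℚ ℚ.< ε → ∃ λ N → ∀ n → N ℕ.≤ n → seq x n ℚ.≤ seq y n ℚ.+ ε

_≈ℝ_ : ℝ → ℝ → Set
x ≈ℝ y = x ≤ℝ y × y ≤ℝ x

-- The closure lemmas are abstract because unfolding them makes type checking intractable.
module CauchyLemmas where
  half-pos : ∀ {ε} → 0ℚ ℚ.< ε → 0ℚ ℚ.< ½ ℚ.* ε
  half-pos {ε} 0<ε = subst (ℚ._< ½ ℚ.* ε) (ℚ.*-zeroʳ ½) (ℚ.*-monoʳ-<-pos ½ 0<ε)

  halves : ∀ ε → ½ ℚ.* ε ℚ.+ ½ ℚ.* ε ≡ ε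
  halves ε = trans (sym (ℚ.*-distribʳ-+ ε ½ ½)) (ℚ.*-identityˡ ε)

  absSum : (ℕ → ℚ) → ℕ → ℚ
  absSum x zero    = 0ℚ
  absSum x (suc N) = absSum x N ℚ.+ ∣ x N ∣

  absSum-nonneg : ∀ x N → 0ℚ ℚ.≤ absSum x N
  absSum-nonneg x zero    = ℚ.≤-refl
  absSum-nonneg x (suc N) = ℚ.+-mono-≤ (absSum-nonneg x N) (ℚ.0≤∣p∣ (x N))

  p≤p+q : ∀ p {q} → 0ℚ ℚ.≤ q → p ℚ.≤ p ℚ.+ q
  p≤p+q p {q} 0≤q = subst (ℚ._≤ p ℚ.+ q) (ℚ.+-identityʳ p) (ℚ.+-monoʳ-≤ p 0≤q)

  p≤q+p : ∀ p {q} → 0ℚ ℚ.≤ q → p ℚ.≤ q ℚ.+ p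
  p≤q+p p {q} 0≤q = subst (ℚ._≤ q ℚ.+ p) (ℚ.+-identityˡ p) (ℚ.+-monoˡ-≤ p 0≤q)

  ∣x∣≤absSum : ∀ x N n → n ℕ.< N → ∣ x n ∣ ℚ.≤ absSum x N
  ∣x∣≤absSum x (suc N) n (ℕ.s≤s n≤N) with n ℕ.≟ N
  ... | yes refl = p≤q+p ∣ x n ∣ (absSum-nonneg x N)
  ... | no  n≢N  = ℚ.≤-trans (∣x∣≤absSum x N n (ℕ.≤∧≢⇒< n≤N n≢N))
                             (p≤p+q (absSum x N) (ℚ.0≤∣p∣ (x N)))

  0<1 : 0ℚ ℚ.< 1ℚ
  0<1 = toWitness {a? = 0ℚ ℚ.<? 1ℚ} _

  bounded : ∀ x → IsCauchy x → ∃ λ B → 0ℚ ℚ.< B × (∀ n → ∣ x n ∣ ℚ.≤ B)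
  bounded x cx with cx 1ℚ 0<1
  ... | N , close = B , 0<B , below
    where
    S = absSum x (suc N)
    B = S ℚ.+ 1ℚ
    0<B : 0ℚ ℚ.< B
    0<B = ℚ.+-mono-≤-< (absSum-nonneg x (suc N)) 0<1
    split : ∀ a b → a ≡ b ℚ.+ (a ℚ.- b)
    split = solve 2 (λ a b → a := b :+ (a :- b)) refl where open +-*-Solver
    below : ∀ n → ∣ x n ∣ ℚ.≤ B
    below n with N ℕ.≤? n
    ... | yes N≤n = ℚ.≤-trans
            (subst (λ z → ∣ z ∣ ℚ.≤ ∣ x N ∣ ℚ.+ ∣ x n ℚ.- x N ∣) (sym (split (x n) (x N)))
              (ℚ.∣p+q∣≤∣p∣+∣q∣ (x N) (x n ℚ.- x N)))
            (ℚ.+-mono-≤ (∣x∣≤absSum x (suc N) N ℕ.≤-refl) (close n N N≤n ℕ.≤-refl))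
    ... | no N≰n = ℚ.≤-trans (∣x∣≤absSum x (suc N) n (ℕ.m≤n⇒m≤1+n (ℕ.≰⇒> N≰n)))
                             (p≤p+q S (ℚ.<⇒≤ 0<1))

  abstract
    +-cauchy : ∀ x y → IsCauchy x → IsCauchy y → IsCauchy (λ n → x n ℚ.+ y n)
    +-cauchy x y cx cy ε 0<ε with cx _ (half-pos 0<ε) | cy _ (half-pos 0<ε)
    ... | M , closeˣ | N , closeʸ = M ℕ.⊔ N , λ m n le le′ →
      subst (λ z → ∣ z ∣ ℚ.≤ ε) (sym (regroup (x m) (y m) (x n) (y n)))
        (ℚ.≤-trans (ℚ.∣p+q∣≤∣p∣+∣q∣ (x m ℚ.- x n) (y m ℚ.- y n))
          (subst (_ ℚ.≤_) (halves ε)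
            (ℚ.+-mono-≤
              (closeˣ m n (ℕ.≤-trans (ℕ.m≤m⊔n M N) le) (ℕ.≤-trans (ℕ.m≤m⊔n M N) le′))
              (closeʸ m n (ℕ.≤-trans (ℕ.m≤n⊔m M N) le) (ℕ.≤-trans (ℕ.m≤n⊔m M N) le′)))))
      where
      regroup : ∀ a b c d → (a ℚ.+ b) ℚ.- (c ℚ.+ d) ≡ (a ℚ.- c) ℚ.+ (b ℚ.- d)
      regroup = solve 4 (λ a b c d → (a :+ b) :- (c :+ d) := (a :- c) :+ (b :- d)) refl
        where open +-*-Solver

  *-mono-∣∣ : ∀ {p q B δ} → 0ℚ ℚ.< B → ∣ p ∣ ℚ.≤ B → ∣ q ∣ ℚ.≤ δ → ∣ p ℚ.* q ∣ ℚ.≤ B ℚ.* δ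
  *-mono-∣∣ {p} {q} {B} {δ} 0<B p≤B q≤δ =
    subst (ℚ._≤ B ℚ.* δ) (sym (ℚ.∣p*q∣≡∣p∣*∣q∣ p q))
      (ℚ.≤-trans (ℚ.*-monoʳ-≤-nonNeg ∣ q ∣ {{ℚ.nonNegative (ℚ.0≤∣p∣ q)}} p≤B)
                 (ℚ.*-monoˡ-≤-nonNeg B {{ℚ.nonNegative (ℚ.<⇒≤ 0<B)}} q≤δ))

  divide : ∀ B ε → 0ℚ ℚ.< B → 0ℚ ℚ.< ε → ∃ λ δ → 0ℚ ℚ.< δ × B ℚ.* δ ≡ ε
  divide B ε 0<B 0<ε = B⁻¹ ℚ.* ε , 0<δ ,
    trans (sym (ℚ.*-assoc B B⁻¹ ε)) (trans (cong (ℚ._* ε) (ℚ.*-inverseʳ B)) (ℚ.*-identityˡ ε))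
    where
    instance
      posB : ℚ.Positive B
      posB = ℚ.positive 0<B
      nzB : ℚ.NonZero B
      nzB = ℚ.pos⇒nonZero B
    B⁻¹ = ℚ.1/ B
    instance
      posB⁻¹ : ℚ.Positive B⁻¹
      posB⁻¹ = ℚ.1/pos⇒pos B
    0<δ : 0ℚ ℚ.< B⁻¹ ℚ.* ε
    0<δ = subst (ℚ._< B⁻¹ ℚ.* ε) (ℚ.*-zeroʳ B⁻¹) (ℚ.*-monoʳ-<-pos B⁻¹ 0<ε)

  abstract
    *-cauchy : ∀ x y → IsCauchy x → IsCauchy y → IsCauchy (λ n → x n ℚ.* y n)
    *-cauchy x y cx cy ε 0<ε with bounded x cx | bounded y cy
    ... | B , 0<B , x≤B | C , 0<C , y≤C
      with divide B _ 0<B (half-pos 0<ε) | divide C _ 0<C (half-pos 0<ε)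
    ... | δ , 0<δ , Bδ | η , 0<η , Cη with cx η 0<η | cy δ 0<δ
    ... | M , closeˣ | N , closeʸ = M ℕ.⊔ N , λ m n le le′ →
      subst (λ z → ∣ z ∣ ℚ.≤ ε) (sym (regroup (x m) (y m) (x n) (y n)))
        (ℚ.≤-trans (ℚ.∣p+q∣≤∣p∣+∣q∣ (x m ℚ.* (y m ℚ.- y n)) (y n ℚ.* (x m ℚ.- x n)))
          (subst (_ ℚ.≤_) (trans (cong₂ ℚ._+_ Bδ Cη) (halves ε))
            (ℚ.+-mono-≤
              (*-mono-∣∣ 0<B (x≤B m)
                (closeʸ m n (ℕ.≤-trans (ℕ.m≤n⊔m M N) le) (ℕ.≤-trans (ℕ.m≤n⊔m M N) le′)))
              (*-mono-∣∣ 0<C (y≤C n)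
                (closeˣ m n (ℕ.≤-trans (ℕ.m≤m⊔n M N) le) (ℕ.≤-trans (ℕ.m≤m⊔n M N) le′))))))
      where
      regroup : ∀ a b c d → (a ℚ.* b) ℚ.- (c ℚ.* d) ≡ a ℚ.* (b ℚ.- d) ℚ.+ d ℚ.* (a ℚ.- c)
      regroup = solve 4 (λ a b c d → (a :* b) :- (c :* d) := a :* (b :- d) :+ d :* (a :- c)) refl
        where open +-*-Solver

  abstract
    const-cauchy : ∀ q → IsCauchy (λ _ → q)
    const-cauchy q ε 0<ε = 0 , λ _ _ _ _ →
      subst (λ z → ∣ z ∣ ℚ.≤ ε) (sym (ℚ.+-inverseʳ q)) (ℚ.<⇒≤ 0<ε)

open CauchyLemmas using (+-cauchy; *-cauchy; const-cauchy)

fromℚ : ℚ → ℝ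
fromℚ q = mkℝ (λ _ → q) (const-cauchy q)

0ℝ 1ℝ : ℝ
0ℝ = fromℚ 0ℚ
1ℝ = fromℚ 1ℚ

infixl 6 _+ℝ_
infixl 7 _*ℝ_

_+ℝ_ _*ℝ_ : ℝ → ℝ → ℝ
x +ℝ y = mkℝ (λ n → seq x n ℚ.+ seq y n) (+-cauchy (seq x) (seq y) (cauchy x) (cauchy y))
x *ℝ y = mkℝ (λ n → seq x n ℚ.* seq y n) (*-cauchy (seq x) (seq y) (cauchy x) (cauchy y))

record Box (a b : ℕ) : Set where
  field
    lo hi : Fin a → Fin b → ℚ
    lo≤hi : ∀ i j → lo i j ℚ.≤ hi i j

open Box public

volume : ∀ {a b} → Box a b → ℚ
volume B = foldr ℚ._*_ 1ℚ λ i → foldr ℚ._*_ 1ℚ λ j → hi B i j ℚ.- lo B i j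

infix 4 _∈Box_

_∈Box_ : ∀ {a b} → (Fin a → Fin b → ℝ) → Box a b → Set
x ∈Box B = ∀ i j → fromℚ (lo B i j) ≤ℝ x i j × x i j ≤ℝ fromℚ (hi B i j)

-- Lebesgue null subsets of ℝ^(a × b), by covers with boxes of total
-- volume at most ε.  `nothing` is the empty box: it is needed in dimension 0,
-- where every (nonempty) box has volume 1.
IsNull : ∀ {a b} → ((Fin a → Fin b → ℝ) → Set) → Set
IsNull {a} {b} S = ∀ ε → 0ℚ ℚ.< ε → Σ (ℕ → Maybe (Box a b)) λ B →
  (∀ N → foldr ℚ._+_ 0ℚ (λ (i : Fin N) → maybe′ volume 0ℚ (B (toℕ i))) ℚ.≤ ε) ×
  (∀ x → S x → ∃ λ n → Any (x ∈Box_) (B n))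

IsDistribution : ∀ {k} → Vector ℝ k → Set
IsDistribution v = (∀ i → 0ℝ ≤ℝ v i) × foldr _+ℝ_ 0ℝ v ≈ℝ 1ℝ

record MarkovChain (k : ℕ) : Set where
  field
    initial         : Vector ℝ k
    transition      : Fin k → Vector ℝ k
    initial-dist    : IsDistribution initial
    transition-dist : ∀ i → IsDistribution (transition i)

open MarkovChain public

-- The space of chains is a product of k + 1 simplices of dimension k - 1.  Its
-- Lebesgue measure is that of the chart forgetting the coordinate of state 0 in
-- each of the simplices (the other choices change it by a constant factor only).
free : ∀ {k} → Fin (pred k) → Fin k
free {suc _} = suc

chart : ∀ {k} → MarkovChain k → Fin (suc k) → Fin (pred k) → ℝ
chart M zero    j = initial M (free j)
chart M (suc i) j = transition M i (free j)

PositiveMeasure : ∀ {k} → (MarkovChain k → Set) → Set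
PositiveMeasure A = ¬ IsNull λ x → ∃ λ M → A M × (∀ i j → chart M i j ≈ℝ x i j)

-- "Length" counts transitions, so a sequence of length n has n + 1 states.
Sequence : ℕ → ℕ → Set
Sequence k n = Vec (Fin k) (suc n)

transitions : ∀ {k n} → Sequence k n → List (Fin k × Fin k)
transitions (s ∷ [])     = []
transitions (s ∷ t ∷ ss) = (s , t) ∷ transitions (t ∷ ss)

Pr : ∀ {k n} → MarkovChain k → Sequence k n → ℝ
Pr M s = initial M (head s) *ℝ
         List.foldr _*ℝ_ 1ℝ (List.map (λ (i , j) → transition M i j) (transitions s))

IsViterbiPath : ∀ {k n} → MarkovChain k → Sequence k n → Set
IsViterbiPath {k} {n} M s = ∀ (t : Sequence k n) → Pr M t ≤ℝ Pr M s

SameRegion : ∀ {k} → ℕ → MarkovChain k → MarkovChain k → Set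
SameRegion {k} n M M′ = (s : Sequence k n) → IsViterbiPath M s ⇔ IsViterbiPath M′ s

-- The Viterbi region is given by a representative M; whether s is a Viterbi path
-- does not depend on the representative.
IsViterbiSequence : ∀ {k n} → Sequence k n → Set
IsViterbiSequence {k} {n} s =
  ∃ λ (M : MarkovChain k) → PositiveMeasure (SameRegion n M) × IsViterbiPath M s

infix 4 _∼_

_∼_ : ∀ {k n} → Sequence k n → Sequence k n → Set
s ∼ t = head s ≡ head t × transitions s ↭ transitions t

record Cycle (k p : ℕ) : Set where
  field
    state    : Fin p → Fin k
    distinct : Injective _≡_ _≡_ state

open Cycle public

-- The interior is s_a ⋯ s_b.  Since phase is arbitrary, it may start at any state of
-- the cycle; the states are indexed by the time t and not by t - a.
record Decomposition {k p n : ℕ} .{{_ : NonZero p}} (c : Cycle k p) (s : Sequence k n) : Set where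
  field
    a b      : Fin (suc n)
    a≤b      : toℕ a ℕ.≤ toℕ b
    phase    : ℕ
    periodic : ∀ t → toℕ a ℕ.≤ toℕ t → toℕ t ℕ.≤ toℕ b →
               lookup s t ≡ state c ((phase ℕ.+ toℕ t) mod p)

  prefixLength interiorLength suffixLength : ℕ
  prefixLength   = toℕ a
  interiorLength = toℕ b ℕ.∸ toℕ a
  suffixLength   = n ℕ.∸ toℕ b

open Decomposition public using (prefixLength; interiorLength; suffixLength)

IsMaximal : ∀ {k p n} .{{_ : NonZero p}} {c : Cycle k p} {s : Sequence k n} → Decomposition c s → Set
IsMaximal {c = c} {s} D = ∀ t → t ∼ s → (E : Decomposition c t) → interiorLength E ℕ.≤ interiorLength D

{-# OPTIONS --safe #-}

-- Let C be the cycle of the interior.  If the sequence is in the same state at two times that differ by m p,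
-- then the walk between them can be replaced by m rounds of C, and it can also be doubled at the expense of m
-- rounds of the long interior.  The edges of the two results make up those of the sequence taken twice, so both
-- are as probable as the sequence on the whole Viterbi region.  As this region is not null, the first result is
-- a rearrangement of the sequence; but its interior is too long.  This applies whenever the first result still
-- meets C.  Outside the interior, a pair (state, time modulo p) can therefore only recur once, first in the
-- prefix and then in the suffix, and only with a state off C.  Once all possible closed walks have been moved from
-- the suffix to the prefix, each state has at most one recurring pair.  Since the interior takes p of the k p
-- pairs, there are at most (k p - p) + (k - p) times outside of it.
--
-- If the first result were not a rearrangement, some edge of C would occur more often in it, and this is the
-- only edge of its row to do so.  The ratio of the two probabilities is then strictly monotone in a
-- coordinate of that row, which confines the region to a null set.

module Submission where

open import Defs
import Algebra.Solver.CommutativeMonoid as CommutativeMonoidSolver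
open import Data.Bool.Base using (if_then_else_)
open import Data.Empty using (⊥; ⊥-elim)
open import Data.Fin.Base as Fin using (Fin; zero; suc; toℕ; fromℕ<)
import Data.Fin.Properties as Fin
open import Data.Integer.Base as ℤ using () renaming (+_ to pos)
import Data.Integer.Properties as ℤ
open import Data.List.Base as List using (List; []; _∷_; _++_; length; map; mapMaybe)
open import Data.List.Membership.Propositional using (_∈_; lose)
import Data.List.Membership.Propositional.Properties as ∈
import Data.List.Properties as List
open import Data.List.Relation.Binary.Permutation.Propositional as ↭ using (_↭_; ↭-refl; ↭-sym; ↭-trans; prep; swap)
import Data.List.Relation.Binary.Permutation.Propositional.Properties as ↭
open import Data.List.Relation.Unary.Any as AnyL using (here; there) renaming (Any to AnyL)
import Data.List.Relation.Unary.Any.Properties as AnyL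
open import Data.Maybe.Base using (Maybe; just; nothing; maybe′)
open import Data.Maybe.Relation.Unary.Any using (just) renaming (Any to AnyM)
open import Data.Nat.Base as ℕ using (ℕ; zero; suc; pred; NonZero)
open import Data.Nat.DivMod using (_%_; _/_; _mod_; m%n<n; [m+kn]%n≡m%n; m%n%n≡m%n; m≡m%n+[m/n]*n; m<n⇒m%n≡m; %-distribˡ-+; /-monoˡ-≤)
open import Data.Nat.Induction using (<-wellFounded)
import Data.Nat.Properties as ℕ
open import Data.Nat.Solver using (module +-*-Solver)
open import Data.Product.Base using (Σ; ∃; _×_; _,_; proj₁; proj₂)
import Data.Product.Properties as ×
open import Data.Rational.Base as ℚ using (ℚ; 0ℚ; 1ℚ)
import Data.Rational.Properties as ℚ
import Data.Rational.Solver as ℚSolver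
import Data.Rational.Unnormalised.Base as ℚᵘ
import Data.Rational.Unnormalised.Properties as ℚᵘ
open import Data.Sum.Base as Sum using (_⊎_; inj₁; inj₂)
open import Data.Sum.Properties using (inj₁-injective; inj₂-injective)
open import Data.Vec.Base as Vec using (head; lookup)
open import Data.Vec.Functional using (Vector; foldr) renaming (_∷_ to _∷ᶠ_)
import Data.Vec.Properties as Vec
open import Function.Base using (_∘_)
open import Function.Bundles using (Equivalence)
open import Induction.WellFounded using (Acc; acc)
open import Relation.Binary.Definitions using (DecidableEquality; tri<; tri≈; tri>)
open import Relation.Binary.PropositionalEquality using (_≡_; _≢_; refl; sym; trans; cong; cong₂; subst; subst₂; module ≡-Reasoning)
open import Relation.Nullary.Decidable using (Dec; yes; no; does; _×-dec_)
open import Relation.Nullary.Negation.Core using (¬_; contradiction)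

-- The Viterbi property bounds the probabilities of the two results only from above; that their
-- product is fixed turns this into the missing lower bounds.
--
-- Nullness has to be shown by explicit covers of arbitrarily small volume, and comparisons of reals
-- cannot be decided. All tests are therefore made at rational points of a grid and with a
-- tolerance, so strict monotonicity has to be made quantitative: where all entries exceed a floor
-- `θ`, a near tie confines one coordinate to an interval of length `ℓ`, and thin slabs take care of
-- the chains with a smaller entry.
--
-- An exchange needs an interior that can pay for the doubled closed walk, although the lengths of
-- prefix and suffix are not known in advance. A pigeonhole argument restricted to short closed
-- walks first bounds each of them by `k * p`. After that `2 * k + 4` rounds of the interior suffice
-- for every exchange, and `p ≤ k` makes the threshold depend on `k` only.

infix 4 _≟ₚ_

abstract
  _≟ₚ_ : ∀ {a b} → DecidableEquality (Fin a × Fin b)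
  _≟ₚ_ = ×.≡-dec Fin._≟_ Fin._≟_

-- Multiplicities of pairs in lists.

occurs : ∀ {a b} → Fin a × Fin b → Fin a × Fin b → ℕ
occurs x y = if does (x ≟ₚ y) then 1 else 0

# : ∀ {a b} → Fin a × Fin b → List (Fin a × Fin b) → ℕ
# x []       = 0
# x (y ∷ ys) = occurs x y ℕ.+ # x ys

#-++ : ∀ {a b} (x : Fin a × Fin b) ys zs → # x (ys ++ zs) ≡ # x ys ℕ.+ # x zs
#-++ x []       zs = refl
#-++ x (y ∷ ys) zs = trans (cong (occurs x y ℕ.+_) (#-++ x ys zs)) (sym (ℕ.+-assoc (occurs x y) _ _))

#-↭ : ∀ {a b} (x : Fin a × Fin b) {ys zs} → ys ↭ zs → # x ys ≡ # x zs
#-↭ x ↭.refl         = refl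
#-↭ x (prep y p)     = cong (occurs x y ℕ.+_) (#-↭ x p)
#-↭ x {zs = _ ∷ _ ∷ zs} (swap y z p) = trans (cong (λ n → occurs x y ℕ.+ (occurs x z ℕ.+ n)) (#-↭ x p))
  (trans (sym (ℕ.+-assoc (occurs x y) _ _)) (trans (cong (ℕ._+ # x zs) (ℕ.+-comm (occurs x y) (occurs x z)))
    (ℕ.+-assoc (occurs x z) _ _)))
#-↭ x (↭.trans p q)  = trans (#-↭ x p) (#-↭ x q)

length-transitions : ∀ {k n} (s : Sequence k n) → length (transitions s) ≡ n
length-transitions (_ Vec.∷ Vec.[])     = refl
length-transitions (_ Vec.∷ y Vec.∷ ys) = cong suc (length-transitions (y Vec.∷ ys))

-- Chains on which two probabilities tie form a null set.

module NullSets where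

  open import Data.Rational.Base using (mkℚ; ∣_∣; _+_; _*_; _-_; -_; _≤_; _<_)
  open import Data.Rational.Properties using (≤-refl; ≤-reflexive; ≤-trans; <⇒≤; +-mono-≤)
  open CauchyLemmas using (0<1; divide; p≤p+q; p≤q+p)

  -- Inequalities between rationals.

  0≤diff : ∀ {a b} → a ≤ b → 0ℚ ≤ b - a
  0≤diff {a} {b} a≤b = subst (_≤ b - a) (ℚ.+-inverseʳ a) (ℚ.+-monoˡ-≤ (- a) a≤b)

  +-nonNeg : ∀ {a b} → 0ℚ ≤ a → 0ℚ ≤ b → 0ℚ ≤ a + b
  +-nonNeg = +-mono-≤

  *-nonNeg : ∀ {a b} → 0ℚ ≤ a → 0ℚ ≤ b → 0ℚ ≤ a * b
  *-nonNeg {a} {b} 0≤a 0≤b =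
    subst (_≤ a * b) (ℚ.*-zeroʳ a) (ℚ.*-monoˡ-≤-nonNeg a {{ℚ.nonNegative 0≤a}} 0≤b)

  *-pos : ∀ {a b} → 0ℚ < a → 0ℚ < b → 0ℚ < a * b
  *-pos {a} {b} 0<a 0<b =
    subst (_< a * b) (ℚ.*-zeroʳ a) (ℚ.*-monoʳ-<-pos a {{ℚ.positive 0<a}} 0<b)

  *-mono-≤ : ∀ {a b c d} → 0ℚ ≤ a → 0ℚ ≤ d → a ≤ b → c ≤ d → a * c ≤ b * d
  *-mono-≤ {a} {b} {c} {d} 0≤a 0≤d a≤b c≤d = ≤-trans
    (ℚ.*-monoˡ-≤-nonNeg a {{ℚ.nonNegative 0≤a}} c≤d)
    (ℚ.*-monoʳ-≤-nonNeg d {{ℚ.nonNegative 0≤d}} a≤b)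

  -- Linear arithmetic: an inequality follows from hypotheses aᵢ ≤ bᵢ once its two sides
  -- are shown to differ by the sum of the bᵢ - aᵢ, which is a ring identity.
  from-diff : ∀ {p q r} → 0ℚ ≤ r → p + r ≡ q → p ≤ q
  from-diff {p} {q} {r} 0≤r eq = subst₂ _≤_ (ℚ.+-identityʳ p) eq (ℚ.+-monoʳ-≤ p 0≤r)

  linear₁ : ∀ {p q a b} → a ≤ b → p + (b - a) ≡ q → p ≤ q
  linear₁ h = from-diff (0≤diff h)

  linear₂ : ∀ {p q a b c d} → a ≤ b → c ≤ d → p + ((b - a) + (d - c)) ≡ q → p ≤ q
  linear₂ h h′ = from-diff (+-nonNeg (0≤diff h) (0≤diff h′))

  linear₃ : ∀ {p q a b c d e f} → a ≤ b → c ≤ d → e ≤ f →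
            p + ((b - a) + ((d - c) + (f - e))) ≡ q → p ≤ q
  linear₃ h h′ h″ = from-diff (+-nonNeg (0≤diff h) (+-nonNeg (0≤diff h′) (0≤diff h″)))

  ∣p∣≤⇒≤ : ∀ {p ε} → ∣ p ∣ ≤ ε → p ≤ ε
  ∣p∣≤⇒≤ {p} h with ℚ.∣p∣≡p∨∣p∣≡-p p
  ... | inj₁ eq = ≤-trans (≤-reflexive (sym eq)) h
  ... | inj₂ eq = ≤-trans (≤-trans p≤0 (ℚ.0≤∣p∣ p)) h
    where
    p≤0 : p ≤ 0ℚ
    p≤0 = from-diff (subst (0ℚ ≤_) eq (ℚ.0≤∣p∣ p)) (ℚ.+-inverseʳ p)

  ∣p-q∣≤⇒≤ : ∀ {p q ε} → ∣ p - q ∣ ≤ ε → p ≤ q + ε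
  ∣p-q∣≤⇒≤ {p} {q} {ε} h = linear₁ (∣p∣≤⇒≤ h)
    (solve 3 (λ p q ε → p :+ (ε :- (p :- q)) := q :+ ε) refl p q ε)
    where open ℚSolver.+-*-Solver

  ∣p-q∣≤⇒≥ : ∀ {p q ε} → ∣ p - q ∣ ≤ ε → q ≤ p + ε
  ∣p-q∣≤⇒≥ {p} {q} {ε} h = ∣p-q∣≤⇒≤ (subst (_≤ ε) (trans (sym (ℚ.∣-p∣≡∣p∣ (p - q))) (cong ∣_∣
    (solve 2 (λ p q → :- (p :- q) := q :- p) refl p q))) h)
    where open ℚSolver.+-*-Solver

  infix 4 _≈[_]_

  _≈[_]_ : ℚ → ℚ → ℚ → Set
  p ≈[ δ ] q = p ≤ q + δ × q ≤ p + δ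

  -- Natural numbers among the rationals.

  ι : ℕ → ℚ
  ι zero    = 0ℚ
  ι (suc n) = 1ℚ + ι n

  0≤ι : ∀ n → 0ℚ ≤ ι n
  0≤ι zero    = ≤-refl
  0≤ι (suc n) = +-nonNeg (<⇒≤ 0<1) (0≤ι n)

  0<ι : ∀ n → 0ℚ < ι (suc n)
  0<ι n = ℚ.+-mono-<-≤ 0<1 (0≤ι n)

  ι-+ : ∀ m n → ι (m ℕ.+ n) ≡ ι m + ι n
  ι-+ zero    n = sym (ℚ.+-identityˡ (ι n))
  ι-+ (suc m) n = trans (cong (1ℚ +_) (ι-+ m n)) (sym (ℚ.+-assoc 1ℚ (ι m) (ι n)))

  ι-* : ∀ m n → ι (m ℕ.* n) ≡ ι m * ι n
  ι-* zero    n = sym (ℚ.*-zeroˡ (ι n))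
  ι-* (suc m) n = trans (ι-+ n (m ℕ.* n)) (trans (cong (ι n +_) (ι-* m n))
    (solve 2 (λ x y → y :+ x :* y := (con 1ℚ :+ x) :* y) refl (ι m) (ι n)))
    where open ℚSolver.+-*-Solver

  toℚᵘ-ι : ∀ n → ℚ.toℚᵘ (ι n) ℚᵘ.≃ ℚᵘ.mkℚᵘ (pos n) 0
  toℚᵘ-ι zero    = ℚᵘ.≃-refl
  toℚᵘ-ι (suc n) = ℚᵘ.≃-trans (ℚ.toℚᵘ-homo-+ 1ℚ (ι n))
    (ℚᵘ.≃-trans (ℚᵘ.+-congʳ (ℚ.toℚᵘ 1ℚ) (toℚᵘ-ι n)) (ℚᵘ.*≡* (cong (ℤ._* pos 1) (cong (λ x → pos 1 ℤ.+ x) (ℤ.*-identityʳ (pos n))))))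

  -- The denominator of `ε` serves as the multiplier: it turns `ε` into its numerator, which is at
  -- least 1.
  archimedean : ∀ ε → 0ℚ < ε → ∃ λ N → 1ℚ ≤ ι (suc N) * ε
  archimedean ε@(mkℚ (pos zero)   d c) 0<ε = contradiction (ℚ.drop-*<* 0<ε) λ { (ℤ.+<+ ()) }
  archimedean ε@(mkℚ ℤ.-[1+ _ ] d c) 0<ε = contradiction (ℚ.drop-*<* 0<ε) λ ()
  archimedean ε@(mkℚ (pos (suc m)) d c) 0<ε = d , ℚ.toℚᵘ-cancel-≤ (ℚᵘ.≤-respʳ-≃
    (ℚᵘ.≃-sym (ℚᵘ.≃-trans (ℚ.toℚᵘ-homo-* (ι (suc d)) ε) (ℚᵘ.*-congʳ {ℚ.toℚᵘ ε} (toℚᵘ-ι (suc d)))))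
    (ℚᵘ.*≤* (subst₂ ℤ._≤_ (sym (ℤ.*-identityˡ (pos (1 ℕ.* suc d)))) (sym (ℤ.*-identityʳ _))
      (ℤ.+≤+ (subst (ℕ._≤ suc d ℕ.* suc m) (sym (ℕ.*-identityˡ (suc d))) (ℕ.m≤m*n (suc d) (suc m)))))))

  -- Powers, sums and products.

  infixr 8 _^_

  _^_ : ℚ → ℕ → ℚ
  x ^ zero  = 1ℚ
  x ^ suc n = x * x ^ n

  0≤1 : 0ℚ ≤ 1ℚ
  0≤1 = <⇒≤ 0<1

  ^-nonNeg : ∀ {x} n → 0ℚ ≤ x → 0ℚ ≤ x ^ n
  ^-nonNeg zero    0≤x = 0≤1
  ^-nonNeg (suc n) 0≤x = *-nonNeg 0≤x (^-nonNeg n 0≤x)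

  ^-pos : ∀ {x} n → 0ℚ < x → 0ℚ < x ^ n
  ^-pos zero    0<x = 0<1
  ^-pos (suc n) 0<x = *-pos 0<x (^-pos n 0<x)

  1≤^ : ∀ {x} n → 1ℚ ≤ x → 1ℚ ≤ x ^ n
  1≤^ zero    1≤x = ≤-refl
  1≤^ (suc n) 1≤x = *-mono-≤ 0≤1 (^-nonNeg n (≤-trans 0≤1 1≤x)) 1≤x (1≤^ n 1≤x)

  ∑ ∏ : ∀ {n} → Vector ℚ n → ℚ
  ∑ = foldr _+_ 0ℚ
  ∏ = foldr _*_ 1ℚ

  ∏-nonNeg : ∀ {n} (v : Vector ℚ n) → (∀ i → 0ℚ ≤ v i) → 0ℚ ≤ ∏ v
  ∏-nonNeg {zero}  v 0≤v = 0≤1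
  ∏-nonNeg {suc n} v 0≤v = *-nonNeg (0≤v zero) (∏-nonNeg (v ∘ suc) (0≤v ∘ suc))

  ∏-cong : ∀ {n} {v w : Vector ℚ n} → (∀ i → v i ≡ w i) → ∏ v ≡ ∏ w
  ∏-cong {zero}  eq = refl
  ∏-cong {suc n} eq = cong₂ _*_ (eq zero) (∏-cong (eq ∘ suc))

  ∏-* : ∀ {n} (v w : Vector ℚ n) → ∏ (λ i → v i * w i) ≡ ∏ v * ∏ w
  ∏-* {zero}  v w = refl
  ∏-* {suc n} v w = trans (cong (v zero * w zero *_) (∏-* (v ∘ suc) (w ∘ suc)))
    (solve 4 (λ a b c d → a :* b :* (c :* d) := a :* c :* (b :* d)) refl
      (v zero) (w zero) (∏ (v ∘ suc)) (∏ (w ∘ suc)))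
    where open ℚSolver.+-*-Solver

  ∏-≤-^ : ∀ {n K} (v : Vector ℚ n) → 0ℚ ≤ K → (∀ i → 0ℚ ≤ v i) → (∀ i → v i ≤ K) → ∏ v ≤ K ^ n
  ∏-≤-^ {zero}  v 0≤K 0≤v v≤K = ≤-refl
  ∏-≤-^ {suc n} v 0≤K 0≤v v≤K =
    *-mono-≤ (0≤v zero) (^-nonNeg n 0≤K) (v≤K zero) (∏-≤-^ (v ∘ suc) 0≤K (0≤v ∘ suc) (v≤K ∘ suc))

  -- The one small factor is what makes a union of thin boxes small. Writing `K ^ n` for the at most
  -- `n - 1` remaining factors costs only a power of `K`, which `1ℚ ≤ K` permits.
  ∏-≤-one-small : ∀ {n K u} (v : Vector ℚ n) j → 1ℚ ≤ K → 0ℚ ≤ u → (∀ i → 0ℚ ≤ v i) →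
                  v j ≤ u → (∀ i → i ≢ j → v i ≤ K) → ∏ v ≤ u * K ^ n
  ∏-≤-one-small {suc n} {K} {u} v zero 1≤K 0≤u 0≤v vj≤u v≤K =
    *-mono-≤ (0≤v zero) (^-nonNeg (suc n) 0≤K) vj≤u
      (≤-trans (∏-≤-^ (v ∘ suc) 0≤K (0≤v ∘ suc) (λ i → v≤K (suc i) λ ()))
        (subst (_≤ K * K ^ n) (ℚ.*-identityˡ (K ^ n))
          (*-mono-≤ 0≤1 (^-nonNeg n 0≤K) 1≤K ≤-refl)))
    where
    0≤K : 0ℚ ≤ K
    0≤K = ≤-trans 0≤1 1≤K
  ∏-≤-one-small {suc n} {K} {u} v (suc j) 1≤K 0≤u 0≤v vj≤u v≤K =
    subst (∏ v ≤_) (solve 3 (λ u K P → K :* (u :* P) := u :* (K :* P)) refl u K (K ^ n))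
      (*-mono-≤ (0≤v zero) (*-nonNeg 0≤u (^-nonNeg n (≤-trans 0≤1 1≤K))) (v≤K zero λ ())
        (∏-≤-one-small (v ∘ suc) j 1≤K 0≤u (0≤v ∘ suc) vj≤u
          (λ i i≢j → v≤K (suc i) λ { refl → i≢j refl })))
    where open ℚSolver.+-*-Solver

  -- Grids of rational points and finite lists of boxes.

  choices : ∀ {a} {A : Set a} {n} → (Fin n → List A) → List (Fin n → A)
  choices {n = zero}  L = (λ ()) ∷ []
  choices {n = suc n} L = List.cartesianProductWith _∷ᶠ_ (L zero) (choices (L ∘ suc))

  length-cartesianProductWith : ∀ {A B C : Set} (f : A → B → C) xs ys →
    length (List.cartesianProductWith f xs ys) ≡ length xs ℕ.* length ys
  length-cartesianProductWith f []       ys = refl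
  length-cartesianProductWith f (x ∷ xs) ys = trans (List.length-++ (map (f x) ys))
    (cong₂ ℕ._+_ (List.length-map (f x) ys) (length-cartesianProductWith f xs ys))

  ι-length-choices : ∀ {A : Set} {n} (L : Fin n → List A) → ι (length (choices L)) ≡ ∏ (ι ∘ length ∘ L)
  ι-length-choices {n = zero}  L = refl
  ι-length-choices {n = suc n} L =
    trans (cong ι (length-cartesianProductWith _∷ᶠ_ (L zero) (choices (L ∘ suc))))
      (trans (ι-* (length (L zero)) _) (cong (ι (length (L zero)) *_) (ι-length-choices (L ∘ suc))))

  choices-Any : ∀ {A : Set} {n} {R : Fin n → A → Set} (L : Fin n → List A) →
                (∀ i → AnyL (R i) (L i)) → AnyL (λ g → ∀ i → R i (g i)) (choices L)
  choices-Any {n = zero}  L any = here λ ()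
  choices-Any {n = suc n} L any = AnyL.cartesianProductWith⁺ _∷ᶠ_
    (λ r rs → λ { zero → r ; (suc i) → rs i }) (any zero) (choices-Any (L ∘ suc) (any ∘ suc))

  Point : ℕ → ℕ → Set
  Point a b = Fin a → Fin b → ℚ

  grid : ∀ {a b} → (Fin a → Fin b → List ℚ) → List (Point a b)
  grid L = choices (λ i → choices (L i))

  totalVolume : ∀ {a b} → List (Box a b) → ℚ
  totalVolume []       = 0ℚ
  totalVolume (B ∷ Bs) = volume B + totalVolume Bs

  volume-nonNeg : ∀ {a b} (B : Box a b) → 0ℚ ≤ volume B
  volume-nonNeg B = ∏-nonNeg _ λ i → ∏-nonNeg _ λ j → 0≤diff (lo≤hi B i j)

  totalVolume-nonNeg : ∀ {a b} (Bs : List (Box a b)) → 0ℚ ≤ totalVolume Bs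
  totalVolume-nonNeg []       = ≤-refl
  totalVolume-nonNeg (B ∷ Bs) = +-nonNeg (volume-nonNeg B) (totalVolume-nonNeg Bs)

  totalVolume-++ : ∀ {a b} (Bs Cs : List (Box a b)) → totalVolume (Bs ++ Cs) ≡ totalVolume Bs + totalVolume Cs
  totalVolume-++ []       Cs = sym (ℚ.+-identityˡ _)
  totalVolume-++ (B ∷ Bs) Cs =
    trans (cong (volume B +_) (totalVolume-++ Bs Cs)) (sym (ℚ.+-assoc (volume B) _ _))

  nth : ∀ {A : Set} → List A → ℕ → Maybe A
  nth []       n       = nothing
  nth (x ∷ xs) zero    = just x
  nth (x ∷ xs) (suc n) = nth xs n

  nth-Any : ∀ {A : Set} {P : A → Set} {xs} → AnyL P xs → ∃ λ n → AnyM P (nth xs n)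
  nth-Any (here px)  = zero , just px
  nth-Any (there an) with nth-Any an
  ... | n , p = suc n , p

  nth-volume : ∀ {a b} (Bs : List (Box a b)) N →
               ∑ (λ (i : Fin N) → maybe′ volume 0ℚ (nth Bs (toℕ i))) ≤ totalVolume Bs
  nth-volume Bs       zero    = totalVolume-nonNeg Bs
  nth-volume {a} {b} [] (suc N) = subst (_≤ 0ℚ) (sym (ℚ.+-identityˡ _)) (nth-volume {a} {b} [] N)
  nth-volume (B ∷ Bs) (suc N) = ℚ.+-monoʳ-≤ (volume B) (nth-volume Bs N)

  FinitelyCovered : ∀ {a b} → ((Fin a → Fin b → ℝ) → Set) → ℚ → Set
  FinitelyCovered {a} {b} S ε =
    Σ (List (Box a b)) λ Bs → totalVolume Bs ≤ ε × (∀ x → S x → AnyL (x ∈Box_) Bs)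

  finitelyCovered⇒null : ∀ {a b} {S : (Fin a → Fin b → ℝ) → Set} →
                         (∀ ε → 0ℚ < ε → FinitelyCovered S ε) → IsNull S
  finitelyCovered⇒null cover ε 0<ε with cover ε 0<ε
  ... | Bs , small , covers =
    nth Bs , (λ N → ≤-trans (nth-volume Bs N) small) , λ x x∈S → nth-Any (covers x x∈S)

  multiples : ℚ → ℕ → List ℚ
  multiples h zero    = 0ℚ ∷ []
  multiples h (suc n) = ι (suc n) * h ∷ multiples h n

  length-multiples : ∀ h n → length (multiples h n) ≡ suc n
  length-multiples h zero    = refl
  length-multiples h (suc n) = cong suc (length-multiples h n)

  multiples-dense : ∀ {h} n q → 0ℚ ≤ h → - h ≤ q → q ≤ ι n * h + h → AnyL (q ≈[ h ]_) (multiples h n)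
  multiples-dense {h} zero q 0≤h lower upper =
    here (subst (λ z → q ≤ z + h) (ℚ.*-zeroˡ h) upper ,
          linear₁ lower (solve 2 (λ h q → con 0ℚ :+ (q :- (:- h)) := q :+ h) refl h q))
    where open ℚSolver.+-*-Solver
  multiples-dense {h} (suc n) q 0≤h lower upper with q ℚ.≤? ι n * h + h
  ... | yes q≤ = there (multiples-dense n q 0≤h lower q≤)
  ... | no  q≰ = here (upper , linear₂ (<⇒≤ (ℚ.≰⇒> q≰)) 0≤h
      (solve 3 (λ h q x → (con 1ℚ :+ x) :* h :+ ((q :- (x :* h :+ h)) :+ (h :- con 0ℚ)) := q :+ h) refl h q (ι n)))
    where open ℚSolver.+-*-Solver

  mapMaybe-Any : ∀ {A B : Set} {P : A → Set} {Q : B → Set} {f : A → Maybe B} {xs} →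
                 (∀ x → P x → AnyM Q (f x)) → AnyL P xs → AnyL Q (mapMaybe f xs)
  mapMaybe-Any {f = f} {x ∷ xs} imp (here px) with f x | imp x px
  ... | just y | just q = here q
  mapMaybe-Any {f = f} {x ∷ xs} imp (there any) with f x
  ... | just y  = there (mapMaybe-Any imp any)
  ... | nothing = mapMaybe-Any imp any

  abstract
    special? : ∀ {a b} (r : Fin a) (s : Fin b) i j → Dec (i ≡ r × j ≡ s)
    special? r s i j = (i Fin.≟ r) ×-dec (j Fin.≟ s)

  update : ∀ {a b} → Fin a → Fin b → Point a b → ℚ → Point a b
  update r s g x i j = if does (special? r s i j) then x else g i j

  -- Each grid line in the direction `(r , s)` gets at most one box, long enough to hold all of `T`
  -- on that line. The other coordinates are cut into pieces of width of order `h`, and their number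
  -- cancels against that width, so the total volume is of order `ℓ + h`.
  module ThinCover {a b : ℕ} (r : Fin a) (s : Fin b) (h ℓ : ℚ) (0≤h : 0ℚ ≤ h) (0≤ℓ : 0ℚ ≤ ℓ) (net : List ℚ)
                   (T : Point a b → Set) (T? : ∀ z → Dec (T z)) where

    width : Point a b
    width = update r s (λ _ _ → h + h) (ℓ + (h + h))

    -- The single value in the distinguished direction is a dummy: it keeps the grid indexed by all
    -- coordinates and is overwritten by `update`.
    axis : Fin a → Fin b → List ℚ
    axis i j = if does (special? r s i j) then 0ℚ ∷ [] else net

    0≤narrow : 0ℚ ≤ h + h
    0≤narrow = +-nonNeg 0≤h 0≤h

    0≤wide : 0ℚ ≤ ℓ + (h + h)
    0≤wide = +-nonNeg 0≤ℓ 0≤narrow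

    width-nonNeg : ∀ i j → 0ℚ ≤ width i j
    width-nonNeg i j with special? r s i j
    ... | yes _ = 0≤wide
    ... | no  _ = 0≤narrow

    around : Point a b → Box a b
    around z = record
      { lo    = λ i j → z i j - width i j
      ; hi    = λ i j → z i j + width i j
      ; lo≤hi = λ i j → linear₂ (width-nonNeg i j) (width-nonNeg i j)
          (solve 2 (λ z w → z :- w :+ ((w :- con 0ℚ) :+ (w :- con 0ℚ)) := z :+ w) refl (z i j) (width i j))
      }
      where open ℚSolver.+-*-Solver

    -- `T` is tested only at the finitely many net points of the line. Which of its points is found
    -- does not matter, since they all lie within `ℓ` of each other when `T` is thin.
    boxAt : Point a b → Maybe (Box a b)
    boxAt g with AnyL.any? (λ x → T? (update r s g x)) net
    ... | yes any = just (around (update r s g (AnyL.lookup any)))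
    ... | no  _   = nothing

    boxes : List (Box a b)
    boxes = mapMaybe boxAt (grid axis)

    boxVolume : ℚ
    boxVolume = ∏ λ i → ∏ λ j → width i j + width i j

    boxVolume-nonNeg : 0ℚ ≤ boxVolume
    boxVolume-nonNeg = ∏-nonNeg _ λ i → ∏-nonNeg _ λ j → +-nonNeg (width-nonNeg i j) (width-nonNeg i j)

    volume-around : ∀ z → volume (around z) ≡ boxVolume
    volume-around z = ∏-cong λ i → ∏-cong λ j →
      solve 2 (λ z w → (z :+ w) :- (z :- w) := w :+ w) refl (z i j) (width i j)
      where open ℚSolver.+-*-Solver

    totalVolume-boxAt : ∀ gs → totalVolume (mapMaybe boxAt gs) ≤ ι (length gs) * boxVolume
    totalVolume-boxAt []       = ≤-reflexive (sym (ℚ.*-zeroˡ boxVolume))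
    totalVolume-boxAt (g ∷ gs) = subst (totalVolume (mapMaybe boxAt (g ∷ gs)) ≤_)
        (solve 2 (λ V n → V :+ n :* V := (con 1ℚ :+ n) :* V) refl boxVolume (ι (length gs))) step
      where
      open ℚSolver.+-*-Solver
      step : totalVolume (mapMaybe boxAt (g ∷ gs)) ≤ boxVolume + ι (length gs) * boxVolume
      step with AnyL.any? (λ x → T? (update r s g x)) net
      ... | yes any = +-mono-≤ (≤-reflexive (volume-around (update r s g (AnyL.lookup any)))) (totalVolume-boxAt gs)
      ... | no  _   = ≤-trans (totalVolume-boxAt gs) (p≤q+p _ boxVolume-nonNeg)

    -- The number of boxes times the volume of one factorises over the coordinates: an ordinary
    -- coordinate contributes `length net` times `4h`, the distinguished one a single side of length
    -- `2 (ℓ + 2h)`.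
    boxes-volume : ∀ {K} → 1ℚ ≤ K → ι (length net) * ((h + h) + (h + h)) ≤ K →
      totalVolume boxes ≤ (ℓ + (h + h) + (ℓ + (h + h))) * K ^ b * (K ^ b) ^ a
    boxes-volume {K} 1≤K net≤K = ≤-trans (totalVolume-boxAt (grid axis)) (subst (_≤ u * K ^ b * (K ^ b) ^ a) (sym count)
      (∏-≤-one-small _ r (1≤^ b 1≤K) (*-nonNeg 0≤u (^-nonNeg b 0≤K)) (λ i → ∏-nonNeg _ (side-nonNeg i))
        (∏-≤-one-small _ s 1≤K 0≤u (side-nonNeg r) side-special (λ j j≢s → side-ordinary r j λ { (_ , eq) → j≢s eq }))
        (λ i i≢r → ∏-≤-^ _ 0≤K (side-nonNeg i) (λ j → side-ordinary i j λ { (eq , _) → i≢r eq }))))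
      where
      0≤K : 0ℚ ≤ K
      0≤K = ≤-trans 0≤1 1≤K
      u : ℚ
      u = ℓ + (h + h) + (ℓ + (h + h))
      0≤u : 0ℚ ≤ u
      0≤u = +-nonNeg 0≤wide 0≤wide
      side : Point a b
      side i j = ι (length (axis i j)) * (width i j + width i j)
      side-nonNeg : ∀ i j → 0ℚ ≤ side i j
      side-nonNeg i j = *-nonNeg (0≤ι (length (axis i j))) (+-nonNeg (width-nonNeg i j) (width-nonNeg i j))
      side-special : side r s ≤ u
      side-special with special? r s r s
      ... | yes _ = ≤-reflexive (ℚ.*-identityˡ u)
      ... | no ¬p = contradiction (refl , refl) ¬p
      side-ordinary : ∀ i j → ¬ (i ≡ r × j ≡ s) → side i j ≤ K
      side-ordinary i j ¬p with special? r s i j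
      ... | yes p = contradiction p ¬p
      ... | no  _ = net≤K
      count : ι (length (grid axis)) * boxVolume ≡ ∏ (λ i → ∏ (side i))
      count = trans (cong (_* boxVolume) (trans (ι-length-choices (λ i → choices (axis i))) (∏-cong λ i → ι-length-choices (axis i))))
        (trans (sym (∏-* (λ i → ∏ (ι ∘ length ∘ axis i)) (λ i → ∏ λ j → width i j + width i j)))
          (∏-cong λ i → sym (∏-* (ι ∘ length ∘ axis i) (λ j → width i j + width i j))))

    -- Rounding `q` to the net gives a point of `T` on some grid line, so the search on that line
    -- succeeds. The point found is within `ℓ` of the rounded one, hence within `ℓ + h` of `q`. The
    -- half-widths `ℓ + 2h` and `2h` exceed the distances by another `h`, which is the margin in the
    -- conclusion.
    boxes-cover : ∀ (q : Point a b) → (∀ i j → AnyL (q i j ≈[ h ]_) net) →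
      (∀ (z : Point a b) → (∀ i j → q i j ≈[ h ] z i j) → T z) →
      (∀ g x x′ → T (update r s g x) → T (update r s g x′) → x ≤ x′ + ℓ) →
      AnyL (λ B → ∀ i j → lo B i j + h ≤ q i j × q i j + h ≤ hi B i j) boxes
    boxes-cover q near near⇒T thin = mapMaybe-Any found (choices-Any _ λ i → choices-Any (axis i) (onAxis i))
      where
      R : ∀ i j → ℚ → Set
      R i j v = ¬ (i ≡ r × j ≡ s) → q i j ≈[ h ] v
      onAxis : ∀ i j → AnyL (R i j) (axis i j)
      onAxis i j with special? r s i j
      ... | yes p = here λ ¬p → contradiction p ¬p
      ... | no  _ = AnyL.map (λ e _ → e) (near i j)
      near-update : ∀ {g x} → (∀ i j → R i j (g i j)) → q r s ≈[ h ] x → ∀ i j → q i j ≈[ h ] update r s g x i j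
      near-update near-g near-x i j with special? r s i j
      ... | yes (refl , refl) = near-x
      ... | no  ¬p            = near-g i j ¬p
      inside : ∀ {g x} → (∀ i j → R i j (g i j)) → q r s ≤ x + (ℓ + h) → x ≤ q r s + (ℓ + h) →
               ∀ i j → lo (around (update r s g x)) i j + h ≤ q i j × q i j + h ≤ hi (around (update r s g x)) i j
      inside {g} {x} near-g below above i j with special? r s i j
      ... | yes (refl , refl) =
            linear₁ above (solve 4 (λ x ℓ h q → x :- (ℓ :+ (h :+ h)) :+ h :+ (q :+ (ℓ :+ h) :- x) := q) refl x ℓ h (q r s)) ,
            linear₁ below (solve 4 (λ x ℓ h q → q :+ h :+ (x :+ (ℓ :+ h) :- q) := x :+ (ℓ :+ (h :+ h))) refl x ℓ h (q r s))
        where open ℚSolver.+-*-Solver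
      ... | no ¬p =
            linear₁ (proj₂ (near-g i j ¬p)) (solve 3 (λ x h q → x :- (h :+ h) :+ h :+ (q :+ h :- x) := q) refl (g i j) h (q i j)) ,
            linear₁ (proj₁ (near-g i j ¬p)) (solve 3 (λ x h q → q :+ h :+ (x :+ h :- q) := x :+ (h :+ h)) refl (g i j) h (q i j))
        where open ℚSolver.+-*-Solver
      found : ∀ g → (∀ i j → R i j (g i j)) →
              AnyM (λ B → ∀ i j → lo B i j + h ≤ q i j × q i j + h ≤ hi B i j) (boxAt g)
      found g near-g with AnyL.any? (λ x → T? (update r s g x)) net
      ... | no ¬any = ⊥-elim (¬any
              (AnyL.map (λ {x} near-x → near⇒T (update r s g x) (near-update near-g near-x)) (near r s)))
      ... | yes any = just (inside near-g
              (linear₂ (proj₁ near-x) (thin g x₀ x Tx₀ Tx)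
                (solve 5 (λ q y h x ℓ → q :+ ((y :+ h :- q) :+ (x :+ ℓ :- y)) := x :+ (ℓ :+ h)) refl (q r s) x₀ h x ℓ))
              (linear₂ (proj₂ near-x) (thin g x x₀ Tx Tx₀)
                (solve 5 (λ q y h x ℓ → x :+ ((q :+ h :- y) :+ (y :+ ℓ :- x)) := q :+ (ℓ :+ h)) refl (q r s) x₀ h x ℓ)))
        where
        open ℚSolver.+-*-Solver
        x x₀ : ℚ
        x = AnyL.lookup any
        x₀ = AnyL.lookup (near r s)
        near-x : q r s ≈[ h ] x₀
        near-x = AnyL.lookup-result (near r s)
        Tx : T (update r s g x)
        Tx = AnyL.lookup-result any
        Tx₀ : T (update r s g x₀)
        Tx₀ = near⇒T (update r s g x₀) (near-update near-g near-x)

  -- Monomials in the entries of a chain.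

  weight : ∀ {A : Set} → (A → ℚ) → List A → ℚ
  weight v []       = 1ℚ
  weight v (x ∷ xs) = v x * weight v xs

  weight-++ : ∀ {A : Set} (v : A → ℚ) xs ys → weight v (xs ++ ys) ≡ weight v xs * weight v ys
  weight-++ v []       ys = sym (ℚ.*-identityˡ _)
  weight-++ v (x ∷ xs) ys = trans (cong (v x *_) (weight-++ v xs ys)) (sym (ℚ.*-assoc (v x) _ _))

  weight-↭ : ∀ {A : Set} (v : A → ℚ) {xs ys} → xs ↭ ys → weight v xs ≡ weight v ys
  weight-↭ v ↭.refl        = refl
  weight-↭ v (prep x p)    = cong (v x *_) (weight-↭ v p)
  weight-↭ v {ys = _ ∷ _ ∷ ys} (swap x y p) = trans (cong (λ w → v x * (v y * w)) (weight-↭ v p))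
    (solve 3 (λ a b w → a :* (b :* w) := b :* (a :* w)) refl (v x) (v y) (weight v ys))
    where open ℚSolver.+-*-Solver
  weight-↭ v (↭.trans p q) = trans (weight-↭ v p) (weight-↭ v q)

  weight-nonNeg : ∀ {A : Set} {v : A → ℚ} → (∀ x → 0ℚ ≤ v x) → ∀ xs → 0ℚ ≤ weight v xs
  weight-nonNeg 0≤v []       = 0≤1
  weight-nonNeg 0≤v (x ∷ xs) = *-nonNeg (0≤v x) (weight-nonNeg 0≤v xs)

  weight-≤-^ : ∀ {A : Set} {v : A → ℚ} {B} → (∀ x → 0ℚ ≤ v x) → 0ℚ ≤ B → (∀ x → v x ≤ B) →
               ∀ xs → weight v xs ≤ B ^ length xs
  weight-≤-^ 0≤v 0≤B v≤B []       = ≤-refl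
  weight-≤-^ 0≤v 0≤B v≤B (x ∷ xs) =
    *-mono-≤ (0≤v x) (^-nonNeg (length xs) 0≤B) (v≤B x) (weight-≤-^ 0≤v 0≤B v≤B xs)

  ^-≤-weight : ∀ {A : Set} {v : A → ℚ} {θ} → 0ℚ ≤ θ → (∀ x → θ ≤ v x) → ∀ xs → θ ^ length xs ≤ weight v xs
  ^-≤-weight 0≤θ θ≤v []       = ≤-refl
  ^-≤-weight 0≤θ θ≤v (x ∷ xs) =
    *-mono-≤ 0≤θ (weight-nonNeg (λ x → ≤-trans 0≤θ (θ≤v x)) xs) (θ≤v x) (^-≤-weight 0≤θ θ≤v xs)

  2ℚ : ℚ
  2ℚ = 1ℚ + 1ℚ

  0≤2 : 0ℚ ≤ 2ℚ
  0≤2 = +-nonNeg 0≤1 0≤1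

  -- The recursion of `n * 2 ^ (n - 1)`, a Lipschitz constant for the product of `n` factors between
  -- 0 and 2.
  lipschitz : ℕ → ℚ
  lipschitz zero    = 0ℚ
  lipschitz (suc n) = 2ℚ ^ n + 2ℚ * lipschitz n

  lipschitz-nonNeg : ∀ n → 0ℚ ≤ lipschitz n
  lipschitz-nonNeg zero    = ≤-refl
  lipschitz-nonNeg (suc n) = +-nonNeg (^-nonNeg n 0≤2) (*-nonNeg 0≤2 (lipschitz-nonNeg n))

  weight-close : ∀ {A : Set} {u v : A → ℚ} {δ} → 0ℚ ≤ δ → (∀ x → 0ℚ ≤ u x) → (∀ x → 0ℚ ≤ v x) →
    (∀ x → u x ≤ 2ℚ) → (∀ x → v x ≤ 2ℚ) → (∀ x → u x ≤ v x + δ) →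
    ∀ xs → weight u xs ≤ weight v xs + lipschitz (length xs) * δ
  weight-close {δ = δ} 0≤δ 0≤u 0≤v u≤2 v≤2 u≤v [] =
    ≤-reflexive (solve 1 (λ δ → con 1ℚ := con 1ℚ :+ con 0ℚ :* δ) refl δ)
    where open ℚSolver.+-*-Solver
  weight-close {u = u} {v} {δ} 0≤δ 0≤u 0≤v u≤2 v≤2 u≤v (x ∷ xs) = begin
    u x * weight u xs                                 ≤⟨ *-mono-≤ (0≤u x) 0≤V+Δ ≤-refl ih ⟩
    u x * (V + Λ * δ)                                 ≡⟨ ℚ.*-distribˡ-+ (u x) V (Λ * δ) ⟩
    u x * V + u x * (Λ * δ)                           ≤⟨ +-mono-≤
        (*-mono-≤ (0≤u x) 0≤V (u≤v x) ≤-refl) (*-mono-≤ (0≤u x) 0≤Δ (u≤2 x) ≤-refl) ⟩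
    (v x + δ) * V + 2ℚ * (Λ * δ)                      ≡⟨ cong (_+ 2ℚ * (Λ * δ)) (ℚ.*-distribʳ-+ V (v x) δ) ⟩
    v x * V + δ * V + 2ℚ * (Λ * δ)                    ≤⟨ ℚ.+-monoˡ-≤ _ (ℚ.+-monoʳ-≤ (v x * V)
        (*-mono-≤ 0≤δ (^-nonNeg (length xs) 0≤2) ≤-refl (weight-≤-^ 0≤v 0≤2 v≤2 xs))) ⟩
    v x * V + δ * 2ℚ ^ length xs + 2ℚ * (Λ * δ)       ≡⟨
        solve 5 (λ w δ P t Λ → w :+ δ :* P :+ t :* (Λ :* δ) := w :+ (P :+ t :* Λ) :* δ) refl
          (v x * V) δ (2ℚ ^ length xs) 2ℚ Λ ⟩
    v x * V + (2ℚ ^ length xs + 2ℚ * Λ) * δ           ∎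
    where
    open ℚSolver.+-*-Solver
    open ℚ.≤-Reasoning
    V Λ : ℚ
    V = weight v xs
    Λ = lipschitz (length xs)
    ih : weight u xs ≤ V + Λ * δ
    ih = weight-close 0≤δ 0≤u 0≤v u≤2 v≤2 u≤v xs
    0≤V : 0ℚ ≤ V
    0≤V = weight-nonNeg 0≤v xs
    0≤Δ : 0ℚ ≤ Λ * δ
    0≤Δ = *-nonNeg (lipschitz-nonNeg (length xs)) 0≤δ
    0≤V+Δ : 0ℚ ≤ V + Λ * δ
    0≤V+Δ = +-nonNeg 0≤V 0≤Δ

  ^-+ : ∀ x m n → x ^ (m ℕ.+ n) ≡ x ^ m * x ^ n
  ^-+ x zero    n = sym (ℚ.*-identityˡ _)
  ^-+ x (suc m) n = trans (cong (x *_) (^-+ x m n)) (sym (ℚ.*-assoc x _ _))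

  ^-mono : ∀ {x y} n → 0ℚ ≤ x → x ≤ y → x ^ n ≤ y ^ n
  ^-mono zero    0≤x x≤y = ≤-refl
  ^-mono (suc n) 0≤x x≤y = *-mono-≤ 0≤x (^-nonNeg n (≤-trans 0≤x x≤y)) x≤y (^-mono n 0≤x x≤y)

  ^-growth : ∀ {x y d θ} n → 0ℚ ≤ θ → θ ≤ x → 0ℚ ≤ d → y ≡ x + d → x ^ suc n + d * θ ^ n ≤ y ^ suc n
  ^-growth {x} {y} {d} {θ} n 0≤θ θ≤x 0≤d refl = begin
    x * x ^ n + d * θ ^ n   ≤⟨ +-mono-≤ (*-mono-≤ 0≤x (^-nonNeg n 0≤y) ≤-refl (^-mono n 0≤x x≤y))
                                         (*-mono-≤ 0≤d (^-nonNeg n 0≤y) ≤-refl (^-mono n 0≤θ (≤-trans θ≤x x≤y))) ⟩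
    x * (x + d) ^ n + d * (x + d) ^ n ≡⟨ sym (ℚ.*-distribʳ-+ ((x + d) ^ n) x d) ⟩
    (x + d) * (x + d) ^ n   ∎
    where
    open ℚ.≤-Reasoning
    0≤x : 0ℚ ≤ x
    0≤x = ≤-trans 0≤θ θ≤x
    x≤y : x ≤ x + d
    x≤y = p≤p+q x 0≤d
    0≤y : 0ℚ ≤ x + d
    0≤y = ≤-trans 0≤x x≤y

  -- Rigidity: a near tie of two monomials determines a coordinate up to a small error.

  module _ {m n : ℕ} (X Z : Fin m × Fin n) (X≢Z : X ≢ Z) where

    Label : Set
    Label = Fin m × Fin n

    -- With the value 1 at `X` and at `Z` the weight becomes the cofactor of the powers of these
    -- two.
    others : (Label → ℚ) → Label → ℚ
    others v f = if does (X ≟ₚ f) then 1ℚ else if does (Z ≟ₚ f) then 1ℚ else v f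

    others-≥ : ∀ {v θ} → θ ≤ 1ℚ → (∀ f → θ ≤ v f) → ∀ f → θ ≤ others v f
    others-≥ θ≤1 θ≤v f with X ≟ₚ f | Z ≟ₚ f
    ... | yes _ | _     = θ≤1
    ... | no _  | yes _ = θ≤1
    ... | no _  | no _  = θ≤v f

    weight-others : ∀ {u v} → (∀ f → f ≢ X → f ≢ Z → u f ≡ v f) → ∀ L → weight (others u) L ≡ weight (others v) L
    weight-others {u} {v} u≡v []      = refl
    weight-others {u} {v} u≡v (f ∷ L) = cong₂ _*_ head≡ (weight-others u≡v L)
      where
      head≡ : others u f ≡ others v f
      head≡ with X ≟ₚ f | Z ≟ₚ f
      ... | yes _  | _      = refl
      ... | no _   | yes _  = refl
      ... | no X≢f | no Z≢f = u≡v f (X≢f ∘ sym) (Z≢f ∘ sym)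

    weight-split : ∀ v L → weight v L ≡ v X ^ # X L * v Z ^ # Z L * weight (others v) L
    weight-split v []      = refl
    weight-split v (f ∷ L) = trans (cong (v f *_) (weight-split v L)) step
      where
      open ℚSolver.+-*-Solver
      P Q W : ℚ
      P = v X ^ # X L
      Q = v Z ^ # Z L
      W = weight (others v) L
      step : v f * (P * Q * W) ≡ v X ^ # X (f ∷ L) * v Z ^ # Z (f ∷ L) * weight (others v) (f ∷ L)
      step with X ≟ₚ f | Z ≟ₚ f
      ... | yes refl | yes refl = contradiction refl X≢Z
      ... | yes refl | no _     =
        solve 4 (λ x P Q W → x :* (P :* Q :* W) := x :* P :* Q :* (con 1ℚ :* W)) refl (v X) P Q W
      ... | no _     | yes refl =
        solve 4 (λ z P Q W → z :* (P :* Q :* W) := P :* (z :* Q) :* (con 1ℚ :* W)) refl (v Z) P Q W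
      ... | no _     | no _     =
        solve 4 (λ x P Q W → x :* (P :* Q :* W) := P :* Q :* (x :* W)) refl (v f) P Q W

    -- Of two monomials, T has the larger exponent at X and the smaller one at Z.  Raising the
    -- value of X and lowering that of Z by d cannot keep both ratios T / S close to 1.
    module _ (S T : List Label) (c e : ℕ) (#X : # X T ≡ # X S ℕ.+ c) (#Z : # Z S ≡ # Z T ℕ.+ e)
             (θ : ℚ) (0<θ : 0ℚ < θ) (θ≤1 : θ ≤ 1ℚ) where

      private
        0≤θ : 0ℚ ≤ θ
        0≤θ = <⇒≤ 0<θ

        -- What remains of the difference of the two monomials after division by their common powers
        -- of `X` and `Z`. For nonnegative values it is monotone upwards in the value of `X` and
        -- downwards in that of `Z`.
        gap : (Label → ℚ) → ℚ
        gap v = v X ^ c * weight (others v) T - v Z ^ e * weight (others v) S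

        common : (Label → ℚ) → ℚ
        common v = v X ^ # X S * v Z ^ # Z T

        floor : ℚ
        floor = θ ^ # X S * θ ^ # Z T

        difference : ∀ v → weight v T ≡ weight v S + common v * gap v
        difference v = trans (weight-split v T) (trans
          (cong (λ y → y * v Z ^ # Z T * weight (others v) T) (trans (cong (v X ^_) #X) (^-+ (v X) (# X S) c)))
          (trans
            (solve 6 (λ A C B U V E → A :* C :* B :* U := A :* (B :* E) :* V :+ A :* B :* (C :* U :- E :* V)) refl
              (v X ^ # X S) (v X ^ c) (v Z ^ # Z T) (weight (others v) T) (weight (others v) S) (v Z ^ e))
            (cong (_+ common v * gap v) (sym (trans (weight-split v S)
              (cong (λ y → v X ^ # X S * y * weight (others v) S) (trans (cong (v Z ^_) #Z) (^-+ (v Z) (# Z T) e))))))))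
          where open ℚSolver.+-*-Solver

        floor≤common : ∀ {v} → (∀ f → θ ≤ v f) → floor ≤ common v
        floor≤common θ≤v = *-mono-≤ (^-nonNeg (# X S) 0≤θ) (^-nonNeg (# Z T) (≤-trans 0≤θ (θ≤v Z)))
          (^-mono (# X S) 0≤θ (θ≤v X)) (^-mono (# Z T) 0≤θ (θ≤v Z))

        0≤floor : 0ℚ ≤ floor
        0≤floor = *-nonNeg (^-nonNeg (# X S) 0≤θ) (^-nonNeg (# Z T) 0≤θ)

        -- Replaces the varying factor `C` by the constant `floor`: for `g ≥ 0` the product shrinks,
        -- and for `g ≤ 0` it is at most 0 anyway.
        scaled-≤ : ∀ {C g μ} → 0ℚ ≤ μ → floor ≤ C → C * g ≤ μ → floor * g ≤ μ
        scaled-≤ {C} {g} {μ} 0≤μ floor≤C Cg≤μ with ℚ.≤-total 0ℚ g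
        ... | inj₁ 0≤g = ≤-trans (*-mono-≤ 0≤floor 0≤g floor≤C ≤-refl) Cg≤μ
        ... | inj₂ g≤0 = ≤-trans (subst (floor * g ≤_) (ℚ.*-zeroʳ floor) (*-mono-≤ 0≤floor ≤-refl ≤-refl g≤0)) 0≤μ

        gap-above : ∀ {v μ} → 0ℚ ≤ μ → (∀ f → θ ≤ v f) → weight v T ≤ weight v S + μ → floor * gap v ≤ μ
        gap-above {v} {μ} 0≤μ θ≤v h = scaled-≤ 0≤μ (floor≤common θ≤v)
          (linear₁ (subst (_≤ weight v S + μ) (difference v) h)
            (solve 3 (λ s d μ → d :+ (s :+ μ :- (s :+ d)) := μ) refl (weight v S) (common v * gap v) μ))
          where open ℚSolver.+-*-Solver

        gap-below : ∀ {v μ} → 0ℚ ≤ μ → (∀ f → θ ≤ v f) → weight v S ≤ weight v T + μ → floor * (- gap v) ≤ μ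
        gap-below {v} {μ} 0≤μ θ≤v h = scaled-≤ 0≤μ (floor≤common θ≤v)
          (linear₁ (subst (λ y → weight v S ≤ y + μ) (difference v) h)
            (solve 4 (λ s C g μ → C :* (:- g) :+ (s :+ C :* g :+ μ :- s) := μ) refl (weight v S) (common v) (gap v) μ))
          where open ℚSolver.+-*-Solver

      private
        Rigid : ℚ → Set
        Rigid κ = ∀ u v d μ → 0ℚ ≤ d → 0ℚ ≤ μ → (∀ f → θ ≤ u f) → (∀ f → θ ≤ v f) →
          v X ≡ u X + d → u Z ≡ v Z + d → (∀ f → f ≢ X → f ≢ Z → u f ≡ v f) →
          weight v T ≤ weight v S + μ → weight u S ≤ weight u T + μ → κ * d ≤ μ + μ

        module _ (u v : Label → ℚ) (d μ : ℚ) (0≤d : 0ℚ ≤ d) (0≤μ : 0ℚ ≤ μ)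
                 (θ≤u : ∀ f → θ ≤ u f) (θ≤v : ∀ f → θ ≤ v f)
                 (vX : v X ≡ u X + d) (uZ : u Z ≡ v Z + d) (u≡v : ∀ f → f ≢ X → f ≢ Z → u f ≡ v f)
                 (hv : weight v T ≤ weight v S + μ) (hu : weight u S ≤ weight u T + μ) where

          gaps-close : floor * (gap v - gap u) ≤ μ + μ
          gaps-close = subst (_≤ μ + μ)
            (solve 3 (λ F g g′ → F :* g :+ F :* (:- g′) := F :* (g :- g′)) refl floor (gap v) (gap u))
            (+-mono-≤ (gap-above 0≤μ θ≤v hv) (gap-below 0≤μ θ≤u hu))
            where open ℚSolver.+-*-Solver

          conclude : ∀ {g} → 0ℚ ≤ g → d * g ≤ gap v - gap u → floor * g * d ≤ μ + μ
          conclude {g} 0≤g h = ≤-trans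
            (subst (_≤ floor * (gap v - gap u)) (solve 3 (λ F g d → F :* (d :* g) := F :* g :* d) refl floor g d)
              (*-mono-≤ 0≤floor (≤-trans (*-nonNeg 0≤d 0≤g) h) ≤-refl h))
            gaps-close
            where open ℚSolver.+-*-Solver

          wT wS : ℚ
          wT = weight (others v) T
          wS = weight (others v) S

          gap-difference : (v X ^ c - u X ^ c) * wT + (u Z ^ e - v Z ^ e) * wS ≡ gap v - gap u
          gap-difference = trans
            (solve 6 (λ a b t c d s → (a :- b) :* t :+ (c :- d) :* s := (a :* t :- d :* s) :- (b :* t :- c :* s)) refl
              (v X ^ c) (u X ^ c) wT (u Z ^ e) (v Z ^ e) wS)
            (cong₂ (λ t s → gap v - (u X ^ c * t - u Z ^ e * s)) (sym (weight-others u≡v T)) (sym (weight-others u≡v S)))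
            where open ℚSolver.+-*-Solver

          θ≤w : ∀ L → θ ^ length L ≤ weight (others v) L
          θ≤w L = ^-≤-weight 0≤θ (others-≥ θ≤1 θ≤v) L

          0≤w : ∀ L → 0ℚ ≤ weight (others v) L
          0≤w L = ≤-trans (^-nonNeg (length L) 0≤θ) (θ≤w L)

          power-≤ : ∀ {x y} m → θ ≤ x → y ≡ x + d → 0ℚ ≤ y ^ m - x ^ m
          power-≤ {x} m θ≤x refl = 0≤diff (^-mono m (≤-trans 0≤θ θ≤x) (p≤p+q x 0≤d))

          power-growth : ∀ {x y} m L → θ ≤ x → y ≡ x + d →
                         d * (θ ^ m * θ ^ length L) ≤ (y ^ suc m - x ^ suc m) * weight (others v) L
          power-growth {x} {y} m L θ≤x eq = subst (_≤ (y ^ suc m - x ^ suc m) * weight (others v) L)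
            (ℚ.*-assoc d (θ ^ m) (θ ^ length L))
            (*-mono-≤ (*-nonNeg 0≤d (^-nonNeg m 0≤θ)) (0≤w L)
              (linear₁ (^-growth {x} {y} m 0≤θ θ≤x 0≤d eq)
                (solve 3 (λ g x y → g :+ (y :- (x :+ g)) := y :- x) refl (d * θ ^ m) (x ^ suc m) (y ^ suc m)))
              (θ≤w L))
            where open ℚSolver.+-*-Solver

          bound-X : ∀ {m} → c ≡ suc m → floor * (θ ^ m * θ ^ length T) * d ≤ μ + μ
          bound-X {m} refl = conclude (*-nonNeg (^-nonNeg m 0≤θ) (^-nonNeg (length T) 0≤θ))
            (subst (d * (θ ^ m * θ ^ length T) ≤_) gap-difference
              (≤-trans (power-growth m T (θ≤u X) vX)
                (p≤p+q _ (*-nonNeg (power-≤ e (θ≤v Z) uZ) (0≤w S)))))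

        0<floor : 0ℚ < floor
        0<floor = *-pos (^-pos (# X S) 0<θ) (^-pos (# Z T) 0<θ)

      -- The witness is a lower bound for the slope. On values at least `θ` the power with exponent
      -- `suc n` of `X` grows with slope at least `θ ^ n`, its cofactor is at least `θ ^ length T`,
      -- and the term of `Z` changes in the same favourable direction. The tie bounds `gap v` from
      -- above and `gap u` from below, so a large `d` is impossible.
      rigid : (∃ λ n → c ≡ suc n) → ∃ λ κ → 0ℚ < κ × Rigid κ
      rigid (n , eq) = floor * (θ ^ n * θ ^ length T) , *-pos 0<floor (*-pos (^-pos n 0<θ) (^-pos (length T) 0<θ)) ,
        λ u v d μ 0≤d 0≤μ θ≤u θ≤v vX uZ u≡v hv hu → bound-X u v d μ 0≤d 0≤μ θ≤u θ≤v vX uZ u≡v hv hu eq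

  -- Rows of approximate distributions and the chart.

  ∑-close : ∀ {n δ} (u v : Vector ℚ n) → (∀ i → u i ≤ v i + δ) → ∑ u ≤ ∑ v + ι n * δ
  ∑-close {zero}  {δ} u v u≤v = ≤-reflexive (solve 1 (λ δ → con 0ℚ := con 0ℚ :+ con 0ℚ :* δ) refl δ)
    where open ℚSolver.+-*-Solver
  ∑-close {suc n} {δ} u v u≤v = ≤-trans (+-mono-≤ (u≤v zero) (∑-close (u ∘ suc) (v ∘ suc) (u≤v ∘ suc)))
    (≤-reflexive (solve 4 (λ a s n δ → a :+ δ :+ (s :+ n :* δ) := a :+ s :+ (con 1ℚ :+ n) :* δ) refl
      (v zero) (∑ (v ∘ suc)) (ι n) δ))
    where open ℚSolver.+-*-Solver

  ∑-≥ : ∀ {n η} (v : Vector ℚ n) → (∀ i → - η ≤ v i) → 0ℚ ≤ ∑ v + ι n * η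
  ∑-≥ {zero}  {η} v -η≤v = ≤-reflexive (solve 1 (λ δ → con 0ℚ := con 0ℚ :+ con 0ℚ :* δ) refl η)
    where open ℚSolver.+-*-Solver
  ∑-≥ {suc n} {η} v -η≤v = linear₂ (-η≤v zero) (∑-≥ (v ∘ suc) (-η≤v ∘ suc))
    (solve 4 (λ a s n η → con 0ℚ :+ ((a :- :- η) :+ (s :+ n :* η :- con 0ℚ)) := a :+ s :+ (con 1ℚ :+ n) :* η) refl
      (v zero) (∑ (v ∘ suc)) (ι n) η)
    where open ℚSolver.+-*-Solver

  entry-≤-∑ : ∀ {n η} (v : Vector ℚ n) → 0ℚ ≤ η → (∀ i → - η ≤ v i) → ∀ j → v j ≤ ∑ v + ι n * η
  entry-≤-∑ {suc n} {η} v 0≤η -η≤v zero = linear₂ 0≤η (∑-≥ (v ∘ suc) (-η≤v ∘ suc))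
    (solve 4 (λ a s n η → a :+ ((η :- con 0ℚ) :+ (s :+ n :* η :- con 0ℚ)) := a :+ s :+ (con 1ℚ :+ n) :* η) refl
      (v zero) (∑ (v ∘ suc)) (ι n) η)
    where open ℚSolver.+-*-Solver
  entry-≤-∑ {suc n} {η} v 0≤η -η≤v (suc j) = linear₂ (-η≤v zero) (entry-≤-∑ (v ∘ suc) 0≤η (-η≤v ∘ suc) j)
    (solve 5 (λ a s n η x → x :+ ((a :- :- η) :+ (s :+ n :* η :- x)) := a :+ s :+ (con 1ℚ :+ n) :* η) refl
      (v zero) (∑ (v ∘ suc)) (ι n) η (v (suc j)))
    where open ℚSolver.+-*-Solver

  ∑-cong : ∀ {n} {v w : Vector ℚ n} → (∀ i → v i ≡ w i) → ∑ v ≡ ∑ w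
  ∑-cong {zero}  eq = refl
  ∑-cong {suc n} eq = cong₂ _+_ (eq zero) (∑-cong (eq ∘ suc))

  ∑-replace : ∀ {n} (v w : Vector ℚ n) j → (∀ i → i ≢ j → v i ≡ w i) → ∑ v + w j ≡ ∑ w + v j
  ∑-replace {suc n} v w zero eq =
    trans (cong (λ y → v zero + y + w zero) (∑-cong λ i → eq (suc i) λ ()))
      (solve 3 (λ a b s → a :+ s :+ b := b :+ s :+ a) refl (v zero) (w zero) (∑ (w ∘ suc)))
    where open ℚSolver.+-*-Solver
  ∑-replace {suc n} v w (suc j) eq = begin
    v zero + ∑ (v ∘ suc) + w (suc j)   ≡⟨ ℚ.+-assoc (v zero) (∑ (v ∘ suc)) (w (suc j)) ⟩
    v zero + (∑ (v ∘ suc) + w (suc j)) ≡⟨ cong₂ _+_ (eq zero λ ())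
        (∑-replace (v ∘ suc) (w ∘ suc) j (λ i i≢j → eq (suc i) λ { refl → i≢j refl })) ⟩
    w zero + (∑ (w ∘ suc) + v (suc j)) ≡⟨ sym (ℚ.+-assoc (w zero) (∑ (w ∘ suc)) (v (suc j))) ⟩
    w zero + ∑ (w ∘ suc) + v (suc j)   ∎
    where open ≡-Reasoning

  -- The chart forgets column `zero`, so a grid point determines a full matrix only through the row
  -- sums.
  val : ∀ {a b} → Point a b → Fin a × Fin (suc b) → ℚ
  val g (r , zero)  = 1ℚ - ∑ (g r)
  val g (r , suc j) = g r j

  module _ {a b : ℕ} (r : Fin a) (s : Fin b) (g : Point a b) where

    val-special : ∀ x → val (update r s g x) (r , suc s) ≡ x
    val-special x with special? r s r s
    ... | yes _ = refl
    ... | no ¬p = contradiction (refl , refl) ¬p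

    update-ordinary : ∀ x x′ i j → ¬ (i ≡ r × j ≡ s) → update r s g x i j ≡ update r s g x′ i j
    update-ordinary x x′ i j ¬p with special? r s i j
    ... | yes p = contradiction p ¬p
    ... | no  _ = refl

    -- Moving one chart coordinate moves exactly two entries, by the same amount in opposite
    -- directions. This is why the exponents of two labels of the row decide about monotonicity.
    val-zero : ∀ x x′ d → x ≡ x′ + d → val (update r s g x′) (r , zero) ≡ val (update r s g x) (r , zero) + d
    val-zero x x′ d refl = begin
      1ℚ - A                  ≡⟨ solve 3 (λ A x d → con 1ℚ :- A := con 1ℚ :- (A :+ (x :+ d)) :+ x :+ d) refl A x′ d ⟩
      1ℚ - (A + (x′ + d)) + x′ + d   ≡⟨ cong (λ y → 1ℚ - y + x′ + d) balance ⟩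
      1ℚ - (B + x′) + x′ + d  ≡⟨ solve 3 (λ B x d → con 1ℚ :- (B :+ x) :+ x :+ d := con 1ℚ :- B :+ d) refl B x′ d ⟩
      1ℚ - B + d              ∎
      where
      open ≡-Reasoning
      open ℚSolver.+-*-Solver
      A B : ℚ
      A = ∑ (update r s g x′ r)
      B = ∑ (update r s g (x′ + d) r)
      balance : A + (x′ + d) ≡ B + x′
      balance = subst₂ (λ y y′ → A + y ≡ B + y′) (val-special (x′ + d)) (val-special x′)
        (∑-replace _ _ s λ i i≢s → update-ordinary x′ (x′ + d) r i λ { (_ , eq) → i≢s eq })

    val-ordinary : ∀ x x′ f → f ≢ (r , suc s) → f ≢ (r , zero) → val (update r s g x) f ≡ val (update r s g x′) f
    val-ordinary x x′ (i , zero)  f≢X f≢Z = cong (λ y → 1ℚ - y)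
      (∑-cong λ j → update-ordinary x x′ i j λ { (refl , _) → f≢Z refl })
    val-ordinary x x′ (i , suc j) f≢X f≢Z = update-ordinary x x′ i j λ { (refl , refl) → f≢X refl }

  -- Rational stages of a chain.

  Eventually : (ℕ → Set) → Set
  Eventually P = ∃ λ N → ∀ n → N ℕ.≤ n → P n

  eventually-× : ∀ {P Q : ℕ → Set} → Eventually P → Eventually Q → Eventually (λ n → P n × Q n)
  eventually-× (M , p) (N , q) = M ℕ.⊔ N , λ n le →
    p n (ℕ.≤-trans (ℕ.m≤m⊔n M N) le) , q n (ℕ.≤-trans (ℕ.m≤n⊔m M N) le)

  eventually-map : ∀ {P Q : ℕ → Set} → (∀ n → P n → Q n) → Eventually P → Eventually Q
  eventually-map f (N , p) = N , λ n le → f n (p n le)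

  eventually-∀ : ∀ {m} {P : Fin m → ℕ → Set} → (∀ i → Eventually (P i)) → Eventually (λ n → ∀ i → P i n)
  eventually-∀ {zero}  ev = 0 , λ n _ ()
  eventually-∀ {suc m} ev with eventually-× (ev zero) (eventually-∀ (ev ∘ suc))
  ... | N , p = N , λ n le → λ { zero → proj₁ (p n le) ; (suc i) → proj₂ (p n le) i }

  -- The initial distribution becomes row `zero`, so that a probability is one monomial in the
  -- entries of a matrix with `suc k` rows.
  labels : ∀ {k n} → Sequence k n → List (Fin (suc k) × Fin k)
  labels s = (zero , head s) ∷ map (λ (i , j) → suc i , j) (transitions s)

  values : ∀ {k} → MarkovChain k → ℕ → Fin (suc k) × Fin k → ℚ
  values M m (zero  , j) = seq (initial M j) m
  values M m (suc i , j) = seq (transition M i j) m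

  seq-Pr : ∀ {k n} (M : MarkovChain k) (s : Sequence k n) m → seq (Pr M s) m ≡ weight (values M m) (labels s)
  seq-Pr M s m = cong (seq (initial M (head s)) m *_) (go (transitions s))
    where
    go : ∀ es → seq (List.foldr _*ℝ_ 1ℝ (List.map (λ (i , j) → transition M i j) es)) m ≡
                weight (values M m) (map (λ (i , j) → suc i , j) es)
    go []       = refl
    go (e ∷ es) = cong (seq (transition M (proj₁ e) (proj₂ e)) m *_) (go es)

  seq-∑ : ∀ {n} (v : Vector ℝ n) m → seq (foldr _+ℝ_ 0ℝ v) m ≡ ∑ (λ j → seq (v j) m)
  seq-∑ {zero}  v m = refl
  seq-∑ {suc n} v m = cong (seq (v zero) m +_) (seq-∑ (v ∘ suc) m)

  eventually-distribution : ∀ {n} {v : Vector ℝ n} → IsDistribution v → ∀ η → 0ℚ < η →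
    Eventually λ m → (∀ j → - η ≤ seq (v j) m) × ∑ (λ j → seq (v j) m) ≈[ η ] 1ℚ
  eventually-distribution {v = v} (0≤v , ∑≤1 , 1≤∑) η 0<η = eventually-×
    (eventually-∀ λ j → proj₁ (0≤v j η 0<η) , λ m le → linear₁ (proj₂ (0≤v j η 0<η) m le)
      (solve 2 (λ v η → :- η :+ (v :+ η :- con 0ℚ) := v) refl (seq (v j) m) η))
    (eventually-×
      (proj₁ (∑≤1 η 0<η) , λ m le → subst (_≤ 1ℚ + η) (seq-∑ v m) (proj₂ (∑≤1 η 0<η) m le))
      (proj₁ (1≤∑ η 0<η) , λ m le → subst (λ y → 1ℚ ≤ y + η) (seq-∑ v m) (proj₂ (1≤∑ η 0<η) m le)))
    where open ℚSolver.+-*-Solver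

  -- At a finite stage the Cauchy sequences of the entries satisfy the constraints of a distribution
  -- only up to `η`.
  record ApproximateChain {k : ℕ} (q : Fin (suc k) × Fin k → ℚ) (η : ℚ) : Set where
    field
      nonNeg : ∀ r j → - η ≤ q (r , j)
      total  : ∀ r → ∑ (λ j → q (r , j)) ≈[ η ] 1ℚ

  entries : ∀ {k} → MarkovChain k → Fin (suc k) → Vector ℝ k
  entries M zero    = initial M
  entries M (suc i) = transition M i

  entries-distribution : ∀ {k} (M : MarkovChain k) r → IsDistribution (entries M r)
  entries-distribution M zero    = initial-dist M
  entries-distribution M (suc i) = transition-dist M i

  seq-entries : ∀ {k} (M : MarkovChain k) r m j → seq (entries M r j) m ≡ values M m (r , j)
  seq-entries M zero    m j = refl
  seq-entries M (suc i) m j = refl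

  eventually-chain : ∀ {k} (M : MarkovChain k) η → 0ℚ < η → Eventually λ m → ApproximateChain (values M m) η
  eventually-chain M η 0<η = eventually-map
    (λ m p → record
      { nonNeg = λ r j → subst (- η ≤_) (seq-entries M r m j) (proj₁ (p r) j)
      ; total  = λ r → subst (_≈[ η ] 1ℚ) (∑-cong (seq-entries M r m)) (proj₂ (p r))
      })
    (eventually-∀ λ r → eventually-distribution (entries-distribution M r) η 0<η)

  eventually-Pr-≤ : ∀ {k n} (M : MarkovChain k) (s t : Sequence k n) → Pr M t ≤ℝ Pr M s → ∀ η → 0ℚ < η →
    Eventually λ m → weight (values M m) (labels t) ≤ weight (values M m) (labels s) + η
  eventually-Pr-≤ M s t t≤s η 0<η = eventually-map
    (λ m → subst₂ (λ x y → x ≤ y + η) (seq-Pr M t m) (seq-Pr M s m)) (t≤s η 0<η)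

  -- One stage of the chain is compared with all later stages of `x`, because membership in a box
  -- speaks of all late stages. One `η` pays for the Cauchy modulus of `x`, the other for `chart M`
  -- being only setoid-equal to `x`.
  eventually-chart : ∀ {κ} (M : MarkovChain (suc κ)) (x : Fin (suc (suc κ)) → Fin κ → ℝ) → (∀ i j → chart M i j ≈ℝ x i j) → ∀ η → 0ℚ < η →
    Eventually λ m → ∀ i j m′ → m ℕ.≤ m′ → seq (x i j) m′ ≈[ η + η ] values M m (i , suc j)
  eventually-chart {κ} M x chart≈ η 0<η = eventually-∀ λ i → eventually-∀ λ j → one i j
    where
    open ℚSolver.+-*-Solver
    shift : ∀ {y z w} → y ≤ z + η → z ≤ w + η → y ≤ w + (η + η)
    shift {y} {z} {w} h h′ = linear₂ h h′
      (solve 4 (λ y z w η → y :+ ((z :+ η :- y) :+ (w :+ η :- z)) := w :+ (η :+ η)) refl y z w η)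
    seq-chart : ∀ i j m → seq (chart M i j) m ≡ values M m (i , suc j)
    seq-chart zero    j m = refl
    seq-chart (suc i) j m = refl
    one : ∀ i j → Eventually λ m → ∀ m′ → m ℕ.≤ m′ → seq (x i j) m′ ≈[ η + η ] values M m (i , suc j)
    one i j = N ℕ.⊔ (N₁ ℕ.⊔ N₂) , λ m le m′ m≤m′ →
      let N≤m  = ℕ.≤-trans (ℕ.m≤m⊔n N _) le
          N₁≤m = ℕ.≤-trans (ℕ.m≤m⊔n N₁ N₂) (ℕ.≤-trans (ℕ.m≤n⊔m N _) le)
          N₂≤m = ℕ.≤-trans (ℕ.m≤n⊔m N₁ N₂) (ℕ.≤-trans (ℕ.m≤n⊔m N _) le)
          step = proj₂ (cauchy (x i j) η 0<η) m′ m (ℕ.≤-trans N≤m m≤m′) N≤m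
      in  subst (seq (x i j) m′ ≈[ η + η ]_) (seq-chart i j m)
            ( shift {seq (x i j) m′} {seq (x i j) m} {seq (chart M i j) m}
                (∣p-q∣≤⇒≤ {seq (x i j) m′} {seq (x i j) m} step) (proj₂ (proj₂ (chart≈ i j) η 0<η) m N₂≤m)
            , shift {seq (chart M i j) m} {seq (x i j) m} {seq (x i j) m′}
                (proj₂ (proj₁ (chart≈ i j) η 0<η) m N₁≤m) (∣p-q∣≤⇒≥ {seq (x i j) m′} {seq (x i j) m} step))
      where
      N N₁ N₂ : ℕ
      N  = proj₁ (cauchy (x i j) η 0<η)
      N₁ = proj₁ (proj₁ (chart≈ i j) η 0<η)
      N₂ = proj₁ (proj₂ (chart≈ i j) η 0<η)

  module _ {κ : ℕ} {q : Fin (suc (suc κ)) × Fin (suc κ) → ℚ} {h η : ℚ} (0≤η : 0ℚ ≤ η) (η-h : ι (suc (suc κ)) * η ≡ h)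
           (chain : ApproximateChain q η) where
    open ApproximateChain chain

    private
      η≤h : η ≤ h
      η≤h = subst (η ≤_) (trans (solve 2 (λ n η → η :+ n :* η := (con 1ℚ :+ n) :* η) refl (ι (suc κ)) η) η-h)
        (p≤p+q η (*-nonNeg (0≤ι (suc κ)) 0≤η))
        where open ℚSolver.+-*-Solver

    chain-lower : ∀ f → - h ≤ q f
    chain-lower (r , j) = ≤-trans (ℚ.neg-antimono-≤ η≤h) (nonNeg r j)

    -- The entries of the row may each be as low as `- η`, so an entry exceeds the row sum by at
    -- most `suc κ` times `η`, and the row sum exceeds 1 by at most `η`. Together this is the
    -- multiple of `η` that `η-h` equates with `h`.
    chain-upper : ∀ f → q f ≤ 1ℚ + h
    chain-upper (r , j) = linear₂ (entry-≤-∑ (λ j → q (r , j)) 0≤η (nonNeg r) j) (proj₁ (total r))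
      (trans (solve 4 (λ x s n η → x :+ ((s :+ n :* η :- x) :+ (con 1ℚ :+ η :- s)) := con 1ℚ :+ (con 1ℚ :+ n) :* η) refl
        (q (r , j)) (∑ λ j → q (r , j)) (ι (suc κ)) η) (cong (1ℚ +_) η-h))
      where open ℚSolver.+-*-Solver

    -- The entry in column `zero` collects the rounding errors of its whole row, whence the factor.
    chain-near : ∀ {z : Point (suc (suc κ)) κ} → (∀ i j → q (i , suc j) ≈[ h ] z i j) → 0ℚ ≤ h →
                 ∀ f → q f ≈[ ι (suc κ) * h ] val z f
    chain-near {z} near 0≤h (r , zero) =
      linear₃ (proj₁ (total r)) (∑-close (z r) (λ j → q (r , suc j)) (λ j → proj₂ (near r j))) η≤h
        (solve 6 (λ q s z n h η → q :+ ((con 1ℚ :+ η :- (q :+ s)) :+ ((s :+ n :* h :- z) :+ (h :- η))) :=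
                                  con 1ℚ :- z :+ (con 1ℚ :+ n) :* h) refl (q (r , zero)) Q (∑ (z r)) (ι κ) h η) ,
      linear₃ (proj₂ (total r)) (∑-close (λ j → q (r , suc j)) (z r) (λ j → proj₁ (near r j))) η≤h
        (solve 6 (λ q s z n h η → con 1ℚ :- z :+ ((q :+ s :+ η :- con 1ℚ) :+ ((z :+ n :* h :- s) :+ (h :- η))) :=
                                  q :+ (con 1ℚ :+ n) :* h) refl (q (r , zero)) Q (∑ (z r)) (ι κ) h η)
      where
      open ℚSolver.+-*-Solver
      Q : ℚ
      Q = ∑ λ j → q (r , suc j)
    chain-near {z} near 0≤h (r , suc j) = widen (q (r , suc j)) (z r j) (proj₁ (near r j)) , widen (z r j) (q (r , suc j)) (proj₂ (near r j))
      where
      open ℚSolver.+-*-Solver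
      widen : ∀ x y → x ≤ y + h → x ≤ y + ι (suc κ) * h
      widen x y x≤y = ≤-trans x≤y (ℚ.+-monoʳ-≤ y (subst (h ≤_)
        (solve 2 (λ n h → h :+ n :* h := (con 1ℚ :+ n) :* h) refl (ι κ) h)
        (p≤p+q h (*-nonNeg (0≤ι κ) 0≤h))))

  -- Rigidity along a coordinate line of the chart.

  module _ {a b : ℕ} where

    module Line (r : Fin a) (s : Fin b) (S T : List (Fin a × Fin (suc b))) (θ : ℚ) (0<θ : 0ℚ < θ) (θ≤1 : θ ≤ 1ℚ) where

      Agree : ℚ → Point a b → Set
      Agree μ z = (∀ f → θ ≤ val z f) × weight (val z) T ≤ weight (val z) S + μ × weight (val z) S ≤ weight (val z) T + μ

      Rigidity : Set
      Rigidity = ∃ λ κ → 0ℚ < κ × (∀ g x x′ d μ → 0ℚ ≤ d → 0ℚ ≤ μ → x ≡ x′ + d →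
        Agree μ (update r s g x) → Agree μ (update r s g x′) → κ * d ≤ μ + μ)

      rises : # (r , suc s) S ℕ.< # (r , suc s) T → # (r , zero) T ℕ.≤ # (r , zero) S → Rigidity
      rises X< Z≤ = proj₁ R , proj₁ (proj₂ R) , λ g x x′ d μ 0≤d 0≤μ x≡ (θ≤v , v≤ , _) (θ≤u , _ , u≤) →
        proj₂ (proj₂ R) (val (update r s g x′)) (val (update r s g x)) d μ 0≤d 0≤μ θ≤u θ≤v
          (trans (val-special r s g x) (trans x≡ (cong (_+ d) (sym (val-special r s g x′)))))
          (val-zero r s g x x′ d x≡) (λ f → val-ordinary r s g x′ x f) v≤ u≤
        where
        excess : ∃ λ c → suc (# (r , suc s) S) ℕ.+ c ≡ # (r , suc s) T
        excess = ℕ.m≤n⇒∃[o]m+o≡n X<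
        deficit : ∃ λ e → # (r , zero) T ℕ.+ e ≡ # (r , zero) S
        deficit = ℕ.m≤n⇒∃[o]m+o≡n Z≤
        R = rigid (r , suc s) (r , zero) (λ ()) S T (suc (proj₁ excess)) (proj₁ deficit)
              (sym (trans (ℕ.+-suc _ (proj₁ excess)) (proj₂ excess))) (sym (proj₂ deficit)) θ 0<θ θ≤1 (_ , refl)

      -- The excess is in the forgotten column. Raising the chart coordinate lowers that entry, so
      -- the two labels and the two points exchange their roles.
      falls : # (r , zero) S ℕ.< # (r , zero) T → # (r , suc s) T ℕ.≤ # (r , suc s) S → Rigidity
      falls Z< X≤ = proj₁ R , proj₁ (proj₂ R) , λ g x x′ d μ 0≤d 0≤μ x≡ (θ≤u , _ , u≤) (θ≤v , v≤ , _) →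
        proj₂ (proj₂ R) (val (update r s g x)) (val (update r s g x′)) d μ 0≤d 0≤μ θ≤u θ≤v
          (val-zero r s g x x′ d x≡)
          (trans (val-special r s g x) (trans x≡ (cong (_+ d) (sym (val-special r s g x′)))))
          (λ f f≢Z f≢X → val-ordinary r s g x x′ f f≢X f≢Z) v≤ u≤
        where
        excess : ∃ λ c → suc (# (r , zero) S) ℕ.+ c ≡ # (r , zero) T
        excess = ℕ.m≤n⇒∃[o]m+o≡n Z<
        deficit : ∃ λ e → # (r , suc s) T ℕ.+ e ≡ # (r , suc s) S
        deficit = ℕ.m≤n⇒∃[o]m+o≡n X≤
        R = rigid (r , zero) (r , suc s) (λ ()) S T (suc (proj₁ excess)) (proj₁ deficit)
              (sym (trans (ℕ.+-suc _ (proj₁ excess)) (proj₂ excess))) (sym (proj₂ deficit)) θ 0<θ θ≤1 (_ , refl)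

  -- Used with `x`, `y`, `z` the weights of `s`, `t`, `t′`, of which only upper bounds for `y` and
  -- `z` are known. From `y * z ≡ x * x` one gets `x (x - y) = y (z - x)`, which is at most `y * ν`;
  -- dividing by `x ≥ c` bounds `y` from below.
  geometric-mean : ∀ {x y z B c μ ν} → 0ℚ < c → c ≤ x → 0ℚ ≤ y → y ≤ B → 0ℚ ≤ ν → y * z ≡ x * x →
                   z ≤ x + ν → B * ν ≤ c * μ → 0ℚ ≤ μ → x ≤ y + μ
  geometric-mean {x} {y} {z} {B} {c} {μ} {ν} 0<c c≤x 0≤y y≤B 0≤ν yz≡xx z≤x+ν Bν≤cμ 0≤μ with ℚ.≤-total x y
  ... | inj₁ x≤y = ≤-trans x≤y (p≤p+q y 0≤μ)
  ... | inj₂ y≤x = linear₁ x-y≤μ (solve 3 (λ x y μ → x :+ (μ :- (x :- y)) := y :+ μ) refl x y μ)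
    where
    open ℚSolver.+-*-Solver
    open ℚ.≤-Reasoning
    scaled : c * (x - y) ≤ c * μ
    scaled = begin
      c * (x - y)   ≤⟨ *-mono-≤ (<⇒≤ 0<c) (0≤diff y≤x) c≤x ≤-refl ⟩
      x * (x - y)   ≡⟨ solve 2 (λ x y → x :* (x :- y) := x :* x :- y :* x) refl x y ⟩
      x * x - y * x ≡⟨ cong (_- y * x) (sym yz≡xx) ⟩
      y * z - y * x ≤⟨ ℚ.+-monoˡ-≤ (- (y * x)) (*-mono-≤ 0≤y (≤-trans (≤-trans (<⇒≤ 0<c) c≤x) (p≤p+q x 0≤ν)) ≤-refl z≤x+ν) ⟩
      y * (x + ν) - y * x ≡⟨ solve 3 (λ x y ν → y :* (x :+ ν) :- y :* x := y :* ν) refl x y ν ⟩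
      y * ν         ≤⟨ *-mono-≤ 0≤y 0≤ν y≤B ≤-refl ⟩
      B * ν         ≤⟨ Bν≤cμ ⟩
      c * μ         ∎
    x-y≤μ : x - y ≤ μ
    x-y≤μ = ℚ.*-cancelˡ-≤-pos c {{ℚ.positive 0<c}} scaled

  below-both : ∀ {p q} → 0ℚ < p → 0ℚ < q → ∃ λ m → 0ℚ < m × m ≤ p × m ≤ q
  below-both {p} {q} 0<p 0<q with ℚ.≤-total p q
  ... | inj₁ p≤q = p , 0<p , ≤-refl , p≤q
  ... | inj₂ q≤p = q , 0<q , q≤p , ≤-refl

  small-multiple : ∀ {K p q} → 0ℚ ≤ K → 0ℚ < p → 0ℚ < q → ∃ λ δ → 0ℚ < δ × K * δ ≤ p × δ ≤ q
  small-multiple {K} {p} {q} 0≤K 0<p 0<q = δ , 0<δ , ≤-trans Kδ≤ (≤-reflexive (proj₂ (proj₂ quotient))) , δ≤q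
    where
    quotient : ∃ λ δ₀ → 0ℚ < δ₀ × (1ℚ + K) * δ₀ ≡ p
    -- The summand 1 keeps the divisor positive when `K` is 0.
    quotient = divide (1ℚ + K) p (ℚ.+-mono-<-≤ 0<1 0≤K) 0<p
    δ₀ : ℚ
    δ₀ = proj₁ quotient
    minimum : ∃ λ δ → 0ℚ < δ × δ ≤ δ₀ × δ ≤ q
    minimum = below-both (proj₁ (proj₂ quotient)) 0<q
    δ : ℚ
    δ = proj₁ minimum
    0<δ : 0ℚ < δ
    0<δ = proj₁ (proj₂ minimum)
    δ≤δ₀ : δ ≤ δ₀
    δ≤δ₀ = proj₁ (proj₂ (proj₂ minimum))
    δ≤q : δ ≤ q
    δ≤q = proj₂ (proj₂ (proj₂ minimum))
    Kδ≤ : K * δ ≤ (1ℚ + K) * δ₀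
    Kδ≤ = *-mono-≤ 0≤K (<⇒≤ (proj₁ (proj₂ quotient))) (p≤q+p K 0≤1) δ≤δ₀

  totalVolume-concatMap : ∀ {a b} {A : Set} {V} (F : A → List (Box a b)) → (∀ f → totalVolume (F f) ≤ V) →
                          ∀ fs → totalVolume (List.concatMap F fs) ≤ ι (length fs) * V
  totalVolume-concatMap {V = V} F F≤V []       = ≤-reflexive (sym (ℚ.*-zeroˡ V))
  totalVolume-concatMap {V = V} F F≤V (f ∷ fs) = ≤-trans (≤-reflexive (totalVolume-++ (F f) _))
    (≤-trans (+-mono-≤ (F≤V f) (totalVolume-concatMap F F≤V fs))
      (≤-reflexive (solve 2 (λ V n → V :+ n :* V := (con 1ℚ :+ n) :* V) refl V (ι (length fs)))))
    where open ℚSolver.+-*-Solver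

  -- The entries to be rounded are themselves known only up to `h`, hence the interval from `- h` to
  -- `1ℚ + h`. The bound `ι 8` does not depend on `h`, so refining the net does not enlarge the
  -- cover.
  Net : ℚ → Set
  Net δ = ∃ λ h → 0ℚ < h × h ≤ δ × Σ (List ℚ) λ net →
    ι (length net) * ((h + h) + (h + h)) ≤ ι 8 × (∀ q → - h ≤ q → q ≤ 1ℚ + h → AnyL (q ≈[ h ]_) net)

  net : ∀ δ → 0ℚ < δ → Net δ
  net δ 0<δ = h , 0<h , h≤δ , multiples h (suc N) , count ,
    λ q lower upper → multiples-dense (suc N) q (<⇒≤ 0<h) lower (subst (λ y → q ≤ y + h) (sym Nh≡1) upper)
    where
    open ℚSolver.+-*-Solver
    arch : ∃ λ N → 1ℚ ≤ ι (suc N) * δ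
    arch = archimedean δ 0<δ
    N : ℕ
    N = proj₁ arch
    step : ∃ λ h → 0ℚ < h × ι (suc N) * h ≡ 1ℚ
    step = divide (ι (suc N)) 1ℚ (0<ι N) 0<1
    h : ℚ
    h = proj₁ step
    0<h : 0ℚ < h
    0<h = proj₁ (proj₂ step)
    Nh≡1 : ι (suc N) * h ≡ 1ℚ
    Nh≡1 = proj₂ (proj₂ step)
    h≤δ : h ≤ δ
    h≤δ = ℚ.*-cancelˡ-≤-pos (ι (suc N)) {{ℚ.positive (0<ι N)}} (≤-trans (≤-reflexive Nh≡1) (proj₂ arch))
    h≤1 : h ≤ 1ℚ
    h≤1 = subst₂ _≤_ (ℚ.*-identityˡ h) Nh≡1 (*-mono-≤ 0≤1 (<⇒≤ 0<h) (p≤p+q 1ℚ (0≤ι N)) ≤-refl)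
    count : ι (length (multiples h (suc N))) * ((h + h) + (h + h)) ≤ ι 8
    count = begin
      ι (length (multiples h (suc N))) * ((h + h) + (h + h)) ≡⟨ cong (λ n → ι n * ((h + h) + (h + h))) (length-multiples h (suc N)) ⟩
      (1ℚ + ι (suc N)) * ((h + h) + (h + h))
        ≡⟨ solve 2 (λ n h → (con 1ℚ :+ n) :* ((h :+ h) :+ (h :+ h)) :=
                            (h :+ h) :+ (h :+ h) :+ ((n :* h :+ n :* h) :+ (n :* h :+ n :* h))) refl (ι (suc N)) h ⟩
      (h + h) + (h + h) + ((ι (suc N) * h + ι (suc N) * h) + (ι (suc N) * h + ι (suc N) * h))
        ≡⟨ cong (λ y → (h + h) + (h + h) + ((y + y) + (y + y))) Nh≡1 ⟩
      (h + h) + (h + h) + ((1ℚ + 1ℚ) + (1ℚ + 1ℚ))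
        ≤⟨ ℚ.+-monoˡ-≤ ((1ℚ + 1ℚ) + (1ℚ + 1ℚ)) (+-mono-≤ (+-mono-≤ h≤1 h≤1) (+-mono-≤ h≤1 h≤1)) ⟩
      ι 8 ∎
      where open ℚ.≤-Reasoning

  length-labels : ∀ {k n} (s : Sequence k n) → length (labels s) ≡ suc n
  length-labels s = cong suc (trans (List.length-map _ (transitions s)) (length-transitions s))

  -- A chart coordinate along which the given entry moves at unit speed: its own one, or for the
  -- forgotten column the first of the row.
  coordinate : ∀ {a b} → Fin a × Fin (suc (suc b)) → Fin a × Fin (suc b)
  coordinate (i , zero)  = i , zero
  coordinate (i , suc j) = i , j

  triple : ℚ → ℚ
  triple θ = θ + (θ + θ)

  -- Rigidity has no uniform constant near the faces of the simplices, so these are covered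
  -- separately. An entry below `2θ` stays below `3θ` after rounding; the lower bound makes the slab
  -- thin.
  Slab : ∀ {a b} → ℚ → Fin a × Fin (suc b) → Point a b → Set
  Slab θ f z = val z f ≤ triple θ × - triple θ ≤ val z f

  slab? : ∀ {a b} θ f (z : Point a b) → Dec (Slab θ f z)
  slab? θ f z = (val z f ℚ.≤? triple θ) ×-dec (- triple θ ℚ.≤? val z f)

  slab-thin : ∀ {a b θ ℓ} (f : Fin a × Fin (suc (suc b))) → triple θ + triple θ ≤ ℓ → ∀ (g : Point a (suc b)) x x′ →
    Slab θ f (update (proj₁ (coordinate f)) (proj₂ (coordinate f)) g x) →
    Slab θ f (update (proj₁ (coordinate f)) (proj₂ (coordinate f)) g x′) → x ≤ x′ + ℓ
  slab-thin {θ = θ} {ℓ} (i , zero) 6θ≤ℓ g x x′ (upper , lower) (upper′ , lower′) = linear₃ lower upper′ 6θ≤ℓ (trans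
    (cong (λ y → x + ((val z (i , zero) - - triple θ) + ((triple θ - y) + (ℓ - (triple θ + triple θ)))))
      (val-zero i zero g x x′ (x - x′) (solve 2 (λ x y → x := y :+ (x :- y)) refl x x′)))
    (solve 5 (λ x y v t ℓ → x :+ ((v :- :- t) :+ ((t :- (v :+ (x :- y))) :+ (ℓ :- (t :+ t)))) := y :+ ℓ) refl
      x x′ (val z (i , zero)) (triple θ) ℓ))
    where
    open ℚSolver.+-*-Solver
    z = update i zero g x
  slab-thin {θ = θ} {ℓ} (i , suc j) 6θ≤ℓ g x x′ (upper , lower) (upper′ , lower′) = linear₃
    (subst (_≤ triple θ) (val-special i j g x) upper) (subst (- triple θ ≤_) (val-special i j g x′) lower′) 6θ≤ℓ
    (solve 4 (λ x y t ℓ → x :+ ((t :- x) :+ ((y :- :- t) :+ (ℓ :- (t :+ t)))) := y :+ ℓ) refl x x′ (triple θ) ℓ)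
    where open ℚSolver.+-*-Solver

  -- The cover of the chains that have `s` as a Viterbi path.

  module Tie {κ n : ℕ} (s t t′ : Sequence (suc (suc κ)) n) (balanced : labels t ++ labels t′ ↭ labels s ++ labels s)
           (r : Fin (suc (suc (suc κ)))) (c : Fin (suc κ)) where

    k a b : ℕ
    k = suc (suc κ)
    a = suc k
    b = suc κ

    S T T′ : List (Fin a × Fin k)
    S  = labels s
    T  = labels t
    T′ = labels t′

    Viterbi : (Fin a → Fin b → ℝ) → Set
    Viterbi x = ∃ λ M → IsViterbiPath M s × (∀ i j → chart M i j ≈ℝ x i j)

    unit : ℚ
    unit = ι 8 ^ b * (ι 8 ^ b) ^ a

    pairs : List (Fin a × Fin k)
    pairs = List.cartesianProduct (List.allFin a) (List.allFin k)

    weights-balanced : ∀ v → weight v T * weight v T′ ≡ weight v S * weight v S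
    weights-balanced v = trans (sym (weight-++ v T T′)) (trans (weight-↭ v balanced) (weight-++ v S S))

    -- The parameters, each chosen small in terms of the earlier ones: `ℓ` is the thickness of the
    -- pieces, `θ` the floor for the entries, `μ` the tolerance of a two-sided tie and `ν` that of
    -- the tests, `h` the mesh of the grid and `η` the accuracy of the stage of the chain.
    module Cover (ℓ θ μ ν h η : ℚ) (points : List ℚ) (0<θ : 0ℚ < θ) (θ≤1 : θ ≤ 1ℚ) (0≤ℓ : 0ℚ ≤ ℓ) (0≤μ : 0ℚ ≤ μ)
      (0≤ν : 0ℚ ≤ ν) (ν≤μ : ν ≤ μ) (0≤h : 0ℚ ≤ h) (h≤θ : h ≤ θ) (0<η : 0ℚ < η)
      (6θ≤ℓ : triple θ + triple θ ≤ ℓ)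
      (thin : ∀ g x x′ d → 0ℚ ≤ d → x ≡ x′ + d → Line.Agree r c S T θ 0<θ θ≤1 μ (update r c g x) →
        Line.Agree r c S T θ 0<θ θ≤1 μ (update r c g x′) → d ≤ ℓ)
      (2ν≤θμ : 2ℚ ^ suc n * ν ≤ θ ^ suc n * μ)
      (δ≤ν : lipschitz (suc n) * (ι k * h) + (lipschitz (suc n) * (ι k * h) + η) ≤ ν)
      (δ≤θ : ι k * h ≤ θ) (h+δ≤1 : h + ι k * h ≤ 1ℚ) (η-h : ι (suc k) * η ≡ h)
      (few : ι (length points) * ((h + h) + (h + h)) ≤ ι 8)
      (dense : ∀ q → - h ≤ q → q ≤ 1ℚ + h → AnyL (q ≈[ h ]_) points) where

      -- A condition on rational data alone, which the search along a grid line can decide. The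
      -- bounds on `T′` and on the size of `T` are there for `geometric-mean`, which supplies the
      -- other half of the tie.
      Tied : Point a b → Set
      Tied z = (∀ i j → θ ≤ val z (i , j)) × weight (val z) T ≤ weight (val z) S + ν ×
               weight (val z) T′ ≤ weight (val z) S + ν × weight (val z) T ≤ 2ℚ ^ suc n

      tied? : ∀ z → Dec (Tied z)
      tied? z = Fin.all? (λ i → Fin.all? λ j → θ ℚ.≤? val z (i , j)) ×-dec
        ((weight (val z) T ℚ.≤? weight (val z) S + ν) ×-dec
        ((weight (val z) T′ ℚ.≤? weight (val z) S + ν) ×-dec (weight (val z) T ℚ.≤? 2ℚ ^ suc n)))

      tied⇒agree : ∀ z → Tied z → Line.Agree r c S T θ 0<θ θ≤1 μ z
      tied⇒agree z (θ≤z , T≤S , T′≤S , T≤2) = (λ (i , j) → θ≤z i j) , ≤-trans T≤S (ℚ.+-monoʳ-≤ (weight (val z) S) ν≤μ) ,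
        geometric-mean (^-pos (suc n) 0<θ)
          (subst (λ m → θ ^ m ≤ weight (val z) S) (length-labels s) (^-≤-weight (<⇒≤ 0<θ) (λ (i , j) → θ≤z i j) S))
          (weight-nonNeg (λ (i , j) → ≤-trans (<⇒≤ 0<θ) (θ≤z i j)) T) T≤2 0≤ν (weights-balanced (val z)) T′≤S 2ν≤θμ 0≤μ

      tied-thin : ∀ (g : Point a b) x x′ → Tied (update r c g x) → Tied (update r c g x′) → x ≤ x′ + ℓ
      tied-thin g x x′ tx tx′ = compare (ℚ.≤-total x x′)
        where
        open ℚSolver.+-*-Solver
        compare : x ≤ x′ ⊎ x′ ≤ x → x ≤ x′ + ℓ
        compare (inj₁ x≤x′) = ≤-trans x≤x′ (p≤p+q x′ 0≤ℓ)
        compare (inj₂ x′≤x) = linear₁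
          (thin g x x′ (x - x′) (0≤diff x′≤x) (solve 2 (λ x y → x := y :+ (x :- y)) refl x x′)
            (tied⇒agree _ tx) (tied⇒agree _ tx′))
          (solve 3 (λ x y ℓ → x :+ (ℓ :- (x :- y)) := y :+ ℓ) refl x x′ ℓ)

      module SlabCover (f : Fin a × Fin k) =
        ThinCover (proj₁ (coordinate f)) (proj₂ (coordinate f)) h ℓ 0≤h 0≤ℓ points (Slab θ f) (slab? θ f)

      module TiedCover = ThinCover r c h ℓ 0≤h 0≤ℓ points Tied tied?

      cover : List (Box a b)
      cover = List.concatMap SlabCover.boxes pairs ++ TiedCover.boxes

      1≤8 : 1ℚ ≤ ι 8
      1≤8 = p≤p+q 1ℚ (0≤ι 7)

      cover-volume : h ≤ ℓ → totalVolume cover ≤ (1ℚ + ι (length pairs)) * (ι 6 * ℓ * unit)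
      cover-volume h≤ℓ = ≤-trans (≤-reflexive (totalVolume-++ (List.concatMap SlabCover.boxes pairs) TiedCover.boxes))
        (≤-trans (+-mono-≤ (totalVolume-concatMap SlabCover.boxes (λ f → each (SlabCover.boxes-volume f 1≤8 few)) pairs)
                           (each (TiedCover.boxes-volume 1≤8 few)))
          (≤-reflexive (solve 2 (λ V n → n :* V :+ V := (con 1ℚ :+ n) :* V) refl (ι 6 * ℓ * unit) (ι (length pairs)))))
        where
        open ℚSolver.+-*-Solver
        0≤unit : 0ℚ ≤ unit
        0≤unit = *-nonNeg (^-nonNeg b (0≤ι 8)) (^-nonNeg a (^-nonNeg b (0≤ι 8)))
        side : ℓ + (h + h) + (ℓ + (h + h)) ≤ ι 6 * ℓ
        side = ≤-trans (+-mono-≤ (ℚ.+-monoʳ-≤ ℓ (+-mono-≤ h≤ℓ h≤ℓ)) (ℚ.+-monoʳ-≤ ℓ (+-mono-≤ h≤ℓ h≤ℓ)))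
          (≤-reflexive (solve 1 (λ ℓ → ℓ :+ (ℓ :+ ℓ) :+ (ℓ :+ (ℓ :+ ℓ)) := con (ι 6) :* ℓ) refl ℓ))
        0≤side : 0ℚ ≤ ℓ + (h + h) + (ℓ + (h + h))
        0≤side = +-nonNeg (+-nonNeg 0≤ℓ (+-nonNeg 0≤h 0≤h)) (+-nonNeg 0≤ℓ (+-nonNeg 0≤h 0≤h))
        each : ∀ {V} → V ≤ (ℓ + (h + h) + (ℓ + (h + h))) * ι 8 ^ b * (ι 8 ^ b) ^ a → V ≤ ι 6 * ℓ * unit
        each V≤ = ≤-trans V≤ (≤-trans
          (≤-reflexive (ℚ.*-assoc (ℓ + (h + h) + (ℓ + (h + h))) (ι 8 ^ b) ((ι 8 ^ b) ^ a)))
          (*-mono-≤ 0≤side 0≤unit side ≤-refl))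

      Inside : Point a b → Box a b → Set
      Inside q B = ∀ i j → lo B i j + h ≤ q i j × q i j + h ≤ hi B i j

      module _ (q : Fin a × Fin k → ℚ) (chain : ApproximateChain q η)
               (T≤S : weight q T ≤ weight q S + η) (T′≤S : weight q T′ ≤ weight q S + η) where

        0≤η : 0ℚ ≤ η
        0≤η = <⇒≤ 0<η

        0≤δ : 0ℚ ≤ ι k * h
        0≤δ = *-nonNeg (0≤ι k) 0≤h

        free-part : Point a b
        free-part i j = q (i , suc j)

        near-points : ∀ i j → AnyL (free-part i j ≈[ h ]_) points
        near-points i j = dense _ (chain-lower 0≤η η-h chain (i , suc j)) (chain-upper 0≤η η-h chain (i , suc j))

        close : ∀ (z : Point a b) → (∀ i j → free-part i j ≈[ h ] z i j) → ∀ f → q f ≈[ ι k * h ] val z f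
        close z near f = chain-near 0≤η η-h chain {z} near 0≤h f

        slab-cover : ∀ f → q f ≤ θ + θ → AnyL (Inside free-part) (SlabCover.boxes f)
        slab-cover f small = SlabCover.boxes-cover f free-part near-points
          (λ z near →
            linear₃ (proj₂ (close z near f)) small δ≤θ
              (solve 4 (λ v q δ θ → v :+ ((q :+ δ :- v) :+ ((θ :+ θ :- q) :+ (θ :- δ))) := θ :+ (θ :+ θ)) refl
                (val z f) (q f) (ι k * h) θ) ,
            from-diff (+-nonNeg (0≤diff (proj₁ (close z near f))) (+-nonNeg (0≤diff (chain-lower 0≤η η-h chain f))
                (+-nonNeg (0≤diff h≤θ) (+-nonNeg (0≤diff δ≤θ) (<⇒≤ 0<θ)))))
              (solve 5 (λ v q δ θ h → :- (θ :+ (θ :+ θ)) :+ ((v :+ δ :- q) :+ ((q :- :- h) :+ ((θ :- h) :+ ((θ :- δ) :+ θ)))) := v) refl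
                (val z f) (q f) (ι k * h) θ h))
          (slab-thin {θ = θ} f 6θ≤ℓ)
          where open ℚSolver.+-*-Solver

        module _ (large : ∀ f → θ + θ ≤ q f) where

          0≤q : ∀ f → 0ℚ ≤ q f
          0≤q f = ≤-trans (+-nonNeg (<⇒≤ 0<θ) (<⇒≤ 0<θ)) (large f)

          q≤2 : ∀ f → q f ≤ 2ℚ
          q≤2 f = linear₃ (chain-upper 0≤η η-h chain f) h+δ≤1 0≤δ
            (solve 3 (λ q h δ → q :+ ((con 1ℚ :+ h :- q) :+ ((con 1ℚ :- (h :+ δ)) :+ (δ :- con 0ℚ))) := con 1ℚ :+ con 1ℚ) refl
              (q f) h (ι k * h))
            where open ℚSolver.+-*-Solver

          module _ (z : Point a b) (near : ∀ i j → free-part i j ≈[ h ] z i j) where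

            θ≤z : ∀ f → θ ≤ val z f
            θ≤z f = linear₃ (proj₁ (close z near f)) (large f) δ≤θ
              (solve 4 (λ v q δ θ → θ :+ ((v :+ δ :- q) :+ ((q :- (θ :+ θ)) :+ (θ :- δ))) := v) refl (val z f) (q f) (ι k * h) θ)
              where open ℚSolver.+-*-Solver

            0≤z : ∀ f → 0ℚ ≤ val z f
            0≤z f = ≤-trans (<⇒≤ 0<θ) (θ≤z f)

            z≤2 : ∀ f → val z f ≤ 2ℚ
            z≤2 f = linear₃ (proj₂ (close z near f)) (chain-upper 0≤η η-h chain f) h+δ≤1
              (solve 4 (λ v q δ h → v :+ ((q :+ δ :- v) :+ ((con 1ℚ :+ h :- q) :+ (con 1ℚ :- (h :+ δ)))) := con 1ℚ :+ con 1ℚ) refl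
                (val z f) (q f) (ι k * h) h)
              where open ℚSolver.+-*-Solver

            weight-z≤q : ∀ (u : Sequence k n) → weight (val z) (labels u) ≤ weight q (labels u) + lipschitz (suc n) * (ι k * h)
            weight-z≤q u = subst (λ m → weight (val z) (labels u) ≤ weight q (labels u) + lipschitz m * (ι k * h)) (length-labels u)
              (weight-close 0≤δ 0≤z 0≤q z≤2 q≤2 (λ f → proj₂ (close z near f)) (labels u))

            weight-q≤z : ∀ (u : Sequence k n) → weight q (labels u) ≤ weight (val z) (labels u) + lipschitz (suc n) * (ι k * h)
            weight-q≤z u = subst (λ m → weight q (labels u) ≤ weight (val z) (labels u) + lipschitz m * (ι k * h)) (length-labels u)
              (weight-close 0≤δ 0≤q 0≤z q≤2 z≤2 (λ f → proj₁ (close z near f)) (labels u))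

            -- The tolerance `ν` has to hold three errors: rounding the weight of `u`, the accuracy
            -- `η` of the Viterbi property at this stage, and rounding the weight of `s`.
            transfer : ∀ (u : Sequence k n) → weight q (labels u) ≤ weight q S + η →
                       weight (val z) (labels u) ≤ weight (val z) S + ν
            transfer u u≤S = from-diff
              (+-nonNeg (0≤diff (weight-z≤q u)) (+-nonNeg (0≤diff u≤S) (+-nonNeg (0≤diff (weight-q≤z s)) (0≤diff δ≤ν))))
              (solve 7 (λ uz uq sq sz Λ η ν →
                  uz :+ ((uq :+ Λ :- uz) :+ ((sq :+ η :- uq) :+ ((sz :+ Λ :- sq) :+ (ν :- (Λ :+ (Λ :+ η)))))) := sz :+ ν) refl
                (weight (val z) (labels u)) (weight q (labels u)) (weight q S) (weight (val z) S)
                (lipschitz (suc n) * (ι k * h)) η ν)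
              where open ℚSolver.+-*-Solver

            tied : Tied z
            tied = (λ i j → θ≤z (i , j)) , transfer t T≤S , transfer t′ T′≤S ,
              subst (λ m → weight (val z) T ≤ 2ℚ ^ m) (length-labels t) (weight-≤-^ 0≤z 0≤2 z≤2 T)

          tied-cover : AnyL (Inside free-part) TiedCover.boxes
          tied-cover = TiedCover.boxes-cover free-part near-points tied tied-thin

        -- The split into chains near a face and the others is made on the rational stage `q`, where
        -- it is decidable, and not on the real entries.
        inside-cover : AnyL (Inside free-part) cover
        inside-cover = decide (Fin.any? λ i → Fin.any? λ j → q (i , j) ℚ.≤? θ + θ)
          where
          decide : Dec (∃ λ i → ∃ λ j → q (i , j) ≤ θ + θ) → AnyL (Inside free-part) cover
          decide (yes (i , j , small)) = AnyL.++⁺ˡ (AnyL.concatMap⁺ SlabCover.boxes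
            (lose (∈.∈-cartesianProduct⁺ (∈.∈-allFin i) (∈.∈-allFin j)) (slab-cover (i , j) small)))
          decide (no none) = AnyL.++⁺ʳ (List.concatMap SlabCover.boxes pairs)
            (tied-cover λ (i , j) → <⇒≤ (ℚ.≰⇒> λ small → none (i , j , small)))

      2η≤h : η + η ≤ h
      2η≤h = subst (η + η ≤_)
        (trans (solve 2 (λ n η → η :+ η :+ (con 1ℚ :+ n) :* η := (con 1ℚ :+ (con 1ℚ :+ (con 1ℚ :+ n))) :* η) refl (ι κ) η) η-h)
        (p≤p+q (η + η) (*-nonNeg (0≤ι (suc κ)) (<⇒≤ 0<η)))
        where open ℚSolver.+-*-Solver

      -- The box is found for one rational stage. Later stages of `x` deviate from it by at most
      -- `η + η`, which the margin `h` of the box absorbs.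
      cover-covers : ∀ x → Viterbi x → AnyL (x ∈Box_) cover
      cover-covers x (M , viterbi , chart≈) = AnyL.map (λ {B} → member {B})
          (inside-cover q (proj₁ at-m) (proj₁ (proj₂ at-m)) (proj₁ (proj₂ (proj₂ at-m))))
        where
        open ℚSolver.+-*-Solver
        eventually : Eventually λ m → ApproximateChain (values M m) η ×
          (weight (values M m) T ≤ weight (values M m) S + η × (weight (values M m) T′ ≤ weight (values M m) S + η ×
          (∀ i j m′ → m ℕ.≤ m′ → seq (x i j) m′ ≈[ η + η ] values M m (i , suc j))))
        eventually = eventually-× (eventually-chain M η 0<η) (eventually-× (eventually-Pr-≤ M s t (viterbi t) η 0<η)
          (eventually-× (eventually-Pr-≤ M s t′ (viterbi t′) η 0<η) (eventually-chart M x chart≈ η 0<η)))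
        m : ℕ
        m = proj₁ eventually
        q : Fin a × Fin k → ℚ
        q = values M m
        at-m = proj₂ eventually m ℕ.≤-refl
        member : ∀ {B} → Inside (λ i j → q (i , suc j)) B → x ∈Box B
        member {B} inside i j =
          (λ ε 0<ε → m , λ m′ m≤m′ → from-diff
            (+-nonNeg (0≤diff (proj₁ (inside i j))) (+-nonNeg (0≤diff (proj₂ (proj₂ (proj₂ (proj₂ at-m)) i j m′ m≤m′)))
              (+-nonNeg (0≤diff 2η≤h) (<⇒≤ 0<ε))))
            (solve 6 (λ l h q x η ε → l :+ ((q :- (l :+ h)) :+ ((x :+ (η :+ η) :- q) :+ ((h :- (η :+ η)) :+ ε))) := x :+ ε) refl
              (lo B i j) h (q (i , suc j)) (seq (x i j) m′) η ε)) ,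
          (λ ε 0<ε → m , λ m′ m≤m′ → from-diff
            (+-nonNeg (0≤diff (proj₂ (inside i j))) (+-nonNeg (0≤diff (proj₁ (proj₂ (proj₂ (proj₂ at-m)) i j m′ m≤m′)))
              (+-nonNeg (0≤diff 2η≤h) (<⇒≤ 0<ε))))
            (solve 6 (λ u h q x η ε → x :+ ((u :- (q :+ h)) :+ ((q :+ (η :+ η) :- x) :+ ((h :- (η :+ η)) :+ ε))) := u :+ ε) refl
              (hi B i j) h (q (i , suc j)) (seq (x i j) m′) η ε))

    -- The order of the choices is forced: the volume fixes `ℓ`, the slabs fix `θ`, and only then is
    -- the rigidity constant known that determines `μ`; the loss in `geometric-mean` determines `ν`,
    -- and the mesh comes last.
    viterbi-null : (∀ θ (0<θ : 0ℚ < θ) (θ≤1 : θ ≤ 1ℚ) → Line.Rigidity r c S T θ 0<θ θ≤1) → IsNull Viterbi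
    viterbi-null rigidity = finitelyCovered⇒null covered
      where
      covered : ∀ ε → 0ℚ < ε → FinitelyCovered Viterbi ε
      covered ε 0<ε = Choice.cover , ≤-trans (Choice.cover-volume h≤ℓ) volume≤ε , Choice.cover-covers
        where
        open ℚSolver.+-*-Solver

        -- The bound of `cover-volume` per unit of `ℓ`.
        K : ℚ
        K = (1ℚ + ι (length pairs)) * (ι 6 * unit)
        0≤K : 0ℚ ≤ K
        0≤K = *-nonNeg (0≤ι (suc (length pairs)))
          (*-nonNeg (0≤ι 6) (*-nonNeg (^-nonNeg b (0≤ι 8)) (^-nonNeg a (^-nonNeg b (0≤ι 8)))))
        choose-ℓ : ∃ λ ℓ → 0ℚ < ℓ × K * ℓ ≤ ε × ℓ ≤ 1ℚ
        choose-ℓ = small-multiple 0≤K 0<ε 0<1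
        ℓ : ℚ
        ℓ = proj₁ choose-ℓ
        0<ℓ : 0ℚ < ℓ
        0<ℓ = proj₁ (proj₂ choose-ℓ)
        volume≤ε : (1ℚ + ι (length pairs)) * (ι 6 * ℓ * unit) ≤ ε
        volume≤ε = ≤-trans (≤-reflexive
          (solve 4 (λ n m ℓ u → n :* (m :* ℓ :* u) := n :* (m :* u) :* ℓ) refl (1ℚ + ι (length pairs)) (ι 6) ℓ unit))
          (proj₁ (proj₂ (proj₂ choose-ℓ)))

        choose-θ : ∃ λ θ → 0ℚ < θ × ι 6 * θ ≤ ℓ × θ ≤ ℓ
        choose-θ = small-multiple (0≤ι 6) 0<ℓ 0<ℓ
        θ : ℚ
        θ = proj₁ choose-θ
        0<θ : 0ℚ < θ
        0<θ = proj₁ (proj₂ choose-θ)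
        θ≤ℓ : θ ≤ ℓ
        θ≤ℓ = proj₂ (proj₂ (proj₂ choose-θ))
        θ≤1 : θ ≤ 1ℚ
        θ≤1 = ≤-trans θ≤ℓ (proj₂ (proj₂ (proj₂ choose-ℓ)))
        6θ≤ℓ : triple θ + triple θ ≤ ℓ
        6θ≤ℓ = ≤-trans (≤-reflexive (solve 1 (λ θ → θ :+ (θ :+ θ) :+ (θ :+ (θ :+ θ)) := con (ι 6) :* θ) refl θ))
          (proj₁ (proj₂ (proj₂ choose-θ)))

        R : Line.Rigidity r c S T θ 0<θ θ≤1
        R = rigidity θ 0<θ θ≤1
        0<Rℓ : 0ℚ < proj₁ R * ℓ
        0<Rℓ = *-pos (proj₁ (proj₂ R)) 0<ℓ
        choose-μ : ∃ λ μ → 0ℚ < μ × 2ℚ * μ ≤ proj₁ R * ℓ × μ ≤ 1ℚ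
        choose-μ = small-multiple 0≤2 0<Rℓ 0<1
        μ : ℚ
        μ = proj₁ choose-μ
        0<μ : 0ℚ < μ
        0<μ = proj₁ (proj₂ choose-μ)
        2μ≤Rℓ : μ + μ ≤ proj₁ R * ℓ
        2μ≤Rℓ = ≤-trans (≤-reflexive (solve 1 (λ μ → μ :+ μ := (con 1ℚ :+ con 1ℚ) :* μ) refl μ))
          (proj₁ (proj₂ (proj₂ choose-μ)))

        choose-ν : ∃ λ ν → 0ℚ < ν × 2ℚ ^ suc n * ν ≤ θ ^ suc n * μ × ν ≤ μ
        choose-ν = small-multiple (^-nonNeg (suc n) 0≤2) (*-pos (^-pos (suc n) 0<θ) 0<μ) 0<μ
        ν : ℚ
        ν = proj₁ choose-ν
        0<ν : 0ℚ < ν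
        0<ν = proj₁ (proj₂ choose-ν)

        Λ : ℚ
        Λ = lipschitz (suc n)
        bound : ∃ λ δ → 0ℚ < δ × δ ≤ ν × δ ≤ θ
        bound = below-both 0<ν 0<θ
        0<bound : 0ℚ < proj₁ bound
        0<bound = proj₁ (proj₂ bound)
        -- One constant that dominates all the multiples of h in the conditions on it.
        J : ℚ
        J = (Λ + Λ) * ι k + 1ℚ + ι k
        0≤J : 0ℚ ≤ J
        0≤J = +-nonNeg (+-nonNeg (*-nonNeg (+-nonNeg (lipschitz-nonNeg (suc n)) (lipschitz-nonNeg (suc n))) (0≤ι k)) 0≤1) (0≤ι k)
        choose-h : ∃ λ δ → 0ℚ < δ × J * δ ≤ proj₁ bound × δ ≤ 1ℚ
        choose-h = small-multiple 0≤J 0<bound 0<1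
        grid-net : Net (proj₁ choose-h)
        grid-net = net (proj₁ choose-h) (proj₁ (proj₂ choose-h))
        h : ℚ
        h = proj₁ grid-net
        0<h : 0ℚ < h
        0<h = proj₁ (proj₂ grid-net)
        0≤h : 0ℚ ≤ h
        0≤h = <⇒≤ 0<h
        Jh≤bound : J * h ≤ proj₁ bound
        Jh≤bound = ≤-trans (*-mono-≤ 0≤J (<⇒≤ (proj₁ (proj₂ choose-h))) ≤-refl (proj₁ (proj₂ (proj₂ grid-net))))
          (proj₁ (proj₂ (proj₂ choose-h)))
        Jh≤ν : J * h ≤ ν
        Jh≤ν = ≤-trans Jh≤bound (proj₁ (proj₂ (proj₂ bound)))
        Jh≤θ : J * h ≤ θ
        Jh≤θ = ≤-trans Jh≤bound (proj₂ (proj₂ (proj₂ bound)))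
        0≤Λδ : 0ℚ ≤ Λ * (ι k * h)
        0≤Λδ = *-nonNeg (lipschitz-nonNeg (suc n)) (*-nonNeg (0≤ι k) 0≤h)
        0≤δ : 0ℚ ≤ ι k * h
        0≤δ = *-nonNeg (0≤ι k) 0≤h
        h+δ≤θ : h + ι k * h ≤ θ
        h+δ≤θ = ≤-trans (from-diff (+-nonNeg 0≤Λδ 0≤Λδ)
          (solve 3 (λ h k Λ → h :+ k :* h :+ (Λ :* (k :* h) :+ Λ :* (k :* h)) := ((Λ :+ Λ) :* k :+ con 1ℚ :+ k) :* h) refl h (ι k) Λ))
          Jh≤θ
        h≤θ : h ≤ θ
        h≤θ = ≤-trans (p≤p+q h 0≤δ) h+δ≤θ
        h≤ℓ : h ≤ ℓ
        h≤ℓ = ≤-trans h≤θ θ≤ℓ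
        δ≤θ : ι k * h ≤ θ
        δ≤θ = ≤-trans (p≤q+p (ι k * h) 0≤h) h+δ≤θ

        choose-η : ∃ λ η → 0ℚ < η × ι (suc k) * η ≡ h
        choose-η = divide (ι (suc k)) h (0<ι k) 0<h
        η : ℚ
        η = proj₁ choose-η
        0<η : 0ℚ < η
        0<η = proj₁ (proj₂ choose-η)
        η-h : ι (suc k) * η ≡ h
        η-h = proj₂ (proj₂ choose-η)
        η≤h : η ≤ h
        η≤h = subst (η ≤_) (trans (solve 2 (λ n η → η :+ n :* η := (con 1ℚ :+ n) :* η) refl (ι k) η) η-h)
          (p≤p+q η (*-nonNeg (0≤ι k) (<⇒≤ 0<η)))
        δ≤ν : Λ * (ι k * h) + (Λ * (ι k * h) + η) ≤ ν
        δ≤ν = ≤-trans (from-diff (+-nonNeg (0≤diff η≤h) 0≤δ)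
          (solve 4 (λ h k Λ η → Λ :* (k :* h) :+ (Λ :* (k :* h) :+ η) :+ ((h :- η) :+ k :* h) :=
                                ((Λ :+ Λ) :* k :+ con 1ℚ :+ k) :* h) refl h (ι k) Λ η))
          Jh≤ν

        thin : ∀ g x x′ d → 0ℚ ≤ d → x ≡ x′ + d → Line.Agree r c S T θ 0<θ θ≤1 μ (update r c g x) →
               Line.Agree r c S T θ 0<θ θ≤1 μ (update r c g x′) → d ≤ ℓ
        thin g x x′ d 0≤d x≡ agree agree′ = ℚ.*-cancelˡ-≤-pos (proj₁ R) {{ℚ.positive (proj₁ (proj₂ R))}}
          (≤-trans (proj₂ (proj₂ R) g x x′ d μ 0≤d (<⇒≤ 0<μ) x≡ agree agree′) 2μ≤Rℓ)

        module Choice = Cover ℓ θ μ ν h η (proj₁ (proj₂ (proj₂ (proj₂ grid-net)))) 0<θ θ≤1 (<⇒≤ 0<ℓ) (<⇒≤ 0<μ)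
          (<⇒≤ 0<ν) (proj₂ (proj₂ (proj₂ choose-ν))) 0≤h h≤θ 0<η 6θ≤ℓ thin (proj₁ (proj₂ (proj₂ choose-ν))) δ≤ν δ≤θ
          (≤-trans h+δ≤θ θ≤1) η-h (proj₁ (proj₂ (proj₂ (proj₂ (proj₂ grid-net)))))
          (proj₂ (proj₂ (proj₂ (proj₂ (proj₂ grid-net)))))

  -- From edge multiplicities to null regions.

  raise : ∀ {k} → Fin k × Fin k → Fin (suc k) × Fin k
  raise (i , j) = suc i , j

  labels-balanced : ∀ {k n} (s t t′ : Sequence k n) → head t ≡ head s → head t′ ≡ head s →
    transitions t ++ transitions t′ ↭ transitions s ++ transitions s → labels t ++ labels t′ ↭ labels s ++ labels s
  labels-balanced s t t′ head-t head-t′ balanced = ↭-trans (gather (transitions t) (transitions t′) head-t head-t′)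
    (↭-trans (prep _ (prep _ (↭.map⁺ raise balanced))) (↭-sym (gather (transitions s) (transitions s) refl refl)))
    where
    gather : ∀ es es′ {x y} → x ≡ head s → y ≡ head s → ((zero , x) ∷ map raise es) ++ ((zero , y) ∷ map raise es′) ↭
             (zero , head s) ∷ (zero , head s) ∷ map raise (es ++ es′)
    gather es es′ refl refl = prep _ (↭-trans (↭.shift _ (map raise es) (map raise es′))
      (prep _ (↭.↭-reflexive (sym (List.map-++ raise es es′)))))

  #-raise : ∀ {k} (e : Fin k × Fin k) es → # (raise e) (map raise es) ≡ # e es
  #-raise e []        = refl
  #-raise e (e′ ∷ es) = cong₂ ℕ._+_ same (#-raise e es)
    where
    same : occurs (raise e) (raise e′) ≡ occurs e e′
    same with raise e ≟ₚ raise e′ | e ≟ₚ e′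
    ... | yes _    | yes _    = refl
    ... | no _     | no _     = refl
    ... | yes refl | no e≢e′  = contradiction refl e≢e′
    ... | no neq   | yes refl = contradiction refl neq

  #-labels : ∀ {k n} (e : Fin k × Fin k) (s : Sequence k n) → # (raise e) (labels s) ≡ # e (transitions s)
  #-labels e s with raise e ≟ₚ (zero , head s)
  ... | no _ = #-raise e (transitions s)

  IsNull-mono : ∀ {a b} {A B : (Fin a → Fin b → ℝ) → Set} → (∀ x → A x → B x) → IsNull B → IsNull A
  IsNull-mono A⊆B null ε 0<ε = proj₁ cover , proj₁ (proj₂ cover) , λ x x∈A → proj₂ (proj₂ cover) x (A⊆B x x∈A)
    where cover = null ε 0<ε

  one-state : ∀ {n} (s t : Vec.Vec (Fin 1) n) → s ≡ t
  one-state Vec.[]           Vec.[]           = refl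
  one-state (zero Vec.∷ s) (zero Vec.∷ t) = cong (zero Vec.∷_) (one-state s t)

  -- Pr t · Pr t′ = (Pr s)² turns the Viterbi property of s into Pr t = Pr s, while the ratio
  -- Pr t / Pr s is strictly monotone in a coordinate of row i.
  viterbi-excess-null : ∀ {k n} (s t t′ : Sequence k n) → labels t ++ labels t′ ↭ labels s ++ labels s →
    ∀ i j → # (i , j) (transitions s) ℕ.< # (i , j) (transitions t) →
    (∀ j′ → j′ ≢ j → # (i , j′) (transitions t) ℕ.≤ # (i , j′) (transitions s)) →
    IsNull {suc k} {ℕ.pred k} λ x → ∃ λ M → IsViterbiPath M s × (∀ i j → chart M i j ≈ℝ x i j)
  -- With a single state there is only one sequence of the given length, so no edge can be in
  -- excess.
  viterbi-excess-null {suc zero} s t t′ balanced i j more less =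
    contradiction more (ℕ.<-irrefl (cong (λ u → # (i , j) (transitions u)) (one-state s t)))
  -- The column in excess is the one forgotten by the chart; the first chart coordinate of the row
  -- is moved against it.
  viterbi-excess-null {suc (suc κ)} s t t′ balanced i zero more less =
    Tie.viterbi-null s t t′ balanced (suc i) zero λ θ 0<θ θ≤1 → Line.falls (suc i) zero (labels s) (labels t) θ 0<θ θ≤1
      (subst₂ ℕ._<_ (sym (#-labels (i , zero) s)) (sym (#-labels (i , zero) t)) more)
      (subst₂ ℕ._≤_ (sym (#-labels (i , suc zero) t)) (sym (#-labels (i , suc zero) s)) (less (suc zero) λ ()))
  viterbi-excess-null {suc (suc κ)} s t t′ balanced i (suc c) more less =
    Tie.viterbi-null s t t′ balanced (suc i) c λ θ 0<θ θ≤1 → Line.rises (suc i) c (labels s) (labels t) θ 0<θ θ≤1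
      (subst₂ ℕ._<_ (sym (#-labels (i , suc c) s)) (sym (#-labels (i , suc c) t)) more)
      (subst₂ ℕ._≤_ (sym (#-labels (i , zero) t)) (sym (#-labels (i , zero) s)) (less zero λ ()))

  -- All chains of the region have `s` as a Viterbi path, so the region is contained in the null
  -- set.
  no-excess : ∀ {k n} (M : MarkovChain k) (s t t′ : Sequence k n) → PositiveMeasure (SameRegion n M) →
    IsViterbiPath M s → head t ≡ head s → head t′ ≡ head s →
    transitions t ++ transitions t′ ↭ transitions s ++ transitions s →
    ∀ i j → # (i , j) (transitions s) ℕ.< # (i , j) (transitions t) →
    ¬ (∀ j′ → j′ ≢ j → # (i , j′) (transitions t) ℕ.≤ # (i , j′) (transitions s))
  no-excess M s t t′ positive viterbi head-t head-t′ balanced i j more less = positive (IsNull-mono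
    (λ x (M′ , same , chart≈) → M′ , Equivalence.to (same s) viterbi , chart≈)
    (viterbi-excess-null s t t′ (labels-balanced s t t′ head-t head-t′ balanced) i j more less))

open NullSets using (no-excess)
open import Data.Nat.Base using (_+_; _*_; _∸_; _≤_; _<_; z≤n; s≤s; s≤s⁻¹)

#-∈ : ∀ {a b} (x : Fin a × Fin b) ys → 1 ≤ # x ys → x ∈ ys
#-∈ x (y ∷ ys) 1≤# with x ≟ₚ y
... | yes refl = here refl
... | no  _    = there (#-∈ x ys 1≤#)

#-self : ∀ {a b} (x : Fin a × Fin b) ys → # x (x ∷ ys) ≡ suc (# x ys)
#-self x ys with x ≟ₚ x
... | yes _  = refl
... | no x≢x = contradiction refl x≢x

#-≤⇒↭ : ∀ {a b} (xs ys : List (Fin a × Fin b)) → length xs ≡ length ys → (∀ x → # x xs ≤ # x ys) → xs ↭ ys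
#-≤⇒↭ []       []       _   _  = ↭-refl
#-≤⇒↭ (x ∷ xs) ys len le
  -- The head of `xs` is removed from both lists. The lengths remain equal, so in the end nothing of
  -- `ys` is left over.
  with us , vs , refl ← ∈.∈-∃++ (#-∈ x ys (ℕ.≤-trans (s≤s z≤n) (ℕ.≤-trans (ℕ.≤-reflexive (sym (#-self x xs))) (le x))))
  = ↭-trans (prep x (#-≤⇒↭ xs (us ++ vs) length≡ λ y → ℕ.+-cancelˡ-≤ (occurs y x) _ _
      (ℕ.≤-trans (le y) (ℕ.≤-reflexive (#-↭ y (↭.shift x us vs))))))
    (↭-sym (↭.shift x us vs))
  where
  length≡ : length xs ≡ length (us ++ vs)
  length≡ = ℕ.suc-injective (trans len (↭.↭-length (↭.shift x us vs)))

-- Walks as lists of edges and as functions of time.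

module _ {A : Set} where

  data Path : A → List (A × A) → A → Set where
    []   : ∀ {x} → Path x [] x
    step : ∀ {x y z es} → Path y es z → Path x ((x , y) ∷ es) z

  infixr 5 _++ᵖ_

  _++ᵖ_ : ∀ {x y z es es′} → Path x es y → Path y es′ z → Path x (es ++ es′) z
  []     ++ᵖ q = q
  step p ++ᵖ q = step (p ++ᵖ q)

  -- Beyond the end of the list the last vertex is repeated, which makes a walk a total function of
  -- time.
  vertex : A → List (A × A) → ℕ → A
  vertex x []             t       = x
  vertex x (_ ∷ _)        zero    = x
  vertex x ((_ , y) ∷ es) (suc t) = vertex y es t

  vertex-0 : ∀ x es → vertex x es 0 ≡ x
  vertex-0 x []      = refl
  vertex-0 x (_ ∷ _) = refl

  vertex-++ : ∀ {x y es} es′ j → Path x es y → vertex x (es ++ es′) (length es + j) ≡ vertex y es′ j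
  vertex-++ es′ j []       = refl
  vertex-++ es′ j (step p) = vertex-++ es′ j p

  segment : (ℕ → A) → ℕ → ℕ → List (A × A)
  segment g i zero    = []
  segment g i (suc m) = (g i , g (suc i)) ∷ segment g (suc i) m

  length-segment : ∀ g i m → length (segment g i m) ≡ m
  length-segment g i zero    = refl
  length-segment g i (suc m) = cong suc (length-segment g (suc i) m)

  segment-++ : ∀ g i m m′ → segment g i (m + m′) ≡ segment g i m ++ segment g (i + m) m′
  segment-++ g i zero    m′ = cong (λ j → segment g j m′) (sym (ℕ.+-identityʳ i))
  segment-++ g i (suc m) m′ = cong (_ ∷_) (trans (segment-++ g (suc i) m m′)
    (cong (λ j → segment g (suc i) m ++ segment g j m′) (sym (ℕ.+-suc i m))))

  segment-path : ∀ g i m → Path (g i) (segment g i m) (g (i + m))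
  segment-path g i zero    = subst (λ j → Path (g i) [] (g j)) (sym (ℕ.+-identityʳ i)) []
  segment-path g i (suc m) = step (subst (λ j → Path (g (suc i)) (segment g (suc i) m) (g j)) (sym (ℕ.+-suc i m))
    (segment-path g (suc i) m))

  segment-cong : ∀ {g g′} i i′ m → (∀ j → j ≤ m → g (i + j) ≡ g′ (i′ + j)) → segment g i m ≡ segment g′ i′ m
  segment-cong i i′ zero eq = refl
  segment-cong {g} {g′} i i′ (suc m) eq = cong₂ _∷_
    (cong₂ _,_ (at 0 z≤n (ℕ.+-identityʳ i) (ℕ.+-identityʳ i′))
               (at 1 (s≤s z≤n) (ℕ.+-comm i 1) (ℕ.+-comm i′ 1)))
    (segment-cong (suc i) (suc i′) m λ j j≤m → at (suc j) (s≤s j≤m) (ℕ.+-suc i j) (ℕ.+-suc i′ j))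
    where
    at : ∀ j → j ≤ suc m → ∀ {x x′} → i + j ≡ x → i′ + j ≡ x′ → g x ≡ g′ x′
    at j j≤ refl refl = eq j j≤

  vertex-segment : ∀ g i m es j → j ≤ m → vertex (g i) (segment g i m ++ es) j ≡ g (i + j)
  vertex-segment g i m       es zero    _           = trans (vertex-0 (g i) (segment g i m ++ es)) (cong g (sym (ℕ.+-identityʳ i)))
  vertex-segment g i (suc m) es (suc j) (s≤s j≤m) =
    trans (vertex-segment g (suc i) m es j j≤m) (cong g (sym (ℕ.+-suc i j)))

  segment-vertex : ∀ {x es y} → Path x es y → segment (vertex x es) 0 (length es) ≡ es
  segment-vertex []                       = refl
  segment-vertex (step {x} {y} {es = es} p) = cong₂ _∷_ (cong (x ,_) (vertex-0 y es))
    (trans (segment-cong 1 0 (length es) (λ _ _ → refl)) (segment-vertex p))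

states : ∀ {k n} → (ℕ → Fin k) → Sequence k n
states {n = n} g = Vec.tabulate (g ∘ toℕ)

transitions-states : ∀ {k} n (g : ℕ → Fin k) → transitions {n = n} (states g) ≡ segment g 0 n
transitions-states zero    g = refl
transitions-states (suc n) g = cong (_ ∷_) (trans (transitions-states n (g ∘ suc)) (segment-cong 0 1 n λ _ _ → refl))

path-sequence : ∀ {k n x y} {es : List (Fin k × Fin k)} → Path x es y → length es ≡ n →
                head (states {n = n} (vertex x es)) ≡ x × transitions (states {n = n} (vertex x es)) ≡ es
path-sequence {x = x} {es = es} p refl = vertex-0 x es , trans (transitions-states _ (vertex x es)) (segment-vertex p)

-- Exchanging closed walks for rounds of the cycle.

module Cyclic {k p : ℕ} .{{_ : NonZero p}} (c : Cycle k p) where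

  open CommutativeMonoidSolver (↭.++-commutativeMonoid {A = Fin k × Fin k}) using (solve; _⊜_; _⊕_)

  τ : ℕ → Fin k
  τ i = state c (i mod p)

  τ-cong : ∀ {i j} → i % p ≡ j % p → τ i ≡ τ j
  τ-cong {i} {j} eq = cong (state c) (Fin.fromℕ<-cong _ _ eq (m%n<n i p) (m%n<n j p))

  τ-period : ∀ i m → τ (i + m * p) ≡ τ i
  τ-period i m = τ-cong ([m+kn]%n≡m%n i m p)

  rounds : ℕ → List (Fin k × Fin k)
  rounds m = segment τ 0 (m * p)

  -- Starting one step later moves the first edge to the end, by periodicity.
  segment-rounds : ∀ i m → segment τ i (m * p) ↭ rounds m
  segment-rounds zero    m = ↭-refl
  segment-rounds (suc i) m = ↭-trans (↭-sym rotate) (segment-rounds i m)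
    where
    q : ℕ
    q = m * p
    turn : (τ i , τ (suc i)) ∷ segment τ (suc i) q ≡ segment τ i q ++ (τ i , τ (suc i)) ∷ []
    turn = trans (cong (segment τ i) (ℕ.+-comm 1 q)) (trans (segment-++ τ i q 1)
      (cong (λ e → segment τ i q ++ e ∷ []) (cong₂ _,_ (τ-period i m) (τ-period (suc i) m))))
    rotate : segment τ i q ↭ segment τ (suc i) q
    rotate = ↭.drop-∷ (↭-trans (↭.∷↭∷ʳ _ (segment τ i q)) (↭.↭-reflexive (sym turn)))

  segment-append : ∀ i q m → segment τ i (q + m * p) ↭ segment τ i q ++ rounds m
  segment-append i q m = ↭-trans (↭.↭-reflexive (segment-++ τ i q (m * p)))
    (↭.++⁺ˡ (segment τ i q) (segment-rounds (i + q) m))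

  rounds-+ : ∀ m m′ → rounds (m + m′) ↭ rounds m ++ rounds m′
  rounds-+ m m′ = ↭-trans (↭.↭-reflexive (cong (segment τ 0) (ℕ.*-distribʳ-+ p m m′))) (segment-append 0 (m * p) m′)

  -- The number of rounds may be changed without moving the ends. Thus rounds can be taken from the
  -- interior or added to it.
  arc : ∀ i q m → Path (τ i) (segment τ i (q + m * p)) (τ (i + q))
  arc i q m = subst (Path (τ i) (segment τ i (q + m * p)))
    (trans (cong τ (sym (ℕ.+-assoc i q (m * p)))) (τ-period (i + q) m)) (segment-path τ i (q + m * p))

  -- What the Viterbi property and the maximality of the interior give: a rearrangement of the edges in
  -- which X is exchanged for v rounds has no interior longer than I, provided that some es′ balances it.
  Trade : Fin k → List (Fin k × Fin k) → ℕ → Set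
  Trade x₀ E I = ∀ A i m R es′ X v {y y′} → Path x₀ (A ++ segment τ i m ++ R) y → Path x₀ es′ y′ →
    (A ++ segment τ i m ++ R) ++ es′ ↭ E ++ E → (A ++ segment τ i m ++ R) ++ X ↭ E ++ rounds v →
    length X ≡ v * p → m ≤ I

  module _ {x₀ : Fin k} {E : List (Fin k × Fin k)} {I : ℕ} (trade : Trade x₀ E I) where

    -- The first result drops `B` and has `m` more rounds in the interior; the balancing walk runs
    -- through `B` twice and has `m` rounds fewer. The connection `D` to the cycle survives in both,
    -- so that the rounds have a place to go.
    cut-before : ∀ A B D i q m R {x y} → Path x₀ A x → Path x B x → Path x D (τ i) → Path (τ (i + q)) R y →
      A ++ B ++ D ++ segment τ i (q + m * p) ++ R ↭ E → length B ≡ m * p → q + (m + m) * p ≤ I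
    cut-before A B D i q m R pA pB pD pR perm len =
      trade (A ++ D) i (q + (m + m) * p) R (A ++ B ++ B ++ D ++ Q ++ R) B m
        (subst (λ L → Path x₀ L _) (sym (List.++-assoc A D _)) (pA ++ᵖ pD ++ᵖ arc i q (m + m) ++ᵖ pR))
        (pA ++ᵖ pB ++ᵖ pB ++ᵖ pD ++ᵖ segment-path τ i q ++ᵖ pR)
        (↭-trans (↭.++⁺ʳ _ expand)
          (↭-trans (solve 6 (λ A B D Q C R → ((A ⊕ D) ⊕ (Q ⊕ C ⊕ C) ⊕ R) ⊕ A ⊕ B ⊕ B ⊕ D ⊕ Q ⊕ R ⊜
              ((A ⊕ B ⊕ D ⊕ (Q ⊕ C) ⊕ R) ⊕ A ⊕ B ⊕ D ⊕ (Q ⊕ C) ⊕ R)) ↭-refl A B D Q C R)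
            (↭.++⁺ whole whole)))
        (↭-trans (↭.++⁺ʳ B expand)
          (↭-trans (solve 6 (λ A B D Q C R → ((A ⊕ D) ⊕ (Q ⊕ C ⊕ C) ⊕ R) ⊕ B ⊜
              ((A ⊕ B ⊕ D ⊕ (Q ⊕ C) ⊕ R) ⊕ C)) ↭-refl A B D Q C R)
            (↭.++⁺ʳ C whole)))
        len
      where
      Q C : List (Fin k × Fin k)
      Q = segment τ i q
      C = rounds m
      whole : A ++ B ++ D ++ (Q ++ C) ++ R ↭ E
      whole = ↭-trans (↭.++⁺ˡ A (↭.++⁺ˡ B (↭.++⁺ˡ D (↭.++⁺ʳ R (↭-sym (segment-append i q m)))))) perm
      expand : (A ++ D) ++ segment τ i (q + (m + m) * p) ++ R ↭ (A ++ D) ++ (Q ++ C ++ C) ++ R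
      expand = ↭.++⁺ˡ (A ++ D) (↭.++⁺ʳ R (↭-trans (segment-append i q (m + m)) (↭.++⁺ˡ Q (rounds-+ m m))))

    -- The mirror image, with the closed walk behind the interior.
    cut-after : ∀ A i q m D B R {x y} → Path x₀ A (τ i) → Path (τ (i + q)) D x → Path x B x → Path x R y →
      A ++ segment τ i (q + m * p) ++ D ++ B ++ R ↭ E → length B ≡ m * p → q + (m + m) * p ≤ I
    cut-after A i q m D B R pA pD pB pR perm len =
      trade A i (q + (m + m) * p) (D ++ R) (A ++ Q ++ D ++ B ++ B ++ R) B m
        (pA ++ᵖ arc i q (m + m) ++ᵖ pD ++ᵖ pR)
        (pA ++ᵖ segment-path τ i q ++ᵖ pD ++ᵖ pB ++ᵖ pB ++ᵖ pR)
        (↭-trans (↭.++⁺ʳ _ expand)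
          (↭-trans (solve 6 (λ A B D Q C R → (A ⊕ (Q ⊕ C ⊕ C) ⊕ D ⊕ R) ⊕ A ⊕ Q ⊕ D ⊕ B ⊕ B ⊕ R ⊜
              ((A ⊕ (Q ⊕ C) ⊕ D ⊕ B ⊕ R) ⊕ A ⊕ (Q ⊕ C) ⊕ D ⊕ B ⊕ R)) ↭-refl A B D Q C R)
            (↭.++⁺ whole whole)))
        (↭-trans (↭.++⁺ʳ B expand)
          (↭-trans (solve 6 (λ A B D Q C R → (A ⊕ (Q ⊕ C ⊕ C) ⊕ D ⊕ R) ⊕ B ⊜
              ((A ⊕ (Q ⊕ C) ⊕ D ⊕ B ⊕ R) ⊕ C)) ↭-refl A B D Q C R)
            (↭.++⁺ʳ C whole)))
        len
      where
      Q C : List (Fin k × Fin k)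
      Q = segment τ i q
      C = rounds m
      whole : A ++ (Q ++ C) ++ D ++ B ++ R ↭ E
      whole = ↭-trans (↭.++⁺ˡ A (↭.++⁺ʳ (D ++ B ++ R) (↭-sym (segment-append i q m)))) perm
      expand : A ++ segment τ i (q + (m + m) * p) ++ D ++ R ↭ A ++ (Q ++ C ++ C) ++ D ++ R
      expand = ↭.++⁺ˡ A (↭.++⁺ʳ (D ++ R) (↭-trans (segment-append i q (m + m)) (↭.++⁺ˡ Q (rounds-+ m m))))

    -- Here the closed walk contains the interior, and all of it is replaced by `m` rounds based at
    -- `τ x`. Two copies of the original carry `u + u` rounds; after the first result has used `m`
    -- of them, `w` are left. The balancing walk runs through `B` and `B′` twice, with no rounds in
    -- the first passage and `w` in the second.
    cut-around : ∀ A x B i q u B′ R m w {y} → Path x₀ A (τ x) → Path (τ x) B (τ i) → Path (τ (i + q)) B′ (τ x) →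
      Path (τ x) R y → A ++ B ++ segment τ i (q + u * p) ++ B′ ++ R ↭ E →
      length B + (q + u * p + length B′) ≡ m * p → u + u ≡ m + w → m * p ≤ I
    cut-around A x B i q u B′ R m w pA pB pB′ pR perm len u+u≡m+w =
      trade A x (m * p) R (A ++ B ++ Q ++ B′ ++ B ++ segment τ i (q + w * p) ++ B′ ++ R)
        (B ++ segment τ i (q + u * p) ++ B′) m
        (pA ++ᵖ subst (λ j → Path (τ x) (segment τ x (m * p)) (τ j)) (ℕ.+-identityʳ x) (arc x 0 m) ++ᵖ pR)
        (pA ++ᵖ pB ++ᵖ segment-path τ i q ++ᵖ pB′ ++ᵖ pB ++ᵖ arc i q w ++ᵖ pB′ ++ᵖ pR)
        (↭-trans (↭.++⁺ (↭.++⁺ˡ A (↭.++⁺ʳ R (segment-rounds x m)))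
            (↭.++⁺ˡ A (↭.++⁺ˡ B (↭.++⁺ˡ Q (↭.++⁺ˡ B′ (↭.++⁺ˡ B (↭.++⁺ʳ (B′ ++ R) (segment-append i q w))))))))
          (↭-trans (solve 7 (λ A B B′ Q M W R → (A ⊕ M ⊕ R) ⊕ A ⊕ B ⊕ Q ⊕ B′ ⊕ B ⊕ (Q ⊕ W) ⊕ B′ ⊕ R ⊜
              ((M ⊕ W) ⊕ (A ⊕ B ⊕ Q ⊕ B′ ⊕ R) ⊕ A ⊕ B ⊕ Q ⊕ B′ ⊕ R)) ↭-refl A B B′ Q (rounds m) (rounds w) R)
          (↭-trans (↭.++⁺ʳ _ regroup)
          (↭-trans (solve 6 (λ A B B′ Q U R → (U ⊕ U) ⊕ (A ⊕ B ⊕ Q ⊕ B′ ⊕ R) ⊕ A ⊕ B ⊕ Q ⊕ B′ ⊕ R ⊜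
              ((A ⊕ B ⊕ (Q ⊕ U) ⊕ B′ ⊕ R) ⊕ A ⊕ B ⊕ (Q ⊕ U) ⊕ B′ ⊕ R)) ↭-refl A B B′ Q (rounds u) R)
            (↭.++⁺ whole whole)))))
        (↭-trans (↭.++⁺ʳ (B ++ segment τ i (q + u * p) ++ B′) (↭.++⁺ˡ A (↭.++⁺ʳ R (segment-rounds x m))))
          (↭-trans (solve 6 (λ A B B′ Q M R → (A ⊕ M ⊕ R) ⊕ B ⊕ Q ⊕ B′ ⊜ ((A ⊕ B ⊕ Q ⊕ B′ ⊕ R) ⊕ M)) ↭-refl
              A B B′ (segment τ i (q + u * p)) (rounds m) R)
            (↭.++⁺ʳ (rounds m) perm)))
        (trans (List.length-++ B) (trans (cong (length B +_) (trans (List.length-++ (segment τ i (q + u * p)))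
          (cong (_+ length B′) (length-segment τ i (q + u * p))))) len))
      where
      Q : List (Fin k × Fin k)
      Q = segment τ i q
      whole : A ++ B ++ (Q ++ rounds u) ++ B′ ++ R ↭ E
      whole = ↭-trans (↭.++⁺ˡ A (↭.++⁺ˡ B (↭.++⁺ʳ (B′ ++ R) (↭-sym (segment-append i q u))))) perm
      regroup : rounds m ++ rounds w ↭ rounds u ++ rounds u
      regroup = ↭-trans (↭-sym (rounds-+ m w)) (↭-trans (↭.↭-reflexive (cong rounds (sym u+u≡m+w))) (rounds-+ u u))

-- Repetitions outside the interior.

module Counting {k p : ℕ} .{{_ : NonZero p}} (c : Cycle k p) (x₀ : Fin k) (E : List (Fin k × Fin k)) (I : ℕ)
                (trade : Cyclic.Trade c x₀ E I) (long : (2 * k + 4) * p ≤ I) where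
  open Cyclic c

  toℕ-mod : ∀ (y : Fin p) → toℕ y mod p ≡ y
  toℕ-mod y = Fin.toℕ-injective (trans (Fin.toℕ-fromℕ< (m%n<n (toℕ y) p)) (m<n⇒m%n≡m (Fin.toℕ<n y)))

  -- The edges are fixed only up to order and `a` and `e` may vary, since moving closed walks
  -- changes the walk but neither `E` nor `I`. The phase `i` is counted from the start of the
  -- interior.
  record IsWalk (S : ℕ → Fin k) (a i e : ℕ) : Set where
    field
      start    : S 0 ≡ x₀
      interior : ∀ j → j ≤ I → S (a + j) ≡ τ (i + j)
      edges    : segment S 0 (a + (I + e)) ↭ E

    enter : S a ≡ τ i
    enter = subst₂ (λ y z → S y ≡ τ z) (ℕ.+-identityʳ a) (ℕ.+-identityʳ i) (interior 0 z≤n)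

    leave : S (a + I) ≡ τ (i + I)
    leave = interior I ℕ.≤-refl

    prefix-path : ∀ m → Path x₀ (segment S 0 m) (S m)
    prefix-path m = subst (λ y → Path y (segment S 0 m) (S m)) start (segment-path S 0 m)

    edges-split : segment S 0 a ++ segment τ i I ++ segment S (a + I) e ↭ E
    edges-split = ↭-trans (↭.↭-reflexive (sym (trans (segment-++ S 0 a (I + e))
      (cong (segment S 0 a ++_) (trans (segment-++ S a I e)
        (cong (_++ segment S (a + I) e) (segment-cong a i I interior))))))) edges

  shorter : ∀ {q m} → q + (suc m + suc m) * p ≤ I → I ≡ q + suc m * p → ⊥
  shorter {q} {m} le refl = ℕ.<-irrefl refl (ℕ.<-≤-trans
    (ℕ.+-monoʳ-< q (ℕ.*-monoˡ-< p (ℕ.m<m+n (suc m) (s≤s z≤n)))) le)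

  clash-before : ∀ {S i e} t m d → IsWalk S (t + (suc m * p + d)) i e → suc m * p ≤ I →
                 S t ≡ S (t + suc m * p) → ⊥
  clash-before {S} {i} {e} t m d walk B≤I same = shorter {q} {m} bound q+B
    where
    open IsWalk walk
    a B q : ℕ
    B = suc m * p
    a = t + (B + d)
    q = I ∸ B
    q+B : I ≡ q + B
    q+B = sym (ℕ.m∸n+n≡m B≤I)
    bound : q + (suc m + suc m) * p ≤ I
    bound = cut-before trade (segment S 0 t) (segment S t B) (segment S (t + B) d) i q (suc m) (segment S (a + I) e)
      (prefix-path t)
      (subst (Path (S t) (segment S t B)) (sym same) (segment-path S t B))
      (subst₂ (λ y z → Path y (segment S (t + B) d) z) (sym same) (trans (cong S (ℕ.+-assoc t B d)) enter)
        (segment-path S (t + B) d))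
      (subst (λ y → Path y (segment S (a + I) e) (S (a + I + e)))
        (trans leave (trans (cong τ (trans (cong (i +_) q+B) (sym (ℕ.+-assoc i q B)))) (τ-period (i + q) (suc m))))
        (segment-path S (a + I) e))
      (subst (_↭ E) (trans (cong₂ (λ u v → u ++ segment τ i v ++ segment S (a + I) e)
          (trans (segment-++ S 0 t (B + d)) (cong (segment S 0 t ++_) (segment-++ S t B d))) q+B)
        (trans (List.++-assoc (segment S 0 t) _ _) (cong (segment S 0 t ++_) (List.++-assoc (segment S t B) _ _)))) edges-split)
      (length-segment S t B)

  -- The closed walk ends `j` steps inside the interior. Cutting it out loses these steps, but
  -- `m * p` steps are gained, and this is more because the closed walk starts before the interior.
  clash-enter : ∀ {S i e} t d m j → IsWalk S (t + suc d) i e → t + m * p ≡ t + suc d + j →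
                m * p + j ≤ I → S t ≡ S (t + m * p) → ⊥
  clash-enter {S} {i} {e} t d m j walk meet room same = ℕ.<-irrefl refl (ℕ.<-≤-trans I<new bound)
    where
    open IsWalk walk
    a B q r : ℕ
    B = m * p
    a = t + suc d
    q = I ∸ (B + j)
    r = q + B
    B≡ : B ≡ suc d + j
    B≡ = ℕ.+-cancelˡ-≡ t B (suc d + j) (trans meet (ℕ.+-assoc t (suc d) j))
    I≡ : I ≡ j + r
    I≡ = trans (sym (ℕ.m∸n+n≡m room)) (solve 3 (λ q B j → q :+ (B :+ j) := j :+ (q :+ B)) refl q B j)
      where open +-*-Solver
    j≤I : j ≤ I
    j≤I = subst (j ≤_) (sym I≡) (ℕ.m≤m+n j r)
    onCycle : S (t + B) ≡ τ (i + j)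
    onCycle = trans (cong S meet) (interior j j≤I)
    bound : q + (m + m) * p ≤ I
    bound = cut-before trade (segment S 0 t) (segment S t B) [] (i + j) q m (segment S (a + I) e)
      (prefix-path t)
      (subst (Path (S t) (segment S t B)) (sym same) (segment-path S t B))
      (subst (Path (S t) []) (trans same onCycle) [])
      (subst (λ y → Path y (segment S (a + I) e) (S (a + I + e)))
        (trans leave (trans (cong τ (trans (cong (i +_) I≡)
          (solve 4 (λ i j q B → i :+ (j :+ (q :+ B)) := i :+ j :+ q :+ B) refl i j q B))) (τ-period (i + j + q) m)))
        (segment-path S (a + I) e))
      (subst (_↭ E) rearranged edges-split)
      (length-segment S t B)
      where
      open +-*-Solver
      rearranged : segment S 0 a ++ segment τ i I ++ segment S (a + I) e ≡
        segment S 0 t ++ segment S t B ++ [] ++ segment τ (i + j) r ++ segment S (a + I) e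
      rearranged = begin
        segment S 0 a ++ segment τ i I ++ R
          ≡⟨ cong₂ (λ u v → u ++ segment τ i v ++ R) (segment-++ S 0 t (suc d)) I≡ ⟩
        (segment S 0 t ++ segment S t (suc d)) ++ segment τ i (j + r) ++ R
          ≡⟨ cong (λ u → (segment S 0 t ++ segment S t (suc d)) ++ u ++ R) (segment-++ τ i j r) ⟩
        (segment S 0 t ++ segment S t (suc d)) ++ (segment τ i j ++ segment τ (i + j) r) ++ R
          ≡⟨ cong (λ u → (segment S 0 t ++ segment S t (suc d)) ++ (u ++ segment τ (i + j) r) ++ R)
               (segment-cong i a j (λ l l≤j → sym (interior l (ℕ.≤-trans l≤j j≤I)))) ⟩
        (segment S 0 t ++ segment S t (suc d)) ++ (segment S a j ++ segment τ (i + j) r) ++ R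
          ≡⟨ regroup (segment S 0 t) (segment S t (suc d)) (segment S a j) (segment τ (i + j) r) R ⟩
        segment S 0 t ++ (segment S t (suc d) ++ segment S a j) ++ segment τ (i + j) r ++ R
          ≡⟨ cong (λ u → segment S 0 t ++ u ++ segment τ (i + j) r ++ R)
               (trans (sym (segment-++ S t (suc d) j)) (cong (segment S t) (sym B≡))) ⟩
        segment S 0 t ++ segment S t B ++ segment τ (i + j) r ++ R ∎
        where
        open ≡-Reasoning
        R : List (Fin k × Fin k)
        R = segment S (a + I) e
        regroup : ∀ (u v w x y : List (Fin k × Fin k)) → (u ++ v) ++ (w ++ x) ++ y ≡ u ++ (v ++ w) ++ x ++ y
        regroup u v w x y = trans (List.++-assoc u v _) (cong (u ++_)
          (trans (cong (v ++_) (List.++-assoc w x y)) (sym (List.++-assoc v w _))))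
    I<new : I < q + (m + m) * p
    I<new = subst₂ _<_ (sym I≡) (solve 3 (λ q m p → m :* p :+ (q :+ m :* p) := q :+ (m :+ m) :* p) refl q m p)
      (ℕ.+-monoˡ-< r (subst (j <_) (sym B≡) (s≤s (ℕ.m≤n+m j d))))
      where open +-*-Solver

  clash-after : ∀ {S a i} d m r → IsWalk S a i (d + (suc m * p + r)) → suc m * p ≤ I →
                S (a + I + d) ≡ S (a + I + d + suc m * p) → ⊥
  clash-after {S} {a} {i} d m r walk B≤I same = shorter {q} {m} bound q+B
    where
    open IsWalk walk
    B b q : ℕ
    B = suc m * p
    b = a + I
    q = I ∸ B
    q+B : I ≡ q + B
    q+B = sym (ℕ.m∸n+n≡m B≤I)
    bound : q + (suc m + suc m) * p ≤ I
    bound = cut-after trade (segment S 0 a) i q (suc m) (segment S b d) (segment S (b + d) B) (segment S (b + d + B) r)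
      (subst (Path x₀ (segment S 0 a)) enter (prefix-path a))
      (subst (λ y → Path y (segment S b d) (S (b + d)))
        (trans leave (trans (cong τ (trans (cong (i +_) q+B) (sym (ℕ.+-assoc i q B)))) (τ-period (i + q) (suc m))))
        (segment-path S b d))
      (subst (Path (S (b + d)) (segment S (b + d) B)) (sym same) (segment-path S (b + d) B))
      (subst (λ y → Path y (segment S (b + d + B) r) (S (b + d + B + r))) (sym same) (segment-path S (b + d + B) r))
      (subst (_↭ E) (cong₂ (λ u v → segment S 0 a ++ segment τ i u ++ v) q+B
        (trans (segment-++ S b d (B + r)) (cong (segment S b d ++_) (segment-++ S (b + d) B r)))) edges-split)
      (length-segment S (b + d) B)

  -- The closed walk takes the last `l` steps of the interior with it; the gain `m * p` exceeds them
  -- by `suc d`.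
  clash-leave : ∀ {S a i} q m l d r → IsWalk S a i (suc d + r) → I ≡ q + m * p + l → m * p ≡ l + suc d →
                S (a + (q + m * p)) ≡ S (a + I + suc d) → ⊥
  clash-leave {S} {a} {i} q m l d r walk I≡ B≡ same = ℕ.<-irrefl refl (ℕ.<-≤-trans I<new bound)
    where
    open IsWalk walk
    open +-*-Solver
    B b j : ℕ
    B = m * p
    b = a + I
    j = q + B
    j≤I : j ≤ I
    j≤I = subst (j ≤_) (sym I≡) (ℕ.m≤m+n j l)
    b≡ : a + j + l ≡ b
    b≡ = trans (ℕ.+-assoc a j l) (cong (a +_) (sym I≡))
    end≡ : a + j + B ≡ b + suc d
    end≡ = trans (cong (a + j +_) B≡) (trans (sym (ℕ.+-assoc (a + j) l (suc d))) (cong (_+ suc d) b≡))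
    loop : List (Fin k × Fin k)
    loop = segment S (a + j) B
    rearranged : segment S 0 a ++ segment τ i I ++ segment S b (suc d + r) ≡
                 segment S 0 a ++ segment τ i j ++ [] ++ loop ++ segment S (b + suc d) r
    rearranged = cong (segment S 0 a ++_) (begin
      segment τ i I ++ segment S b (suc d + r)
        ≡⟨ cong₂ _++_ (trans (cong (segment τ i) I≡) (segment-++ τ i j l)) (segment-++ S b (suc d) r) ⟩
      (segment τ i j ++ segment τ (i + j) l) ++ segment S b (suc d) ++ R
        ≡⟨ cong (λ u → (segment τ i j ++ u) ++ segment S b (suc d) ++ R)
             (segment-cong (i + j) (a + j) l λ l′ l′≤l → sym (subst₂ (λ y z → S y ≡ τ z)
               (sym (ℕ.+-assoc a j l′)) (sym (ℕ.+-assoc i j l′))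
               (interior (j + l′) (subst (j + l′ ≤_) (sym I≡) (ℕ.+-monoʳ-≤ j l′≤l))))) ⟩
      (segment τ i j ++ segment S (a + j) l) ++ segment S b (suc d) ++ R
        ≡⟨ trans (List.++-assoc (segment τ i j) _ _) (cong (segment τ i j ++_) (sym (List.++-assoc (segment S (a + j) l) _ R))) ⟩
      segment τ i j ++ (segment S (a + j) l ++ segment S b (suc d)) ++ R
        ≡⟨ cong (λ u → segment τ i j ++ u ++ R) (trans (cong (λ y → segment S (a + j) l ++ segment S y (suc d)) (sym b≡))
             (trans (sym (segment-++ S (a + j) l (suc d))) (cong (segment S (a + j)) (sym B≡)))) ⟩
      segment τ i j ++ loop ++ R ∎)
      where
      open ≡-Reasoning
      R : List (Fin k × Fin k)
      R = segment S (b + suc d) r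
    onCycle : S (a + j) ≡ τ (i + q)
    onCycle = trans (interior j j≤I) (trans (cong τ (sym (ℕ.+-assoc i q B))) (τ-period (i + q) m))
    bound : q + (m + m) * p ≤ I
    bound = cut-after trade (segment S 0 a) i q m [] loop (segment S (b + suc d) r)
      (subst (Path x₀ (segment S 0 a)) enter (prefix-path a))
      (subst (λ y → Path y [] (S (a + j))) onCycle [])
      (subst (Path (S (a + j)) loop) (trans (cong S end≡) (sym same)) (segment-path S (a + j) B))
      (subst (λ y → Path y (segment S (b + suc d) r) (S (b + suc d + r))) (sym same) (segment-path S (b + suc d) r))
      (subst (_↭ E) rearranged edges-split)
      (length-segment S (a + j) B)
    I<new : I < q + (m + m) * p
    I<new = subst₂ _<_ (sym I≡) (solve 3 (λ q m p → q :+ m :* p :+ m :* p := q :+ (m :+ m) :* p) refl q m p)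
      (ℕ.+-monoʳ-< j (subst (l <_) (sym B≡) (ℕ.m<m+n l (s≤s z≤n))))

  clash-around : ∀ {S i} t d g r m x → IsWalk S (t + d) i (suc g + r) → m * p ≡ d + (I + suc g) →
    d ≤ k * p → suc g ≤ k * p → S t ≡ S (t + d + I + suc g) → S t ≡ τ x → ⊥
  clash-around {S} {i} t d g r m x walk B≡ d≤ g≤ same onCycle = ℕ.<-irrefl refl (ℕ.<-≤-trans I<mp bound)
    where
    open IsWalk walk
    open +-*-Solver
    a b q u : ℕ
    a = t + d
    b = a + I
    q = I % p
    u = I / p
    I≡ : I ≡ q + u * p
    I≡ = m≡m%n+[m/n]*n I p
    q<p : q < p
    q<p = m%n<n I p
    2k+4≤1+u : 2 * k + 4 ≤ suc u
    2k+4≤1+u = ℕ.*-cancelʳ-≤ (2 * k + 4) (suc u) p (ℕ.≤-trans long (subst (_≤ suc u * p) (sym I≡)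
      (ℕ.+-monoˡ-≤ (u * p) (ℕ.<⇒≤ q<p))))
    -- The parts before and after the interior amount to at most `k` rounds each and the interior to
    -- at most `u + 1`, so `m ≤ u + 2 * k + 1`; a long interior makes `u` at least `2 * k + 1`.
    m≤2u : m ≤ u + u
    m≤2u = ℕ.*-cancelʳ-≤ m (u + u) p (begin
      m * p                                     ≡⟨ B≡ ⟩
      d + (I + suc g)                         ≤⟨ ℕ.+-mono-≤ d≤ (ℕ.+-mono-≤ I≤ g≤) ⟩
      k * p + (p + u * p + k * p)     ≡⟨ solve 3 (λ k p u → k :* p :+ (p :+ u :* p :+ k :* p) := (con 2 :* k :+ con 1) :* p :+ u :* p) refl k p u ⟩
      (2 * k + 1) * p + u * p           ≤⟨ ℕ.+-monoˡ-≤ (u * p) (ℕ.*-monoˡ-≤ p 2k+1≤u) ⟩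
      u * p + u * p                         ≡⟨ sym (ℕ.*-distribʳ-+ p u u) ⟩
      (u + u) * p                             ∎)
      where
      open ℕ.≤-Reasoning
      I≤ : I ≤ p + u * p
      I≤ = subst (_≤ p + u * p) (sym I≡) (ℕ.+-monoˡ-≤ (u * p) (ℕ.<⇒≤ q<p))
      2k+1≤u : 2 * k + 1 ≤ u
      2k+1≤u = s≤s⁻¹ (ℕ.≤-trans (ℕ.≤-trans (ℕ.≤-reflexive (sym (ℕ.+-suc (2 * k) 1)))
        (ℕ.+-monoʳ-≤ (2 * k) (s≤s (s≤s z≤n)))) 2k+4≤1+u)
    bound : m * p ≤ I
    bound = cut-around trade (segment S 0 t) x (segment S t d) i q u (segment S b (suc g)) (segment S (b + suc g) r)
      m (u + u ∸ m)
      (subst (Path x₀ (segment S 0 t)) onCycle (prefix-path t))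
      (subst₂ (λ y z → Path y (segment S t d) z) onCycle enter (segment-path S t d))
      (subst₂ (λ y z → Path y (segment S b (suc g)) z)
        (trans leave (trans (cong τ (trans (cong (i +_) I≡) (sym (ℕ.+-assoc i q (u * p))))) (τ-period (i + q) u)))
        (trans (sym same) onCycle) (segment-path S b (suc g)))
      (subst (λ y → Path y (segment S (b + suc g) r) (S (b + suc g + r))) (trans (sym same) onCycle) (segment-path S (b + suc g) r))
      (subst (_↭ E) (trans (cong₂ (λ v w → v ++ w) (segment-++ S 0 t d)
          (cong₂ (λ v w → segment τ i v ++ w) I≡ (segment-++ S b (suc g) r)))
        (List.++-assoc (segment S 0 t) _ _)) edges-split)
      (trans (cong₂ (λ v w → v + (q + u * p + w)) (length-segment S t d) (length-segment S b (suc g)))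
        (trans (cong (λ v → d + (v + suc g)) (sym I≡)) (sym B≡)))
      (sym (ℕ.m+[n∸m]≡n m≤2u))
    I<mp : I < m * p
    I<mp = subst (I <_) (sym B≡) (ℕ.≤-trans (ℕ.m<m+n I (s≤s z≤n)) (ℕ.m≤n+m (I + suc g) d))

  -- A closed walk of the suffix is inserted at time `t`, where the walk is in the same state, so
  -- the edges are merely permuted. Its length `l` need not be a multiple of `p`: the interior is
  -- shifted as a whole and keeps its phase.
  move : ∀ {S i} t d g l r → IsWalk S (t + d) i (g + (l + r)) → S t ≡ S (t + d + I + g) →
         S t ≡ S (t + d + I + g + l) → ∃ λ S′ → IsWalk S′ (t + (l + d)) i (g + r)
  move {S} {i} t d g l r walk same same′ = vertex x₀ new , record
    { start    = vertex-0 x₀ new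
    ; interior = λ j j≤I → trans (subst (λ y → vertex x₀ new (y + j) ≡ vertex (S a) (segment S a I ++ tail) j) front-length
                   (vertex-++ (segment S a I ++ tail) j front-path)) (trans (vertex-segment S a I tail j j≤I) (interior j j≤I))
    ; edges    = ↭-trans (↭.↭-reflexive (trans (cong (segment (vertex x₀ new) 0) (sym new-length)) (segment-vertex new-path))) perm
    }
    where
    open IsWalk walk
    open CommutativeMonoidSolver (↭.++-commutativeMonoid {A = Fin k × Fin k}) using (_⊜_; _⊕_) renaming (solve to solve-↭)
    a b : ℕ
    a = t + d
    b = a + I
    loop front tail new : List (Fin k × Fin k)
    loop  = segment S (b + g) l
    front = segment S 0 t ++ loop ++ segment S t d
    tail  = segment S b g ++ segment S (b + g + l) r
    new   = front ++ segment S a I ++ tail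
    front-path : Path x₀ front (S a)
    front-path = prefix-path t ++ᵖ subst₂ (λ y z → Path y loop z) (sym same) (sym same′) (segment-path S (b + g) l) ++ᵖ segment-path S t d
    front-length : length front ≡ t + (l + d)
    front-length = trans (List.length-++ (segment S 0 t)) (cong₂ _+_ (length-segment S 0 t)
      (trans (List.length-++ loop) (cong₂ _+_ (length-segment S (b + g) l) (length-segment S t d))))
    new-path : Path x₀ new (S (b + g + l + r))
    new-path = front-path ++ᵖ segment-path S a I ++ᵖ segment-path S b g ++ᵖ
      subst (λ y → Path y (segment S (b + g + l) r) (S (b + g + l + r))) (trans (sym same′) same) (segment-path S (b + g + l) r)
    new-length : length new ≡ t + (l + d) + (I + (g + r))
    new-length = trans (List.length-++ front) (cong₂ _+_ front-length
      (trans (List.length-++ (segment S a I)) (cong₂ _+_ (length-segment S a I)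
        (trans (List.length-++ (segment S b g)) (cong₂ _+_ (length-segment S b g) (length-segment S (b + g + l) r))))))
    perm : new ↭ E
    perm = ↭-trans (solve-↭ 6 (λ A L D Q G R → (A ⊕ L ⊕ D) ⊕ Q ⊕ G ⊕ R ⊜ ((A ⊕ D) ⊕ Q ⊕ G ⊕ L ⊕ R)) ↭-refl
        (segment S 0 t) loop (segment S t d) (segment S a I) (segment S b g) (segment S (b + g + l) r))
      (subst (_↭ E) (cong₂ _++_ (segment-++ S 0 t d) (cong₂ _++_ (sym (segment-cong a i I interior))
        (trans (segment-++ S b g (l + r)) (cong (segment S b g ++_) (segment-++ S (b + g) l r))))) edges-split)

  -- Pairs of a state and a residue modulo `p`.

  module _ (S : ℕ → Fin k) where

    code : ℕ → Fin (k * p)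
    code t = Fin.combine (S t) (t mod p)

    code-state : ∀ {t t′} → code t ≡ code t′ → S t ≡ S t′
    code-state {t} {t′} eq = proj₁ (Fin.combine-injective (S t) (t mod p) (S t′) (t′ mod p) eq)

    code-time : ∀ {t t′} → t < t′ → code t ≡ code t′ → ∃ λ m → t′ ≡ t + suc m * p
    code-time {t} {t′} t<t′ eq = positive (t′ / p ∸ t / p) later
      where
      residue : t % p ≡ t′ % p
      residue = trans (sym (Fin.toℕ-fromℕ< (m%n<n t p))) (trans
        (cong toℕ (proj₂ (Fin.combine-injective (S t) (t mod p) (S t′) (t′ mod p) eq))) (Fin.toℕ-fromℕ< (m%n<n t′ p)))
      later : t′ ≡ t + (t′ / p ∸ t / p) * p
      later = begin
        t′                                                  ≡⟨ m≡m%n+[m/n]*n t′ p ⟩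
        t′ % p + t′ / p * p
          ≡⟨ cong₂ (λ r q → r + q * p) (sym residue) (sym (ℕ.m+[n∸m]≡n (/-monoˡ-≤ p (ℕ.<⇒≤ t<t′)))) ⟩
        t % p + (t / p + (t′ / p ∸ t / p)) * p
          ≡⟨ solve 4 (λ r q d p → r :+ (q :+ d) :* p := r :+ q :* p :+ d :* p) refl (t % p) (t / p) (t′ / p ∸ t / p) p ⟩
        t % p + t / p * p + (t′ / p ∸ t / p) * p  ≡⟨ cong (_+ (t′ / p ∸ t / p) * p) (sym (m≡m%n+[m/n]*n t p)) ⟩
        t + (t′ / p ∸ t / p) * p                      ∎
        where
        open ≡-Reasoning
        open +-*-Solver
      positive : ∀ d → t′ ≡ t + d * p → ∃ λ m → t′ ≡ t + suc m * p
      positive zero    eq′ = contradiction t<t′ (ℕ.<-irrefl (sym (trans eq′ (ℕ.+-identityʳ t))))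
      positive (suc m) eq′ = m , eq′

  [k+2]p≤I : ∀ {n} → n ≤ k * p + 2 * p → n ≤ I
  [k+2]p≤I n≤ = ℕ.≤-trans n≤ (ℕ.≤-trans (subst (_≤ (2 * k + 4) * p) (ℕ.*-distribʳ-+ p k 2)
    (ℕ.*-monoˡ-≤ p (ℕ.+-mono-≤ (ℕ.m≤m+n k (1 * k)) (s≤s (s≤s z≤n))))) long)

  kp≤I : ∀ {n} → n ≤ k * p → n ≤ I
  kp≤I n≤ = [k+2]p≤I (ℕ.≤-trans n≤ (ℕ.m≤m+n (k * p) (2 * p)))

  p≤kp : p ≤ k * p
  p≤kp = subst (_≤ k * p) (ℕ.*-identityˡ p) (ℕ.*-monoˡ-≤ p {1} {k} (1≤ x₀))
    where
    1≤ : ∀ {n} → Fin n → 1 ≤ n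
    1≤ zero    = s≤s z≤n
    1≤ (suc _) = s≤s z≤n

  module _ {S : ℕ → Fin k} {a i e : ℕ} (walk : IsWalk S a i e) where
    open IsWalk walk

    prefix-clash : ∀ {t t′} → t < t′ → t′ ≤ a → t′ ≤ t + k * p → code S t ≡ code S t′ → ⊥
    prefix-clash {t} {t′} t<t′ t′≤a near eq with code-time S t<t′ eq | ℕ.m≤n⇒∃[o]m+o≡n t′≤a
    ... | m , refl | d , refl = clash-before t m d (subst (λ y → IsWalk S y i e) (ℕ.+-assoc t (suc m * p) d) walk)
      (kp≤I (ℕ.+-cancelˡ-≤ t (suc m * p) (k * p) near)) (code-state S eq)

    suffix-clash : ∀ {s s′} → s < s′ → s′ ≤ e → s′ ≤ s + k * p → code S (a + I + s) ≡ code S (a + I + s′) → ⊥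
    suffix-clash {s} {s′} s<s′ s′≤e near eq = conclude (code-time S (ℕ.+-monoʳ-< (a + I) s<s′) eq) (ℕ.m≤n⇒∃[o]m+o≡n s′≤e)
      where
      conclude : (∃ λ m → a + I + s′ ≡ a + I + s + suc m * p) → (∃ λ r → s′ + r ≡ e) → ⊥
      conclude (m , shift) (r , refl) = clash-after s m r
          (subst (IsWalk S a i) (trans (cong (_+ r) s′≡) (ℕ.+-assoc s (suc m * p) r)) walk)
          (kp≤I (ℕ.+-cancelˡ-≤ s (suc m * p) (k * p) (subst (_≤ s + k * p) s′≡ near)))
          (trans (code-state S eq) (cong S shift))
        where
        s′≡ : s′ ≡ s + suc m * p
        s′≡ = ℕ.+-cancelˡ-≡ (a + I) s′ (s + suc m * p) (trans shift (ℕ.+-assoc (a + I) s (suc m * p)))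

    -- Before any bound on prefix and suffix is known, a clash is available only for times at most
    -- `k * p` apart, as the closed walk between them has to fit into the interior. Among
    -- `k * p + 1` consecutive times the pigeonhole principle finds such a pair. Once the length is
    -- bounded, the restriction is automatic.
    short : ∀ {n} (f : ℕ → ℕ) → (∀ {t t′} → t < t′ → t′ ≤ n → t′ ≤ t + k * p → code S (f t) ≡ code S (f t′) → ⊥) →
            n ≤ k * p
    short {n} f clash = ℕ.≮⇒≥ λ kp<n → repeat kp<n (Fin.pigeonhole (ℕ.n<1+n (k * p)) (code S ∘ f ∘ toℕ))
      where
      repeat : k * p < n → ¬ (∃ λ u → ∃ λ v → u Fin.< v × code S (f (toℕ u)) ≡ code S (f (toℕ v)))
      repeat kp<n (u , v , u<v , eq) = clash u<v (ℕ.≤-trans v≤kp (ℕ.<⇒≤ kp<n)) (ℕ.≤-trans v≤kp (ℕ.m≤n+m (k * p) (toℕ u))) eq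
        where
        v≤kp : toℕ v ≤ k * p
        v≤kp = s≤s⁻¹ (Fin.toℕ<n v)

    a≤kp : a ≤ k * p
    a≤kp = short (λ t → t) prefix-clash

    e≤kp : e ≤ k * p
    e≤kp = short (a + I +_) suffix-clash

    prefix-injective : ∀ {t t′} → t < t′ → t′ ≤ a → code S t ≡ code S t′ → ⊥
    prefix-injective {t} t<t′ t′≤a = prefix-clash t<t′ t′≤a (ℕ.≤-trans t′≤a (ℕ.≤-trans a≤kp (ℕ.m≤n+m (k * p) t)))

    suffix-injective : ∀ {s s′} → s < s′ → s′ ≤ e → code S (a + I + s) ≡ code S (a + I + s′) → ⊥
    suffix-injective {s} s<s′ s′≤e = suffix-clash s<s′ s′≤e (ℕ.≤-trans s′≤e (ℕ.≤-trans e≤kp (ℕ.m≤n+m (k * p) s)))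

    cycle-injective : ∀ {y y′} → y < y′ → y′ < p → code S (a + y) ≡ code S (a + y′) → ⊥
    cycle-injective {y} {y′} y<y′ y′<p eq with code-time S (ℕ.+-monoʳ-< a y<y′) eq
    ... | m , shift = ℕ.<-irrefl refl (ℕ.<-≤-trans y′<p (ℕ.≤-trans (ℕ.≤-trans (ℕ.m≤m+n p (m * p)) (ℕ.m≤n+m (suc m * p) y))
      (ℕ.≤-reflexive (sym (ℕ.+-cancelˡ-≡ a y′ (y + suc m * p) (trans shift (ℕ.+-assoc a y (suc m * p))))))))

    prefix-cycle : ∀ {t y} → t < a → y < p → code S t ≡ code S (a + y) → ⊥
    prefix-cycle {t} {y} t<a y<p eq = conclude (code-time S (ℕ.<-≤-trans t<a (ℕ.m≤m+n a y)) eq) (ℕ.m≤n⇒∃[o]m+o≡n t<a)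
      where
      conclude : (∃ λ m → a + y ≡ t + suc m * p) → (∃ λ d → suc t + d ≡ a) → ⊥
      conclude (m , shift) (d , a≡) = clash-enter t d (suc m) y (subst (λ z → IsWalk S z i e) (sym a≡′) walk)
          (trans (sym shift) (cong (_+ y) (sym a≡′)))
          ([k+2]p≤I (ℕ.≤-trans (ℕ.+-monoˡ-≤ y (ℕ.≤-trans (ℕ.m≤n+m (suc m * p) t) (ℕ.≤-reflexive (sym shift)))) room))
          (trans (code-state S eq) (cong S shift))
        where
        a≡′ : t + suc d ≡ a
        a≡′ = trans (ℕ.+-suc t d) a≡
        room : a + y + y ≤ k * p + 2 * p
        room = ℕ.≤-trans (ℕ.≤-reflexive (ℕ.+-assoc a y y)) (ℕ.+-mono-≤ a≤kp
          (ℕ.≤-trans (ℕ.+-mono-≤ (ℕ.<⇒≤ y<p) (ℕ.<⇒≤ y<p)) (ℕ.≤-reflexive (cong (p +_) (sym (ℕ.+-identityʳ p))))))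

    cycle-suffix : ∀ {y d} → y < p → d < e → code S (a + y) ≡ code S (a + I + suc d) → ⊥
    cycle-suffix {y} {d} y<p d<e eq = conclude (code-time S earlier eq) (ℕ.m≤n⇒∃[o]m+o≡n d<e)
      where
      open +-*-Solver
      y≤I : y ≤ I
      y≤I = kp≤I (ℕ.≤-trans (ℕ.<⇒≤ y<p) p≤kp)
      earlier : a + y < a + I + suc d
      earlier = ℕ.≤-<-trans (ℕ.+-monoʳ-≤ a y≤I) (ℕ.m<m+n (a + I) (s≤s z≤n))
      conclude : (∃ λ M → a + I + suc d ≡ a + y + suc M * p) → (∃ λ r → suc d + r ≡ e) → ⊥
      conclude (M , shift) (r , refl) = clash-leave q m l d r walk I≡ (sym (ℕ.m∸n+n≡m d≤mp)) same
        where
        m w l q : ℕ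
        -- The state at `y` recurs in every round. The occurrence `m` rounds before the suffix time
        -- is used: `m * p` reaches back over the suffix into the interior, and another `m` rounds
        -- have to precede it as payment. Both fit because `long` allows for `2 * k + 4 = m + m`
        -- rounds.
        m = k + 2
        l = m * p ∸ suc d
        w = suc M ∸ (m + m)
        q = y + w * p
        d≤mp : suc d ≤ m * p
        d≤mp = ℕ.≤-trans (ℕ.≤-trans (ℕ.m≤m+n (suc d) r) e≤kp) (ℕ.*-monoˡ-≤ p (ℕ.m≤m+n k 2))
        total : I + suc d ≡ y + suc M * p
        total = ℕ.+-cancelˡ-≡ a _ _ (trans (sym (ℕ.+-assoc a I (suc d))) (trans shift (ℕ.+-assoc a y (suc M * p))))
        2m≤M : m + m ≤ suc M
        2m≤M = s≤s⁻¹ (ℕ.*-cancelʳ-< p (m + m) (suc (suc M)) (begin-strict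
          (m + m) * p         ≡⟨ cong (_* p) (solve 1 (λ k → k :+ con 2 :+ (k :+ con 2) := con 2 :* k :+ con 4) refl k) ⟩
          (2 * k + 4) * p   ≤⟨ long ⟩
          I                       ≤⟨ ℕ.m≤m+n I (suc d) ⟩
          I + suc d             ≡⟨ total ⟩
          y + suc M * p       <⟨ ℕ.+-monoˡ-< (suc M * p) y<p ⟩
          p + suc M * p       ∎))
          where open ℕ.≤-Reasoning
        M≡ : suc M ≡ m + m + w
        M≡ = sym (ℕ.m+[n∸m]≡n 2m≤M)
        I≡ : I ≡ q + m * p + l
        I≡ = ℕ.+-cancelʳ-≡ (suc d) I (q + m * p + l) (begin
          I + suc d                           ≡⟨ total ⟩
          y + suc M * p                     ≡⟨ cong (λ z → y + z * p) M≡ ⟩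
          y + (m + m + w) * p
            ≡⟨ solve 4 (λ y m w p → y :+ (m :+ m :+ w) :* p := y :+ w :* p :+ m :* p :+ m :* p) refl y m w p ⟩
          q + m * p + m * p             ≡⟨ cong (q + m * p +_) (sym (ℕ.m∸n+n≡m d≤mp)) ⟩
          q + m * p + (l + suc d)       ≡⟨ sym (ℕ.+-assoc (q + m * p) l (suc d)) ⟩
          q + m * p + l + suc d         ∎)
          where open ≡-Reasoning
        same : S (a + (q + m * p)) ≡ S (a + I + suc d)
        same = trans (interior (q + m * p) (subst (q + m * p ≤_) (sym I≡) (ℕ.m≤m+n (q + m * p) l)))
          (trans (cong τ (solve 5 (λ i y w m p → i :+ (y :+ w :* p :+ m :* p) := i :+ y :+ (w :+ m) :* p) refl i y w m p))
          (trans (τ-period (i + y) (w + m)) (trans (sym (interior y y≤I)) (code-state S eq))))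

    around-cycle : ∀ {t d x} → t < a → d < e → code S t ≡ code S (a + I + suc d) →
                   S (a + I + suc d) ≡ τ x → ⊥
    around-cycle {t} {d} {x} t<a d<e eq onCycle =
      conclude (code-time S earlier eq) (ℕ.m≤n⇒∃[o]m+o≡n (ℕ.<⇒≤ t<a)) (ℕ.m≤n⇒∃[o]m+o≡n d<e)
      where
      earlier : t < a + I + suc d
      earlier = ℕ.<-≤-trans t<a (ℕ.≤-trans (ℕ.m≤m+n a I) (ℕ.m≤m+n (a + I) (suc d)))
      conclude : (∃ λ m → a + I + suc d ≡ t + suc m * p) → (∃ λ u → t + u ≡ a) → (∃ λ r → suc d + r ≡ e) → ⊥
      conclude (m , shift) (u , refl) (r , refl) = clash-around t u d r (suc m) x walk
        (ℕ.+-cancelˡ-≡ t _ _ (trans (sym shift) (solve 4 (λ t u I d → t :+ u :+ I :+ d := t :+ (u :+ (I :+ d))) refl t u I (suc d))))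
        (ℕ.≤-trans (ℕ.m≤n+m u t) a≤kp) (ℕ.≤-trans (ℕ.m≤m+n (suc d) r) e≤kp) (code-state S eq)
        (trans (code-state S eq) onCycle)
        where open +-*-Solver

    -- Two recurring suffix times with the same state enclose a closed walk at a state that the
    -- prefix visits too, so `move` applies. It lowers `e` and keeps the sum `a + e`.
    shorten : ∀ {t d d′} → t < a → d < d′ → d′ < e → S t ≡ S (a + I + suc d) →
              S (a + I + suc d) ≡ S (a + I + suc d′) →
              ∃ λ S′ → ∃ λ a′ → ∃ λ e′ → IsWalk S′ a′ i e′ × e′ < e × a′ + e′ ≡ a + e
    shorten {t} {d} {d′} t<a d<d′ d′<e same same′ =
      conclude (ℕ.m≤n⇒∃[o]m+o≡n (ℕ.<⇒≤ t<a)) (ℕ.m≤n⇒∃[o]m+o≡n d<d′) (ℕ.m≤n⇒∃[o]m+o≡n d′<e)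
      where
      open +-*-Solver
      conclude : (∃ λ u → t + u ≡ a) → (∃ λ l → suc d + l ≡ d′) → (∃ λ r → suc d′ + r ≡ e) →
        ∃ λ S′ → ∃ λ a′ → ∃ λ e′ → IsWalk S′ a′ i e′ × e′ < e × a′ + e′ ≡ a + e
      conclude (u , refl) (l , refl) (r , refl) = proj₁ moved , t + (suc l + u) , suc d + r , proj₂ moved ,
        ℕ.+-monoˡ-< r (s≤s (s≤s (ℕ.m≤m+n d l))) ,
        solve 5 (λ t u l d r → t :+ (con 1 :+ l :+ u) :+ (con 1 :+ d :+ r) := t :+ u :+ (con 1 :+ (con 1 :+ d :+ l) :+ r)) refl t u l d r
        where
        moved : ∃ λ S′ → IsWalk S′ (t + (suc l + u)) i (suc d + r)
        moved = move t u (suc d) (suc l) r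
          (subst (IsWalk S (t + u) i) (solve 3 (λ d l r → con 1 :+ (con 1 :+ d :+ l) :+ r := con 1 :+ d :+ (con 1 :+ l :+ r)) refl d l r) walk)
          same (trans same (trans same′ (cong S
            (solve 3 (λ b d l → b :+ (con 1 :+ (con 1 :+ d :+ l)) := b :+ (con 1 :+ d) :+ (con 1 :+ l)) refl (t + u + I) d l))))

    -- The injection that gives the bound.

    -- Both end points of the interior belong to it: prefix times run up to `a - 1` and suffix times
    -- start one step after the interior. So there are exactly `a + e` outside times, one per
    -- transition.
    Time : Set
    Time = (Fin a ⊎ Fin e) ⊎ (Fin p ⊎ Fin p)

    after : Fin e → ℕ
    after x = a + I + suc (toℕ x)

    Seen : Fin e → Set
    Seen x = ∃ λ (t : Fin a) → code S (toℕ t) ≡ code S (after x)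

    seen? : ∀ x → Dec (Seen x)
    seen? x = Fin.any? λ t → code S (toℕ t) Fin.≟ code S (after x)

    tag-suffix : ∀ x → Dec (Seen x) → Fin (k * p) ⊎ Fin k
    tag-suffix x (yes _) = inj₂ (S (after x))
    tag-suffix x (no _)  = inj₁ (code S (after x))

    -- A time outside the interior is recorded by its state and its residue, except that a repetition in the
    -- suffix of a pair met in the prefix is recorded by its state only.  The last two summands
    -- count the pairs met in the interior and the states on the cycle, which are never recorded.
    tag : Time → Fin (k * p) ⊎ Fin k
    tag (inj₁ (inj₁ t)) = inj₁ (code S (toℕ t))
    tag (inj₁ (inj₂ x)) = tag-suffix x (seen? x)
    tag (inj₂ (inj₁ y)) = inj₁ (code S (a + toℕ y))
    tag (inj₂ (inj₂ y)) = inj₂ (state c y)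

    separate : ∀ {n} (f : ℕ → Fin (k * p)) → (∀ {u v} → u < v → v < n → f u ≡ f v → ⊥) →
               ∀ (u v : Fin n) → f (toℕ u) ≡ f (toℕ v) → u ≡ v
    separate f clash u v eq with Fin.<-cmp u v
    ... | tri< u<v _ _ = ⊥-elim (clash u<v (Fin.toℕ<n v) eq)
    ... | tri≈ _ u≡v _ = u≡v
    ... | tri> _ _ v<u = ⊥-elim (clash v<u (Fin.toℕ<n u) (sym eq))

    module _ (stuck : ¬ (∃ λ S′ → ∃ λ a′ → ∃ λ e′ → IsWalk S′ a′ i e′ × e′ < e × a′ + e′ ≡ a + e)) where

      tag-suffix-injective : ∀ x x′ (s : Dec (Seen x)) (s′ : Dec (Seen x′)) → tag-suffix x s ≡ tag-suffix x′ s′ → x ≡ x′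
      tag-suffix-injective x x′ (no _) (no _) eq =
        separate (λ s → code S (a + I + suc s)) (λ u<v v<e → suffix-injective (s≤s u<v) v<e) x x′ (inj₁-injective eq)
      tag-suffix-injective x x′ (yes (t , seen)) (yes (t′ , seen′)) eq with Fin.<-cmp x x′
      ... | tri< x<x′ _ _ = ⊥-elim (stuck (shorten (Fin.toℕ<n t) x<x′ (Fin.toℕ<n x′) (code-state S seen) (inj₂-injective eq)))
      ... | tri≈ _ x≡x′ _ = x≡x′
      ... | tri> _ _ x′<x = ⊥-elim (stuck (shorten (Fin.toℕ<n t′) x′<x (Fin.toℕ<n x) (code-state S seen′) (sym (inj₂-injective eq))))

      prefix≢suffix : ∀ t x (s : Dec (Seen x)) → inj₁ (code S (toℕ t)) ≡ tag-suffix x s → ⊥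
      prefix≢suffix t x (no ¬seen) eq = ¬seen (t , inj₁-injective eq)

      cycle≢suffix : ∀ (y : Fin p) x (s : Dec (Seen x)) → inj₁ (code S (a + toℕ y)) ≡ tag-suffix x s → ⊥
      cycle≢suffix y x (no _) eq = cycle-suffix (Fin.toℕ<n y) (Fin.toℕ<n x) (inj₁-injective eq)

      state≢suffix : ∀ y x (s : Dec (Seen x)) → inj₂ (state c y) ≡ tag-suffix x s → ⊥
      state≢suffix y x (yes (t , seen)) eq = around-cycle (Fin.toℕ<n t) (Fin.toℕ<n x) seen
        (trans (sym (inj₂-injective eq)) (cong (state c) (sym (toℕ-mod y))))

      tag-injective : ∀ u v → tag u ≡ tag v → u ≡ v
      tag-injective (inj₁ (inj₁ t)) (inj₁ (inj₁ t′)) eq =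
        cong (inj₁ ∘ inj₁) (separate (code S) (λ u<v v<a → prefix-injective u<v (ℕ.<⇒≤ v<a)) t t′ (inj₁-injective eq))
      tag-injective (inj₁ (inj₁ t)) (inj₁ (inj₂ x)) eq = ⊥-elim (prefix≢suffix t x (seen? x) eq)
      tag-injective (inj₁ (inj₁ t)) (inj₂ (inj₁ y)) eq = ⊥-elim (prefix-cycle (Fin.toℕ<n t) (Fin.toℕ<n y) (inj₁-injective eq))
      tag-injective (inj₁ (inj₂ x)) (inj₁ (inj₁ t)) eq = ⊥-elim (prefix≢suffix t x (seen? x) (sym eq))
      tag-injective (inj₁ (inj₂ x)) (inj₁ (inj₂ x′)) eq = cong (inj₁ ∘ inj₂) (tag-suffix-injective x x′ (seen? x) (seen? x′) eq)
      tag-injective (inj₁ (inj₂ x)) (inj₂ (inj₁ y)) eq = ⊥-elim (cycle≢suffix y x (seen? x) (sym eq))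
      tag-injective (inj₁ (inj₂ x)) (inj₂ (inj₂ y)) eq = ⊥-elim (state≢suffix y x (seen? x) (sym eq))
      tag-injective (inj₂ (inj₁ y)) (inj₁ (inj₁ t)) eq = ⊥-elim (prefix-cycle (Fin.toℕ<n t) (Fin.toℕ<n y) (inj₁-injective (sym eq)))
      tag-injective (inj₂ (inj₁ y)) (inj₁ (inj₂ x)) eq = ⊥-elim (cycle≢suffix y x (seen? x) eq)
      tag-injective (inj₂ (inj₁ y)) (inj₂ (inj₁ y′)) eq =
        cong (inj₂ ∘ inj₁) (separate (λ z → code S (a + z)) cycle-injective y y′ (inj₁-injective eq))
      tag-injective (inj₂ (inj₂ y)) (inj₁ (inj₂ x)) eq = ⊥-elim (state≢suffix y x (seen? x) eq)
      tag-injective (inj₂ (inj₂ y)) (inj₂ (inj₂ y′)) eq = cong (inj₂ ∘ inj₂) (distinct c (inj₂-injective eq))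

      count : a + e + (p + p) ≤ k * p + k
      count = Fin.injective⇒≤ {f = Fin.join (k * p) k ∘ tag ∘ decode} λ {u} {v} eq →
        trans (sym (encode-decode u)) (trans (cong encode (tag-injective (decode u) (decode v) (join-injective eq))) (encode-decode v))
        where
        decode : Fin (a + e + (p + p)) → Time
        decode u = Sum.map (Fin.splitAt a) (Fin.splitAt p) (Fin.splitAt (a + e) u)
        encode : Time → Fin (a + e + (p + p))
        encode u = Fin.join (a + e) (p + p) (Sum.map (Fin.join a e) (Fin.join p p) u)
        encode-decode : ∀ u → encode (decode u) ≡ u
        encode-decode u = trans (cong (Fin.join (a + e) (p + p)) (go (Fin.splitAt (a + e) u))) (Fin.join-splitAt (a + e) (p + p) u)
          where
          go : ∀ s → Sum.map (Fin.join a e) (Fin.join p p) (Sum.map (Fin.splitAt a) (Fin.splitAt p) s) ≡ s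
          go (inj₁ x) = cong inj₁ (Fin.join-splitAt a e x)
          go (inj₂ y) = cong inj₂ (Fin.join-splitAt p p y)
        join-injective : ∀ {s s′} → Fin.join (k * p) k s ≡ Fin.join (k * p) k s′ → s ≡ s′
        join-injective {s} {s′} eq = trans (sym (Fin.splitAt-join (k * p) k s))
          (trans (cong (Fin.splitAt (k * p)) eq) (Fin.splitAt-join (k * p) k s′))

  -- Whether a walk can be shortened need not be decided. If the decidable bound fails, it fails for
  -- every shortened walk too, since `a + e` is the same; by induction there is none, and `count`
  -- applies.
  outside-bound : ∀ {S a i e} → Acc _<_ e → IsWalk S a i e → a + e + (p + p) ≤ k * p + k
  outside-bound {a = a} {e = e} (acc smaller) walk with a + e + (p + p) ℕ.≤? k * p + k
  ... | yes bound = bound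
  ... | no ¬bound = count walk λ (S′ , a′ , e′ , walk′ , e′<e , a′+e′) →
    ¬bound (subst (λ n → n + (p + p) ≤ k * p + k) a′+e′ (outside-bound (smaller e′<e) walk′))

-- Viterbi sequences and their maximal interiors.

sequence-path : ∀ {k n} (s : Sequence k n) → Path (head s) (transitions s) (Vec.last s)
sequence-path (x Vec.∷ Vec.[])     = []
sequence-path (x Vec.∷ y Vec.∷ ys) = step (sequence-path (y Vec.∷ ys))

lookup-vertex : ∀ {k n} (s : Sequence k n) t → lookup s t ≡ vertex (head s) (transitions s) (toℕ t)
lookup-vertex (x Vec.∷ ys)         zero    = sym (vertex-0 x (transitions (x Vec.∷ ys)))
lookup-vertex (x Vec.∷ y Vec.∷ ys) (suc t) = lookup-vertex (y Vec.∷ ys) t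

module _ {k p : ℕ} .{{_ : NonZero p}} (c : Cycle k p) where
  open Cyclic c

  τ-suc : ∀ {i j} → i % p ≡ j % p → τ (suc i) ≡ τ (suc j)
  τ-suc {i} {j} eq = τ-cong (trans (%-distribˡ-+ 1 i p) (trans (cong (λ r → (1 % p + r) % p) eq) (sym (%-distribˡ-+ 1 j p))))

  τ-residue : ∀ {i j} → τ i ≡ τ j → i % p ≡ j % p
  τ-residue {i} {j} eq = trans (sym (Fin.toℕ-fromℕ< (m%n<n i p))) (trans (cong toℕ (distinct c eq)) (Fin.toℕ-fromℕ< (m%n<n j p)))

  cycle-edge : ℕ → Fin k × Fin k
  cycle-edge l = τ l , τ (suc l)

  #-segment : ∀ e → (∀ l → e ≢ cycle-edge l) → ∀ l m → # e (segment τ l m) ≡ 0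
  #-segment e off l zero = refl
  #-segment e off l (suc m) with e ≟ₚ cycle-edge l
  ... | yes on = contradiction on (off l)
  ... | no  _  = #-segment e off (suc l) m

  -- The Viterbi property is that of `s`, the decomposition that of its rearrangement `s′`. Edge
  -- multiplicities pass between the two.
  module Exchange {n : ℕ} (M : MarkovChain k) (s s′ : Sequence k n) (positive : PositiveMeasure (SameRegion n M))
                  (viterbi : IsViterbiPath M s) (s′∼s : s′ ∼ s) where

    E : List (Fin k × Fin k)
    E = transitions s′

    module _ {y y′ : Fin k} {es es′ X : List (Fin k × Fin k)} {v : ℕ} (path : Path (head s′) es y) (path′ : Path (head s′) es′ y′)
             (balanced : es ++ es′ ↭ E ++ E) (exchanged : es ++ X ↭ E ++ rounds v) (length-X : length X ≡ v * p) where

      length-es : length es ≡ length E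
      length-es = ℕ.+-cancelʳ-≡ (length X) _ _ (trans (sym (List.length-++ es)) (trans (↭.↭-length exchanged)
        (trans (List.length-++ E) (cong (length E +_) (trans (length-segment τ 0 (v * p)) (sym length-X))))))

      length-es′ : length es′ ≡ length E
      length-es′ = ℕ.+-cancelˡ-≡ (length E) _ _ (trans (cong (_+ length es′) (sym length-es))
        (trans (sym (List.length-++ es)) (trans (↭.↭-length balanced) (List.length-++ E))))

      t t′ : Sequence k n
      t  = states (vertex (head s′) es)
      t′ = states (vertex (head s′) es′)

      sequence-t : head t ≡ head s′ × transitions t ≡ es
      sequence-t = path-sequence path (trans length-es (length-transitions s′))

      sequence-t′ : head t′ ≡ head s′ × transitions t′ ≡ es′
      sequence-t′ = path-sequence path′ (trans length-es′ (length-transitions s′))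

      off-cycle : ∀ e → (∀ l → e ≢ cycle-edge l) → # e es ≤ # e E
      off-cycle e off = ℕ.≤-trans (ℕ.m≤m+n (# e es) (# e X)) (ℕ.≤-reflexive (trans (sym (#-++ e es X))
        (trans (#-↭ e exchanged) (trans (#-++ e E (rounds v))
          (trans (cong (# e E +_) (#-segment e off 0 (v * p))) (ℕ.+-identityʳ (# e E)))))))

      E↭s : E ↭ transitions s
      E↭s = proj₂ s′∼s

      on-cycle : ∀ l → # (cycle-edge l) es ≤ # (cycle-edge l) E
      on-cycle l = ℕ.≮⇒≥ λ more → no-excess M s t t′ positive viterbi
        (trans (proj₁ sequence-t) (proj₁ s′∼s)) (trans (proj₁ sequence-t′) (proj₁ s′∼s))
        (subst₂ (λ u w → u ++ w ↭ transitions s ++ transitions s) (sym (proj₂ sequence-t)) (sym (proj₂ sequence-t′))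
          (↭-trans balanced (↭.++⁺ E↭s E↭s)))
        (τ l) (τ (suc l))
        (subst₂ _<_ (#-↭ (cycle-edge l) E↭s) (cong (# (cycle-edge l)) (sym (proj₂ sequence-t))) more)
        -- The states of the cycle are distinct, so the source `τ l` determines the residue: any
        -- other edge of this row is off the cycle.
        (λ j j≢ → subst₂ _≤_ (cong (# (τ l , j)) (sym (proj₂ sequence-t))) (#-↭ (τ l , j) E↭s)
          (off-cycle (τ l , j) λ l′ eq → j≢ (trans (cong proj₂ eq) (τ-suc (τ-residue {l′} {l} (sym (cong proj₁ eq)))))))

      rearranged : es ↭ E
      rearranged = #-≤⇒↭ es E length-es λ e → compare e (Fin.any? λ x → e ≟ₚ cycle-edge (toℕ x))
        where
        compare : ∀ e → Dec (∃ λ (x : Fin p) → e ≡ cycle-edge (toℕ x)) → # e es ≤ # e E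
        compare e (yes (x , refl)) = on-cycle (toℕ x)
        compare e (no off)         = off-cycle e λ l eq → off (l mod p , trans eq
          (cong₂ _,_ (τ-cong (sym (representative l))) (τ-suc (sym (representative l)))))
          where
          representative : ∀ l → toℕ (l mod p) % p ≡ l % p
          representative l = trans (cong (_% p) (Fin.toℕ-fromℕ< (m%n<n l p))) (m%n%n≡m%n l p)

    trade : ∀ (D : Decomposition c s′) → IsMaximal D → Trade (head s′) E (interiorLength D)
    -- An empty segment would not reveal that `A` ends at `τ i`, but then the claim is empty too.
    trade D maximal A i zero R es′ X v path path′ balanced exchanged length-X = z≤n
    trade D maximal A i m@(suc _) R es′ X v path path′ balanced exchanged length-X =
      subst (_≤ interiorLength D) interior≡ (maximal u
        (proj₁ sequence-u , subst (_↭ E) (sym (proj₂ sequence-u)) (rearranged {v = v} path path′ balanced exchanged length-X)) decomposition)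
      where
      open +-*-Solver
      es : List (Fin k × Fin k)
      es = A ++ segment τ i m ++ R
      u : Sequence k n
      u = t {v = v} path path′ balanced exchanged length-X
      sequence-u : head u ≡ head s′ × transitions u ≡ es
      sequence-u = sequence-t {v = v} path path′ balanced exchanged length-X
      α : ℕ
      α = length A
      end≤n : α + m ≤ n
      end≤n = subst (α + m ≤_) (trans (sym (trans (List.length-++ A) (cong (α +_)
          (trans (List.length-++ (segment τ i m)) (cong (_+ length R) (length-segment τ i m))))))
          (trans (length-es {v = v} path path′ balanced exchanged length-X) (length-transitions s′)))
        (ℕ.+-monoʳ-≤ α (ℕ.m≤m+n m (length R)))
      start<n : α < suc n
      start<n = s≤s (ℕ.≤-trans (ℕ.m≤m+n α m) end≤n)
      end<n : α + m < suc n
      end<n = s≤s end≤n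
      start≡ : toℕ (fromℕ< start<n) ≡ α
      start≡ = Fin.toℕ-fromℕ< start<n
      end≡ : toℕ (fromℕ< end<n) ≡ α + m
      end≡ = Fin.toℕ-fromℕ< end<n
      -- Chosen so that phase + α ≡ i modulo p.
      phase : ℕ
      phase = i + α * pred p
      in-step : ∀ j → τ (i + j) ≡ τ (phase + (α + j))
      in-step j = sym (trans (cong τ (trans
        (solve 4 (λ i α j q → i :+ α :* q :+ (α :+ j) := i :+ j :+ α :* (con 1 :+ q)) refl i α j (pred p))
        (cong (λ q → i + j + α * q) (ℕ.suc-pred p)))) (τ-period (i + j) α))
      path-split : ∀ {x z : Fin k} A {e B} → Path x (A ++ e ∷ B) z → Path x A (proj₁ e)
      path-split []      (step q) = []
      path-split (_ ∷ A) (step q) = step (path-split A q)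
      visits : ∀ j → j ≤ m → vertex (head s′) es (α + j) ≡ τ (i + j)
      visits j j≤m = trans (vertex-++ (segment τ i m ++ R) j (path-split A path)) (vertex-segment τ i m R j j≤m)
      periodic : ∀ (l : Fin (suc n)) → α ≤ toℕ l → toℕ l ≤ α + m → lookup u l ≡ τ (phase + toℕ l)
      periodic l α≤l l≤ with ℕ.m≤n⇒∃[o]m+o≡n α≤l
      ... | j , l≡ = trans (Vec.lookup∘tabulate (vertex (head s′) es ∘ toℕ) l) (trans (cong (vertex (head s′) es) (sym l≡))
        (trans (visits j (ℕ.+-cancelˡ-≤ α j m (subst (_≤ α + m) (sym l≡) l≤)))
          (trans (in-step j) (cong (λ y → τ (phase + y)) l≡))))
      decomposition : Decomposition c u
      decomposition = record
        { a        = fromℕ< start<n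
        ; b        = fromℕ< end<n
        ; a≤b      = subst₂ _≤_ (sym start≡) (sym end≡) (ℕ.m≤m+n α m)
        ; phase    = phase
        ; periodic = λ l a≤l l≤b → periodic l (subst (_≤ toℕ l) start≡ a≤l) (subst (toℕ l ≤_) end≡ l≤b)
        }
      interior≡ : interiorLength decomposition ≡ m
      interior≡ = trans (cong₂ _∸_ end≡ start≡) (ℕ.m+n∸m≡n α m)

    walk : ∀ (D : Decomposition c s′) (long : (2 * k + 4) * p ≤ interiorLength D) (maximal : IsMaximal D) →
           Counting.IsWalk c (head s′) E (interiorLength D) (trade D maximal) long
             (vertex (head s′) E) (prefixLength D) (Decomposition.phase D + prefixLength D) (suffixLength D)
    walk D long maximal = record
      { start    = vertex-0 (head s′) E
      ; interior = inside
      ; edges    = ↭.↭-reflexive (trans (cong (segment (vertex (head s′) E) 0) total) (segment-vertex (sequence-path s′)))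
      }
      where
      module D = Decomposition D
      α I ω : ℕ
      α = toℕ D.a
      I = interiorLength D
      ω = toℕ D.b
      α+I : α + I ≡ ω
      α+I = ℕ.m+[n∸m]≡n D.a≤b
      ω≤n : ω ≤ n
      ω≤n = s≤s⁻¹ (Fin.toℕ<n D.b)
      total : α + (I + suffixLength D) ≡ length E
      total = trans (sym (ℕ.+-assoc α I (suffixLength D))) (trans (cong (_+ suffixLength D) α+I)
        (trans (ℕ.m+[n∸m]≡n ω≤n) (sym (length-transitions s′))))
      inside : ∀ j → j ≤ I → vertex (head s′) E (α + j) ≡ τ (D.phase + α + j)
      inside j j≤I = trans (cong (vertex (head s′) E) (sym at≡)) (trans (sym (lookup-vertex s′ at))
        (trans (D.periodic at (subst (α ≤_) (sym at≡) (ℕ.m≤m+n α j)) (subst (_≤ ω) (sym at≡) at≤ω))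
          (cong τ (trans (cong (D.phase +_) at≡) (sym (ℕ.+-assoc D.phase α j))))))
        where
        at≤ω : α + j ≤ ω
        at≤ω = subst (α + j ≤_) α+I (ℕ.+-monoʳ-≤ α j≤I)
        at<n : α + j < suc n
        at<n = s≤s (ℕ.≤-trans at≤ω ω≤n)
        at : Fin (suc n)
        at = fromℕ< at<n
        at≡ : toℕ at ≡ α + j
        at≡ = Fin.toℕ-fromℕ< at<n

proposition3p4 : ∀ (k : ℕ) → 1 ≤ k →
    ∃ λ (L : ℕ) →
    ∀ (n : ℕ) (s : Sequence k n) → IsViterbiSequence s →
    ∀ (s′ : Sequence k n) → s′ ∼ s →
    ∀ (p : ℕ) .{{_ : NonZero p}} (c : Cycle k p) (D : Decomposition c s′) →
    IsMaximal D → L ≤ interiorLength D →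
    prefixLength D + suffixLength D ≤ (k * p + k) ∸ 2 * p
-- Exchanges need `2 * k + 4` rounds, and a round has at most `k` steps because the states of the
-- cycle are distinct.
proposition3p4 k _ = (2 * k + 4) * k , λ n s (M , positive , viterbi) s′ s′∼s p c D maximal L≤I →
  let open Exchange c M s s′ positive viterbi s′∼s
      long = ℕ.≤-trans (ℕ.*-monoʳ-≤ (2 * k + 4) (Fin.injective⇒≤ (distinct c))) L≤I
      outside = prefixLength D + suffixLength D
  in  subst (λ q → outside ≤ k * p + k ∸ q) (cong (p +_) (sym (ℕ.+-identityʳ p)))
        (ℕ.m+n≤o⇒m≤o∸n outside
          (Counting.outside-bound c (head s′) (transitions s′) (interiorLength D) (trade D maximal) long (<-wellFounded _)
            (walk D long maximal)))
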